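{- Let $T$ be a finite tree. The natural spectral sequence $(E_r,d_r)_{r\ge 1}$ over $\mathbb{F}_2$ associated with the filtered complex $(SC^{\bullet}(T),D+d)$ starts from the Seifert cohomology, i.e. $E_1\cong SH^{\bullet}(T)=\bigoplus_n SH^{\bullet}(T,n)$, and converges to an $E_\infty$ term whose total dimension over $\mathbb{F}_2$ is $0$ or $1$. Its differential $d_1$ is the map on $SH^{\bullet}(T)$ induced by $d$, and for every $n\geq 2$ the higher differential $d_n$ increases the $E$-grading by $n$ and the $Q$-grading by $1$.
   Context: Let $T$ be a finite tree. A configuration $C$ on $T$ is a way of marking some vertices of $T$ by pluses and minuses and making some edges of $T$ red such that every vertex of $T$ is either marked by exactly one of the signs $+,-$ (and is then not an end of any red edge), or is unmarked and is the end of exactly one red edge. Let $Q(C)$ be the number of minuses of $C$, and let $E(C)$ be the sum of the number of minuses and the number of red edges. $SC(T)$ is the $\mathbb{F}_2$-vector space with basis the set of all configurations on $T$; $SC^{k}(T,n)$ is the subspace spanned by configurations with $Q(C)=k$, $E(C)=n$, and $SC^k(T)=\bigoplus_n SC^k(T,n)$. Define linear maps $D,d:SC(T)\to SC(T)$ on basis elements as follows. $D(C)$ is the sum, over all red edges $e$ of $C$, of the two configurations obtained from $C$ by making $e$ non-red and marking one of its ends by $+$ and the other by $-$ (in the two possible ways). $d(C)$ is the sum, over all vertices of $C$ marked by $+$, of the configuration obtained from $C$ by changing that $+$ to $-$. Then $D^2=d^2=0$, $Dd=dD$, so $(D+d)^2=0$; $D$ changes the bigrading $(Q,E)$ by $(1,0)$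 and $d$ changes it by $(1,1)$. The Seifert cohomology $SH^{\bullet}(T)$ is the cohomology of $(SC^{\bullet}(T),D)$; since $D$ preserves $E$, $SH^{\bullet}(T)=\bigoplus_n SH^{\bullet}(T,n)$, where $SH^{\bullet}(T,n)$ is the cohomology of the subcomplex $(SC^{\bullet}(T,n),D)$. The total complex $(SC^{\bullet}(T),D+d)$, graded by $Q$, is filtered by the subcomplexes $F^p=\bigoplus_{n\ge p}SC^{\bullet}(T,n)$; the associated spectral sequence is the one of the bicomplex $SC(T)$ with gradings $E$ and $E-Q$ whose $E_1$ term is the cohomology with respect to $D$. -}

module Defs where

open import Algebra.Bundles using (CommutativeMonoid; Ring; CommutativeRing)
open import Algebra.Module.Bundles using (LeftModule)
open import Algebra.Module.Structures using (IsLeftModule)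
open import Algebra.Module.Morphism.Structures using (module LeftModuleMorphisms)
open import Data.Bool.Base using (Bool; true; false; _∧_; _xor_; if_then_else_)
import Data.Bool.Properties as Bool
open import Data.Bool.Properties
  using (xor-∧-commutativeRing; xor-assoc; xor-comm; xor-identityʳ; xor-same; ∧-zeroʳ)
open import Data.Empty using (⊥-elim)
open import Data.Fin.Base using (Fin; zero; suc; inject₁; fromℕ)
import Data.Fin.Properties as Fin
open import Data.Fin.Subset using (Subset; inside; outside; _∈_) renaming (∣_∣ to card)
open import Data.Fin.Subset.Properties using (_∈?_)
open import Data.Integer.Base as ℤ using (ℤ; +_; 1ℤ)
import Data.Integer.Properties as ℤ
open import Data.List.Base as List using (List; []; _∷_; _++_; concat; concatMap; tabulate; length)
open import Data.List.Relation.Unary.All as All using (All; []; _∷_)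
import Data.List.Relation.Unary.All.Properties as All
import Data.List.Membership.Propositional as List
open import Data.List.Membership.Propositional.Properties using (∈-map⁺; ∈-++⁺ˡ; ∈-++⁺ʳ)
open import Data.List.Relation.Unary.Any using (here; there)
open import Data.Maybe.Base using (Maybe; just; nothing)
import Data.Maybe.Properties as Maybe
open import Data.Nat.Base as ℕ using (ℕ; zero; suc; NonZero; s≤s)
import Data.Nat.Properties as ℕ
open import Data.Product using (Σ; _×_; _,_; proj₁; proj₂; ∃; ∃!; Σ-syntax; ∃-syntax)
open import Data.Product.Properties using () renaming (≡-dec to ×-≡-dec)
open import Data.Sign.Base as Sign using (Sign; opposite)
import Data.Sign.Properties as Sign
open import Data.Sum.Base using (_⊎_; inj₁; inj₂)
open import Data.Unit.Base using (⊤; tt)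
open import Data.Vec.Base as Vec using (Vec; lookup; _[_]≔_; count)
import Data.Vec.Properties as Vec
open import Function.Base using (_∘_; id; case_of_)
open import Function.Definitions using (Injective)
open import Level using (0ℓ)
open import Relation.Binary.Construct.Closure.ReflexiveTransitive using (Star)
open import Relation.Binary.Definitions using (DecidableEquality)
open import Relation.Binary.PropositionalEquality
  using (_≡_; _≢_; refl; sym; trans; cong; cong₂; subst; module ≡-Reasoning)
open import Relation.Nullary using (¬_; Dec; yes; no; does; recompute)
open import Relation.Nullary.Decidable using (dec-true; dec-false)

𝔽₂ : Ring 0ℓ 0ℓ
𝔽₂ = CommutativeRing.ring xor-∧-commutativeRing

Vect : Set₁
Vect = LeftModule 𝔽₂ 0ℓ 0ℓ

Carrier : Vect → Set
Carrier = LeftModule.Carrierᴹ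

equal : (V : Vect) → Carrier V → Carrier V → Set
equal = LeftModule._≈ᴹ_

syntax equal V x y = x ≈[ V ] y

infix 4 equal

module _ (V : Vect) where
  open LeftModule V

  char2 : ∀ x → (x +ᴹ x) ≈ᴹ 0ᴹ
  char2 x = ≈ᴹ-trans (+ᴹ-cong (≈ᴹ-sym (*ₗ-identityˡ x)) (≈ᴹ-sym (*ₗ-identityˡ x)))
            (≈ᴹ-trans (≈ᴹ-sym (*ₗ-distribʳ x true true)) (*ₗ-zeroˡ x))

  neg≈ : ∀ x → (-ᴹ x) ≈ᴹ x
  neg≈ x = ≈ᴹ-sym (uniqueʳ‿-ᴹ x x (char2 x))

record LinearMap (V W : Vect) : Set where
  constructor linear
  private
    module V = LeftModule V
    module W = LeftModule W
  open LeftModuleMorphisms V.rawLeftModule W.rawLeftModule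
  field
    fun            : Carrier V → Carrier W
    isHomomorphism : IsLeftModuleHomomorphism fun
  open IsLeftModuleHomomorphism isHomomorphism public
    using (⟦⟧-cong; +ᴹ-homo; *ₗ-homo; 0ᴹ-homo; -ᴹ-homo)

infixl 20 _$_
_$_ : ∀ {V W} → LinearMap V W → Carrier V → Carrier W
_$_ = LinearMap.fun

IsIso : (V W : Vect) → (Carrier V → Carrier W) → Set
IsIso V W = IsLeftModuleIsomorphism
  where open LeftModuleMorphisms (LeftModule.rawLeftModule V) (LeftModule.rawLeftModule W)

mkLinear : (V W : Vect) (let module V = LeftModule V; module W = LeftModule W)
           (f : Carrier V → Carrier W) →
           (∀ {x y} → x V.≈ᴹ y → f x W.≈ᴹ f y) →
           (∀ x y → f (x V.+ᴹ y) W.≈ᴹ (f x W.+ᴹ f y)) →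
           LinearMap V W
mkLinear V W f f-cong f-+ .LinearMap.fun            = f
mkLinear V W f f-cong f-+ .LinearMap.isHomomorphism = record
    { +ᴹ-isGroupHomomorphism = record
      { isMonoidHomomorphism = record
        { isMagmaHomomorphism = record
          { isRelHomomorphism = record { cong = f-cong }
          ; homo              = f-+ }
        ; ε-homo = f-0 }
      ; ⁻¹-homo = λ x → W.≈ᴹ-trans (f-cong (neg≈ V x)) (W.≈ᴹ-sym (neg≈ W (f x))) }
    ; *ₗ-homo = λ where
        true  x → W.≈ᴹ-trans (f-cong (V.*ₗ-identityˡ x)) (W.≈ᴹ-sym (W.*ₗ-identityˡ (f x)))
        false x → W.≈ᴹ-trans (f-cong (V.*ₗ-zeroˡ x))
                 (W.≈ᴹ-trans f-0 (W.≈ᴹ-sym (W.*ₗ-zeroˡ (f x)))) }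
  where
  module V = LeftModule V
  module W = LeftModule W
  f-0 : f V.0ᴹ W.≈ᴹ W.0ᴹ
  f-0 = W.≈ᴹ-trans (f-cong (V.≈ᴹ-sym (char2 V V.0ᴹ)))
       (W.≈ᴹ-trans (f-+ V.0ᴹ V.0ᴹ) (char2 W (f V.0ᴹ)))

idMap : (V : Vect) → LinearMap V V
idMap V = mkLinear V V id id (λ _ _ → LeftModule.≈ᴹ-refl V)

_⊕_ : ∀ {V W} → LinearMap V W → LinearMap V W → LinearMap V W
_⊕_ {V} {W} f g = mkLinear V W (λ x → (f $ x) +ᴹ (g $ x))
  (λ e → +ᴹ-cong (LinearMap.⟦⟧-cong f e) (LinearMap.⟦⟧-cong g e))
  (λ x y → ≈ᴹ-trans (+ᴹ-cong (LinearMap.+ᴹ-homo f x y) (LinearMap.+ᴹ-homo g x y))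
                    (interchange (f $ x) (f $ y) (g $ x) (g $ y)))
  where
  open LeftModule W
  open import Algebra.Properties.CommutativeSemigroup
    (CommutativeMonoid.commutativeSemigroup (LeftModule.+ᴹ-commutativeMonoid W))
    using (interchange)

record Subspace (V : Vect) : Set₁ where
  open LeftModule V
  field
    Mem   : Carrierᴹ → Set
    resp  : ∀ {x y} → x ≈ᴹ y → Mem x → Mem y
    0-mem : Mem 0ᴹ
    +-mem : ∀ {x y} → Mem x → Mem y → Mem (x +ᴹ y)
    *-mem : ∀ b {x} → Mem x → Mem (b *ₗ x)

infix 4 _∋_
_∋_ : ∀ {V} → Subspace V → Carrier V → Set
_∋_ = Subspace.Mem

mkSubspace : (V : Vect) (let open LeftModule V) (M : Carrierᴹ → Set) →
             (∀ {x y} → x ≈ᴹ y → M x → M y) → M 0ᴹ →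
             (∀ {x y} → M x → M y → M (x +ᴹ y)) → Subspace V
mkSubspace V M r z a .Subspace.Mem   = M
mkSubspace V M r z a .Subspace.resp  = r
mkSubspace V M r z a .Subspace.0-mem = z
mkSubspace V M r z a .Subspace.+-mem = a
mkSubspace V M r z a .Subspace.*-mem true  {x} m =
  r (LeftModule.≈ᴹ-sym V (LeftModule.*ₗ-identityˡ V x)) m
mkSubspace V M r z a .Subspace.*-mem false {x} m =
  r (LeftModule.≈ᴹ-sym V (LeftModule.*ₗ-zeroˡ V x)) z

whole : (V : Vect) → Subspace V
whole V = mkSubspace V (λ _ → ⊤) (λ _ _ → tt) tt (λ _ _ → tt)

infixl 7 _∩_
_∩_ : ∀ {V} → Subspace V → Subspace V → Subspace V
_∩_ {V} S S′ = mkSubspace V (λ x → S ∋ x × S′ ∋ x)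
  (λ { e (s , s′) → Subspace.resp S e s , Subspace.resp S′ e s′ })
  (Subspace.0-mem S , Subspace.0-mem S′)
  (λ { (s , s′) (t , t′) → Subspace.+-mem S s t , Subspace.+-mem S′ s′ t′ })

infixl 6 _⊞_
_⊞_ : ∀ {V} → Subspace V → Subspace V → Subspace V
_⊞_ {V} S S′ = mkSubspace V
  (λ x → ∃[ s ] ∃[ s′ ] (S ∋ s × S′ ∋ s′ × x ≈ᴹ (s +ᴹ s′)))
  (λ { e (s , s′ , m , m′ , q) → s , s′ , m , m′ , ≈ᴹ-trans (≈ᴹ-sym e) q })
  (0ᴹ , 0ᴹ , Subspace.0-mem S , Subspace.0-mem S′ , ≈ᴹ-sym (+ᴹ-identityˡ 0ᴹ))
  (λ { (s , s′ , m , m′ , q) (t , t′ , n , n′ , q′) →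
       s +ᴹ t , s′ +ᴹ t′ , Subspace.+-mem S m n , Subspace.+-mem S′ m′ n′ ,
       ≈ᴹ-trans (+ᴹ-cong q q′) (interchange s s′ t t′) })
  where
  open LeftModule V
  open import Algebra.Properties.CommutativeSemigroup
    (CommutativeMonoid.commutativeSemigroup (LeftModule.+ᴹ-commutativeMonoid V))
    using (interchange)

module _ {V W : Vect} (f : LinearMap V W) where
  private
    module V = LeftModule V
    module W = LeftModule W
  open LinearMap f

  image : Subspace V → Subspace W
  image S = mkSubspace W (λ y → ∃[ x ] (S ∋ x × y W.≈ᴹ (f $ x)))
    (λ { e (x , m , q) → x , m , W.≈ᴹ-trans (W.≈ᴹ-sym e) q })
    (V.0ᴹ , Subspace.0-mem S , W.≈ᴹ-sym 0ᴹ-homo)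
    (λ { (x , m , q) (y , n , q′) → x V.+ᴹ y , Subspace.+-mem S m n ,
         W.≈ᴹ-trans (W.+ᴹ-cong q q′) (W.≈ᴹ-sym (+ᴹ-homo x y)) })

  preimage : Subspace W → Subspace V
  preimage S = mkSubspace V (λ x → S ∋ (f $ x))
    (λ e → Subspace.resp S (⟦⟧-cong e))
    (Subspace.resp S (W.≈ᴹ-sym 0ᴹ-homo) (Subspace.0-mem S))
    (λ m n → Subspace.resp S (W.≈ᴹ-sym (+ᴹ-homo _ _)) (Subspace.+-mem S m n))

  kernel : Subspace V
  kernel = mkSubspace V (λ x → (f $ x) W.≈ᴹ W.0ᴹ)
    (λ e q → W.≈ᴹ-trans (⟦⟧-cong (V.≈ᴹ-sym e)) q)
    0ᴹ-homo
    (λ q q′ → W.≈ᴹ-trans (+ᴹ-homo _ _) (W.≈ᴹ-trans (W.+ᴹ-cong q q′) (W.+ᴹ-identityˡ W.0ᴹ)))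

-- Z / (Z ∩ B): the elements are those of Z, and two of them are equal when
-- their difference lies in B.

module _ (V : Vect) (Z B : Subspace V) where
  private
    open LeftModule V
    module Z = Subspace Z
    module B = Subspace B
    open import Algebra.Properties.AbelianGroup +ᴹ-abelianGroup using (⁻¹-∙-comm)
    open import Algebra.Properties.CommutativeSemigroup
      (CommutativeMonoid.commutativeSemigroup +ᴹ-commutativeMonoid)
      using (interchange)

  infix 4 _~_
  record _~_ (x y : Σ Carrierᴹ Z.Mem) : Set where
    constructor difference∈
    field difference : B ∋ (proj₁ x +ᴹ -ᴹ proj₁ y)

  open _~_ public

  ≈⇒~ : ∀ {x y} → proj₁ x ≈ᴹ proj₁ y → x ~ y
  ≈⇒~ e = difference∈ (B.resp
    (≈ᴹ-sym (≈ᴹ-trans (+ᴹ-cong e ≈ᴹ-refl) (proj₂ -ᴹ‿inverse _))) B.0-mem)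

  ~-sym : ∀ {x y} → x ~ y → y ~ x
  ~-sym {x , _} {y , _} (difference∈ p) = difference∈ (B.resp
    (≈ᴹ-trans (+ᴹ-comm x (-ᴹ y)) (+ᴹ-cong (neg≈ V y) (≈ᴹ-sym (neg≈ V x)))) p)

  ~-trans : ∀ {x y z} → x ~ y → y ~ z → x ~ z
  ~-trans {x , _} {y , _} {z , _} (difference∈ p) (difference∈ q) = difference∈ (B.resp
    (≈ᴹ-trans (+ᴹ-assoc x (-ᴹ y) (y +ᴹ -ᴹ z))
      (+ᴹ-cong ≈ᴹ-refl
        (≈ᴹ-trans (≈ᴹ-sym (+ᴹ-assoc (-ᴹ y) y (-ᴹ z)))
          (≈ᴹ-trans (+ᴹ-cong (proj₁ -ᴹ‿inverse y) ≈ᴹ-refl) (+ᴹ-identityˡ (-ᴹ z))))))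
    (B.+-mem p q))

  Subquotient : Vect
  Subquotient .LeftModule.Carrierᴹ = Σ Carrierᴹ Z.Mem
  Subquotient .LeftModule._≈ᴹ_     = _~_
  Subquotient .LeftModule._+ᴹ_ (x , m) (y , n) = x +ᴹ y , Z.+-mem m n
  Subquotient .LeftModule._*ₗ_ b (x , m) = b *ₗ x , Z.*-mem b m
  Subquotient .LeftModule.0ᴹ       = 0ᴹ , Z.0-mem
  Subquotient .LeftModule.-ᴹ_ (x , m) = -ᴹ x , Z.resp (≈ᴹ-sym (neg≈ V x)) m
  Subquotient .LeftModule.isLeftModule = record
    { isLeftSemimodule = record
      { +ᴹ-isCommutativeMonoid = record
        { isMonoid = record
          { isSemigroup = record
            { isMagma = record
              { isEquivalence = record { refl = ≈⇒~ ≈ᴹ-refl ; sym = ~-sym ; trans = ~-trans }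
              ; ∙-cong = λ { {x , _} {y , _} {z , _} {w , _} (difference∈ p) (difference∈ q) →
                  difference∈ (B.resp
                    (≈ᴹ-trans (interchange x (-ᴹ y) z (-ᴹ w)) (+ᴹ-cong ≈ᴹ-refl (⁻¹-∙-comm y w)))
                    (B.+-mem p q)) } }
            ; assoc = λ x y z → ≈⇒~ (+ᴹ-assoc (proj₁ x) (proj₁ y) (proj₁ z)) }
          ; identity = (λ x → ≈⇒~ (+ᴹ-identityˡ (proj₁ x)))
                     , (λ x → ≈⇒~ (+ᴹ-identityʳ (proj₁ x))) }
        ; comm = λ x y → ≈⇒~ (+ᴹ-comm (proj₁ x) (proj₁ y)) }
      ; isPreleftSemimodule = record
        { *ₗ-cong      = λ { {b} {_} {x , _} {y , _} refl (difference∈ p) → difference∈ (B.resp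
            (≈ᴹ-trans (*ₗ-distribˡ b x (-ᴹ y)) (+ᴹ-cong ≈ᴹ-refl
              (≈ᴹ-trans (*ₗ-cong refl (neg≈ V y)) (≈ᴹ-sym (neg≈ V (b *ₗ y))))))
            (B.*-mem b p)) }
        ; *ₗ-zeroˡ     = λ x → ≈⇒~ (*ₗ-zeroˡ (proj₁ x))
        ; *ₗ-distribʳ  = λ x b c → ≈⇒~ (*ₗ-distribʳ (proj₁ x) b c)
        ; *ₗ-identityˡ = λ x → ≈⇒~ (*ₗ-identityˡ (proj₁ x))
        ; *ₗ-assoc     = λ b c x → ≈⇒~ (*ₗ-assoc b c (proj₁ x))
        ; *ₗ-zeroʳ     = λ b → ≈⇒~ (*ₗ-zeroʳ b)
        ; *ₗ-distribˡ  = λ b x y → ≈⇒~ (*ₗ-distribˡ b (proj₁ x) (proj₁ y)) } }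
    ; -ᴹ‿cong    = λ { {x , _} {y , _} (difference∈ p) → difference∈ (B.resp
        (+ᴹ-cong (≈ᴹ-sym (neg≈ V x)) (-ᴹ‿cong (≈ᴹ-sym (neg≈ V y)))) p) }
    ; -ᴹ‿inverse = (λ x → ≈⇒~ (proj₁ -ᴹ‿inverse (proj₁ x)))
                 , (λ x → ≈⇒~ (proj₂ -ᴹ‿inverse (proj₁ x))) }

induced : ∀ {V W} (f : LinearMap V W) {Z B : Subspace V} {Z′ B′ : Subspace W} →
          (∀ {x} → Z ∋ x → Z′ ∋ f $ x) → (∀ {x} → B ∋ x → B′ ∋ f $ x) →
          LinearMap (Subquotient V Z B) (Subquotient W Z′ B′)
induced {V} {W} f {Z} {B} {Z′} {B′} fZ fB = mkLinear (Subquotient V Z B) (Subquotient W Z′ B′)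
  (λ { (x , m) → (f $ x) , fZ m })
  (λ { {x , _} {y , _} (difference∈ e) → difference∈ (Subspace.resp B′
       (W.≈ᴹ-trans (+ᴹ-homo x (V.-ᴹ y)) (W.+ᴹ-cong W.≈ᴹ-refl (-ᴹ-homo y))) (fB e)) })
  (λ x y → ≈⇒~ W Z′ B′ (+ᴹ-homo (proj₁ x) (proj₁ y)))
  where
  module V = LeftModule V
  module W = LeftModule W
  open LinearMap f

-- The cohomology in degree k of the complex with terms C k ⊆ V and
-- differential the restriction of ∂ : V → V.

Cohomology : (V : Vect) → LinearMap V V → (ℤ → Subspace V) → ℤ → Vect
Cohomology V ∂ C k = Subquotient V (C k ∩ kernel ∂) (image ∂ (C (k ℤ.- 1ℤ)))

-- The elements are the finitely supported families; the list support may be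
-- larger than necessary and has no bearing on equality.

module _ {I : Set} (A : I → Vect) where
  private
    open module M {i : I} = LeftModule (A i) hiding (Carrierᴹ; isLeftModule)

  record FinSupp : Set where
    constructor family
    field
      component : ∀ i → Carrier (A i)
      support   : List I
      vanishes  : ∀ i → ¬ (i List.∈ support) → component i ≈ᴹ 0ᴹ

  open FinSupp

  record Pointwise (f g : FinSupp) : Set where
    constructor pointwise
    field at-index : ∀ i → component f i ≈ᴹ component g i

  open Pointwise

  ⨁ : Vect
  ⨁ .LeftModule.Carrierᴹ = FinSupp
  ⨁ .LeftModule._≈ᴹ_ = Pointwise
  ⨁ .LeftModule._+ᴹ_ f g = family (λ i → component f i +ᴹ component g i) (support f ++ support g)
    (λ i i∉ → ≈ᴹ-trans (+ᴹ-cong (vanishes f i (i∉ ∘ ∈-++⁺ˡ)) (vanishes g i (i∉ ∘ ∈-++⁺ʳ (support f))))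
                       (+ᴹ-identityˡ 0ᴹ))
  ⨁ .LeftModule._*ₗ_ b f = family (λ i → b *ₗ component f i) (support f)
    (λ i i∉ → ≈ᴹ-trans (*ₗ-cong refl (vanishes f i i∉)) (*ₗ-zeroʳ b))
  ⨁ .LeftModule.0ᴹ = family (λ i → 0ᴹ) [] (λ i _ → ≈ᴹ-refl)
  ⨁ .LeftModule.-ᴹ_ f = family (λ i → -ᴹ component f i) (support f)
    (λ i i∉ → ≈ᴹ-trans (neg≈ (A i) (component f i)) (vanishes f i i∉))
  ⨁ .LeftModule.isLeftModule = record
    { isLeftSemimodule = record
      { +ᴹ-isCommutativeMonoid = record
        { isMonoid = record
          { isSemigroup = record
            { isMagma = record
              { isEquivalence = record
                { refl  = pointwise λ i → ≈ᴹ-refl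
                ; sym   = λ e → pointwise λ i → ≈ᴹ-sym (at-index e i)
                ; trans = λ e e′ → pointwise λ i → ≈ᴹ-trans (at-index e i) (at-index e′ i) }
              ; ∙-cong = λ e e′ → pointwise λ i → +ᴹ-cong (at-index e i) (at-index e′ i) }
            ; assoc = λ _ _ _ → pointwise λ i → +ᴹ-assoc _ _ _ }
          ; identity = (λ _ → pointwise λ i → +ᴹ-identityˡ _) , (λ _ → pointwise λ i → +ᴹ-identityʳ _) }
        ; comm = λ _ _ → pointwise λ i → +ᴹ-comm _ _ }
      ; isPreleftSemimodule = record
        { *ₗ-cong      = λ p e → pointwise λ i → *ₗ-cong p (at-index e i)
        ; *ₗ-zeroˡ     = λ _ → pointwise λ i → *ₗ-zeroˡ _
        ; *ₗ-distribʳ  = λ _ b c → pointwise λ i → *ₗ-distribʳ _ b c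
        ; *ₗ-identityˡ = λ _ → pointwise λ i → *ₗ-identityˡ _
        ; *ₗ-assoc     = λ b c _ → pointwise λ i → *ₗ-assoc b c _
        ; *ₗ-zeroʳ     = λ b → pointwise λ i → *ₗ-zeroʳ b
        ; *ₗ-distribˡ  = λ b _ _ → pointwise λ i → *ₗ-distribˡ b _ _ } }
    ; -ᴹ‿cong    = λ e → pointwise λ i → -ᴹ‿cong (at-index e i)
    ; -ᴹ‿inverse = (λ _ → pointwise λ i → proj₁ -ᴹ‿inverse _)
                 , (λ _ → pointwise λ i → proj₂ -ᴹ‿inverse _) }

open FinSupp public
open Pointwise public

module _ {I : Set} (_≟_ : DecidableEquality I) {A : I → Vect} where

  private
    ι-fun : ∀ i → Carrier (A i) → ∀ j → Carrier (A j)
    ι-fun i x j with i ≟ j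
    ... | yes refl = x
    ... | no  _    = LeftModule.0ᴹ (A j)

    ι-supp : ∀ i x j → ¬ (j List.∈ (i ∷ [])) → ι-fun i x j ≈[ A j ] LeftModule.0ᴹ (A j)
    ι-supp i x j j∉ with i ≟ j
    ... | yes refl = ⊥-elim (j∉ (here refl))
    ... | no  _    = LeftModule.≈ᴹ-refl (A j)

  ι : ∀ i → Carrier (A i) → Carrier (⨁ A)
  ι i x = family (ι-fun i x) (i ∷ []) (ι-supp i x)

-- The map of direct sums whose j-th component is g j applied to component
-- σ j of the argument; τ is a left inverse of σ.

⨁-map : {I J : Set} (A : I → Vect) (B : J → Vect) (σ : J → I) (τ : I → J) →
        (∀ j → τ (σ j) ≡ j) → (∀ j → LinearMap (A (σ j)) (B j)) → LinearMap (⨁ A) (⨁ B)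
⨁-map A B σ τ τσ g = mkLinear (⨁ A) (⨁ B)
  (λ f → family (λ j → g j $ component f (σ j)) (List.map τ (support f)) (λ j j∉ →
    LeftModule.≈ᴹ-trans (B j)
      (LinearMap.⟦⟧-cong (g j) (vanishes f (σ j)
        (λ m → j∉ (subst (List._∈ List.map τ (support f)) (τσ j) (∈-map⁺ τ m)))))
      (LinearMap.0ᴹ-homo (g j))))
  (λ e → pointwise λ j → LinearMap.⟦⟧-cong (g j) (at-index e (σ j)))
  (λ f h → pointwise λ j → LinearMap.+ᴹ-homo (g j) (component f (σ j)) (component h (σ j)))

module _ (V : Vect) where
  open LeftModule V
  open import Algebra.Definitions.RawMonoid +ᴹ-rawMonoid using (sum)

  combination : ∀ {n} → (Fin n → Bool) → (Fin n → Carrierᴹ) → Carrierᴹ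
  combination c v = sum (λ i → c i *ₗ v i)

  record HasDimension (n : ℕ) : Set where
    field
      basis       : Fin n → Carrierᴹ
      spanning    : ∀ x → ∃[ c ] x ≈ᴹ combination c basis
      independent : ∀ c → combination c basis ≈ᴹ 0ᴹ → ∀ i → c i ≡ false

-- A cochain complex of 𝔽₂-vector spaces whose terms C k are subspaces of an
-- ambient space V on which the differential is defined, with a decreasing
-- filtration; F p k is the degree k part of the p-th filtration step.

record FilteredComplex : Set₁ where
  field
    V    : Vect
    ∂    : LinearMap V V
    C    : ℤ → Subspace V
    F    : ℤ → ℤ → Subspace V
    ∂²≈0 : ∀ x → ∂ $ (∂ $ x) ≈[ V ] LeftModule.0ᴹ V
    ∂-C  : ∀ {k x} → C k ∋ x → C (k ℤ.+ 1ℤ) ∋ ∂ $ x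
    ∂-F  : ∀ {p k x} → F p k ∋ x → F p (k ℤ.+ 1ℤ) ∋ ∂ $ x
    F⊆C  : ∀ {p k x} → F p k ∋ x → C k ∋ x
    F-decreasing : ∀ {p q k x} → p ℤ.≤ q → F q k ∋ x → F p k ∋ x

ℤ²-≟ : DecidableEquality (ℤ × ℤ)
ℤ²-≟ = ×-≡-dec ℤ._≟_ ℤ._≟_

[p-a]+a : ∀ p a → (p ℤ.- a) ℤ.+ a ≡ p
[p-a]+a p a = trans (ℤ.+-assoc p (ℤ.- a) a)
  (trans (cong (λ q → p ℤ.+ q) (ℤ.+-inverseˡ a)) (ℤ.+-identityʳ p))

[p+a]-a : ∀ p a → (p ℤ.+ a) ℤ.- a ≡ p
[p+a]-a p a = trans (ℤ.+-assoc p a (ℤ.- a))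
  (trans (cong (λ q → p ℤ.+ q) (ℤ.+-inverseʳ a)) (ℤ.+-identityʳ p))

[p+1]+[r-1] : ∀ p r → (p ℤ.+ 1ℤ) ℤ.+ (r ℤ.- 1ℤ) ≡ p ℤ.+ r
[p+1]+[r-1] p r = trans (ℤ.+-assoc p 1ℤ (r ℤ.- 1ℤ)) (cong (λ q → p ℤ.+ q)
  (trans (ℤ.+-comm 1ℤ (r ℤ.- 1ℤ)) ([p-a]+a r 1ℤ)))

[p+r]-r+1 : ∀ p r → ((p ℤ.+ r) ℤ.- r) ℤ.+ 1ℤ ≡ p ℤ.+ 1ℤ
[p+r]-r+1 p r = cong (ℤ._+ 1ℤ) ([p+a]-a p r)

module SpectralSequence (S : FilteredComplex) where
  open FilteredComplex S
  open LeftModule V using (0ᴹ; _+ᴹ_; -ᴹ_; ≈ᴹ-refl; ≈ᴹ-sym; ≈ᴹ-trans; +ᴹ-cong)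

  -- E r p k is the term of filtration index p and total degree k, a subquotient
  -- of F p k / F (p + 1) k.

  Z : (r p k : ℤ) → Subspace V
  Z r p k = F p k ∩ preimage ∂ (F (p ℤ.+ r) (k ℤ.+ 1ℤ))

  B : (r p k : ℤ) → Subspace V
  B r p k = Z (r ℤ.- 1ℤ) (p ℤ.+ 1ℤ) k ⊞ image ∂ (Z (r ℤ.- 1ℤ) (p ℤ.- r ℤ.+ 1ℤ) (k ℤ.- 1ℤ))

  E : ℕ → ℤ → ℤ → Vect
  E r p k = Subquotient V (Z (+ r) p k) (B (+ r) p k)

  ∂Z : ∀ r {p k x} → Z r p k ∋ x → Z r (p ℤ.+ r) (k ℤ.+ 1ℤ) ∋ ∂ $ x
  ∂Z r {p} {k} {x} (_ , m) = m , Subspace.resp (F (p ℤ.+ r ℤ.+ r) (k ℤ.+ 1ℤ ℤ.+ 1ℤ))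
    (≈ᴹ-sym (∂²≈0 x)) (Subspace.0-mem (F (p ℤ.+ r ℤ.+ r) (k ℤ.+ 1ℤ ℤ.+ 1ℤ)))

  ∂B : ∀ r {p k x} → B r p k ∋ x → B r (p ℤ.+ r) (k ℤ.+ 1ℤ) ∋ ∂ $ x
  ∂B r {p} {k} {x} (s , s′ , m , (y , _ , e) , q) =
    0ᴹ , ∂ $ s , Subspace.0-mem (Z (r ℤ.- 1ℤ) (p ℤ.+ r ℤ.+ 1ℤ) (k ℤ.+ 1ℤ)) ,
    (s , subst (λ p′ → Z (r ℤ.- 1ℤ) p′ (k ℤ.+ 1ℤ ℤ.- 1ℤ) ∋ s) (sym ([p+r]-r+1 p r))
           (subst (λ k′ → Z (r ℤ.- 1ℤ) (p ℤ.+ 1ℤ) k′ ∋ s) (sym ([p+a]-a k 1ℤ)) m) ,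
     ≈ᴹ-refl) ,
    ≈ᴹ-trans (LinearMap.⟦⟧-cong ∂ q) (≈ᴹ-trans (LinearMap.+ᴹ-homo ∂ s s′)
      (≈ᴹ-trans (+ᴹ-cong ≈ᴹ-refl (≈ᴹ-trans (LinearMap.⟦⟧-cong ∂ e) (∂²≈0 y)))
                (LeftModule.+ᴹ-comm V (∂ $ s) 0ᴹ)))

  -- The component of dᵣ from E r p k to E r (p + r) (k + 1). The target indices
  -- are arbitrary integers equal to these sums, so that the components arriving
  -- in E r p k have the same form.

  δ : ∀ r {p k p′ k′} → p ℤ.+ + r ≡ p′ → k ℤ.+ 1ℤ ≡ k′ → LinearMap (E r p k) (E r p′ k′)
  δ r {p} {k} refl refl = induced ∂ (∂Z (+ r) {p} {k}) (∂B (+ r) {p} {k})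

  δ-out : ∀ r p k → LinearMap (E r p k) (E r (p ℤ.+ + r) (k ℤ.+ 1ℤ))
  δ-out r p k = δ r refl refl

  δ-in : ∀ r p k → LinearMap (E r (p ℤ.- + r) (k ℤ.- 1ℤ)) (E r p k)
  δ-in r p k = δ r ([p-a]+a p (+ r)) ([p-a]+a k 1ℤ)

  page : ℕ → Vect
  page r = ⨁ λ ((p , k) : ℤ × ℤ) → E r p k

  d : ∀ r → LinearMap (page r) (page r)
  d r = ⨁-map (λ (p , k) → E r p k) (λ (p , k) → E r p k)
    (λ (p , k) → p ℤ.- + r , k ℤ.- 1ℤ) (λ (p , k) → p ℤ.+ + r , k ℤ.+ 1ℤ)
    (λ (p , k) → cong₂ _,_ ([p-a]+a p (+ r)) ([p-a]+a k 1ℤ))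
    (λ (p , k) → δ-in r p k)

  at : ∀ r p k → Carrier (E r p k) → Carrier (page r)
  at r p k = ι ℤ²-≟ (p , k)

  -- The cohomology of the page (E r , d r) at position (p , k).

  HE : ℕ → ℤ → ℤ → Vect
  HE r p k = Subquotient (E r p k) (kernel (δ-out r p k)) (image (δ-in r p k) (whole _))

  -- The class of x in E (r + 1) goes to the class in HE r of the class of x in E r.

  turn : ∀ r p k → Carrier (E (suc r) p k) → Carrier (HE r p k)
  turn r p k (x , m , n) = (x , m , F-decreasing (ℤ.+-monoʳ-≤ p (ℤ.+≤+ (ℕ.n≤1+n r))) n) ,
    difference∈ (Subspace.resp (B (+ r) (p ℤ.+ + r) (k ℤ.+ 1ℤ))
      (≈ᴹ-sym (≈ᴹ-trans (+ᴹ-cong ≈ᴹ-refl (neg≈ V 0ᴹ)) (LeftModule.+ᴹ-identityʳ V (∂ $ x))))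
      (∂ $ x , 0ᴹ , (subst (λ q → F q (k ℤ.+ 1ℤ) ∋ ∂ $ x) p+[1+r] n , F0) ,
       Subspace.0-mem (image ∂ (Z (+ r ℤ.- 1ℤ) (p ℤ.+ + r ℤ.- + r ℤ.+ 1ℤ) (k ℤ.+ 1ℤ ℤ.- 1ℤ))) ,
       ≈ᴹ-sym (LeftModule.+ᴹ-identityʳ V (∂ $ x))))
    where
    p+[1+r] : p ℤ.+ + suc r ≡ p ℤ.+ + r ℤ.+ 1ℤ
    p+[1+r] = trans (cong (λ q → p ℤ.+ q) (ℤ.+-comm 1ℤ (+ r))) (sym (ℤ.+-assoc p (+ r) 1ℤ))
    F0 : F (p ℤ.+ + r ℤ.+ 1ℤ ℤ.+ (+ r ℤ.- 1ℤ)) (k ℤ.+ 1ℤ ℤ.+ 1ℤ) ∋ ∂ $ (∂ $ x)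
    F0 = Subspace.resp (F _ _) (≈ᴹ-sym (∂²≈0 x)) (Subspace.0-mem (F _ _))

  Z∞ : (p k : ℤ) → Subspace V
  Z∞ p k = F p k ∩ kernel ∂

  B∞ : (p k : ℤ) → Subspace V
  B∞ p k = F p k ∩ image ∂ (C (k ℤ.- 1ℤ))

  E∞ : ℤ → ℤ → Vect
  E∞ p k = Subquotient V (Z∞ p k) (Z∞ (p ℤ.+ 1ℤ) k ⊞ B∞ p k)

  page∞ : Vect
  page∞ = ⨁ λ ((p , k) : ℤ × ℤ) → E∞ p k

  E∞→E : ∀ r p k → Carrier (E∞ p k) → Carrier (E r p k)
  E∞→E r p k (x , m , e) = x , m , Subspace.resp (F _ _) (≈ᴹ-sym e) (Subspace.0-mem (F _ _))

  H : ℤ → Vect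
  H = Cohomology V ∂ C

  HF : ℤ → ℤ → Vect
  HF p = Cohomology V ∂ (F p)

  HF→H : ∀ p k → LinearMap (HF p k) (H k)
  HF→H p k = induced (idMap V) (λ { (m , e) → F⊆C m , e }) (λ { (y , m , e) → y , F⊆C m , e })

  FH : (p k : ℤ) → Subspace (H k)
  FH p k = image (HF→H p k) (whole _)

  grH : ℤ → ℤ → Vect
  grH p k = Subquotient (H k) (FH p k) (FH (p ℤ.+ 1ℤ) k)

  E∞→grH : ∀ p k → Carrier (E∞ p k) → Carrier (grH p k)
  E∞→grH p k x = HF→H p k $ x , x , tt , LeftModule.≈ᴹ-refl (H k)

  IsSpectralSequence : Set
  IsSpectralSequence = ∀ r → 1 ℕ.≤ r →
      (∀ ξ → d r $ (d r $ ξ) ≈[ page r ] LeftModule.0ᴹ (page r))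
    × (∀ p k → IsIso (E (suc r) p k) (HE r p k) (turn r p k))

  Converges : Set
  Converges =
      (∃[ r₀ ] ∀ r → r₀ ℕ.≤ r → (∀ ξ → d r $ ξ ≈[ page r ] LeftModule.0ᴹ (page r))
                              × (∀ p k → IsIso (E∞ p k) (E r p k) (E∞→E r p k)))
    × (∀ p k → IsIso (E∞ p k) (grH p k) (E∞→grH p k))

HasBidegree : {A : ℤ × ℤ → Vect} → LinearMap (⨁ A) (⨁ A) → ℤ × ℤ → Set
HasBidegree {A} f (a , b) =
  ∀ p k x → ∃[ y ] f $ ι ℤ²-≟ (p , k) x ≈[ ⨁ A ] ι ℤ²-≟ (p ℤ.+ a , k ℤ.+ b) y

open CommutativeRing xor-∧-commutativeRing using (+-commutativeMonoid)
open import Algebra.Properties.CommutativeMonoid.Sum +-commutativeMonoid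
  using (sum; sum-cong-≗; ∑-comm; ∑-distrib-+)

xor≡false : ∀ {a b} → a xor b ≡ false → a ≡ b
xor≡false {false} {false} _ = refl
xor≡false {true}  {true}  _ = refl

sum-false : ∀ {n} {f : Fin n → Bool} → (∀ i → f i ≡ false) → sum f ≡ false
sum-false {zero}  _ = refl
sum-false {suc n} z rewrite z zero = sum-false (z ∘ suc)

sum-symmetric : ∀ {n} (φ : Fin n → Fin n → Bool) →
                (∀ i → φ i i ≡ false) → (∀ i j → φ i j ≡ φ j i) →
                sum (λ i → sum (φ i)) ≡ false
sum-symmetric {zero}  φ diag symm = refl
sum-symmetric {suc n} φ diag symm
  rewrite diag zero
        | ∑-distrib-+ (λ i → φ (suc i) zero) (λ i → sum (λ j → φ (suc i) (suc j)))
        | sum-symmetric (λ i j → φ (suc i) (suc j)) (diag ∘ suc) (λ i j → symm (suc i) (suc j))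
        | xor-identityʳ (sum (λ i → φ (suc i) zero))
        | sum-cong-≗ (λ i → symm zero (suc i))
  = xor-same (sum (λ i → φ (suc i) zero))

sum-delta : ∀ {n} (s : Fin n) (f : Fin n → Bool) → (∀ i → i ≢ s → f i ≡ false) → sum f ≡ f s
sum-delta zero    f z
  rewrite sum-false {f = f ∘ suc} (λ i → z (suc i) (λ ())) = xor-identityʳ (f zero)
sum-delta (suc s) f z rewrite z zero (λ ()) =
  sum-delta s (f ∘ suc) (λ i i≢s → z (suc i) (i≢s ∘ Fin.suc-injective))

sum-pair : ∀ {n} (s t : Fin n) (f : Fin n → Bool) → s ≢ t → f s ≡ f t →
           (∀ i → i ≢ s → i ≢ t → f i ≡ false) → sum f ≡ false
sum-pair {n} s t f s≢t fs≡ft z = begin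
  sum f                                           ≡⟨ sum-cong-≗ split ⟩
  sum (λ i → on s i xor on t i)                   ≡⟨ ∑-distrib-+ (on s) (on t) ⟩
  sum (on s) xor sum (on t)                       ≡⟨ cong₂ _xor_ (at-sum s) (at-sum t) ⟩
  f s xor f t                                     ≡⟨ cong (_xor f t) fs≡ft ⟩
  f t xor f t                                     ≡⟨ xor-same (f t) ⟩
  false                                           ∎
  where
  open ≡-Reasoning
  on : Fin n → Fin n → Bool
  on a i = does (i Fin.≟ a) ∧ f i
  at-sum : ∀ a → sum (on a) ≡ f a
  at-sum a = trans
    (sum-delta a (on a) (λ i i≢a → cong (_∧ f i) (dec-false (i Fin.≟ a) i≢a)))
    (cong (_∧ f a) (dec-true (a Fin.≟ a) refl))
  split : ∀ i → f i ≡ on s i xor on t i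
  split i with i Fin.≟ s | i Fin.≟ t
  ... | yes refl | yes i≡t  = ⊥-elim (s≢t i≡t)
  ... | yes refl | no  _    = sym (xor-identityʳ (f i))
  ... | no  _    | yes _    = refl
  ... | no  i≢s  | no  i≢t  = z i i≢s i≢t

-- A vector is a formal sum of basis elements, with repetitions allowed and
-- counted modulo 2.

module _ {A : Set} (_≟_ : DecidableEquality A) where

  coeff : List A → A → Bool
  coeff []      a = false
  coeff (b ∷ x) a = does (b ≟ a) xor coeff x a

  coeff-++ : ∀ x y a → coeff (x ++ y) a ≡ coeff x a xor coeff y a
  coeff-++ []      y a = refl
  coeff-++ (b ∷ x) y a = trans (cong (does (b ≟ a) xor_) (coeff-++ x y a))
    (sym (xor-assoc (does (b ≟ a)) (coeff x a) (coeff y a)))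

  coeff-double : ∀ x a → coeff (x ++ x) a ≡ false
  coeff-double x a = trans (coeff-++ x x a) (xor-same (coeff x a))

  infix 4 _≋_
  record _≋_ (x y : List A) : Set where
    constructor same-coeff
    field coeff-≡ : ∀ a → coeff x a ≡ coeff y a

  open _≋_ public

  Free-isLeftModule : IsLeftModule 𝔽₂ _≋_ _++_ [] id (λ b x → if b then x else [])
  Free-isLeftModule = record
    { isLeftSemimodule = record
      { +ᴹ-isCommutativeMonoid = record
        { isMonoid = record
          { isSemigroup = record
            { isMagma = record
              { isEquivalence = record
                { refl  = same-coeff λ a → refl
                ; sym   = λ e → same-coeff λ a → sym (coeff-≡ e a)
                ; trans = λ e e′ → same-coeff λ a → trans (coeff-≡ e a) (coeff-≡ e′ a) }
              ; ∙-cong = λ {x} {y} {u} {v} e e′ → same-coeff λ a → trans (coeff-++ x u a)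
                  (trans (cong₂ _xor_ (coeff-≡ e a) (coeff-≡ e′ a)) (sym (coeff-++ y v a))) }
            ; assoc = λ x y z → same-coeff λ a → trans (coeff-++ (x ++ y) z a)
                (trans (cong (_xor coeff z a) (coeff-++ x y a))
                (trans (xor-assoc (coeff x a) (coeff y a) (coeff z a))
                (trans (cong (coeff x a xor_) (sym (coeff-++ y z a)))
                       (sym (coeff-++ x (y ++ z) a))))) }
          ; identity = (λ x → same-coeff λ a → refl)
                     , (λ x → same-coeff λ a → trans (coeff-++ x [] a) (xor-identityʳ _)) }
        ; comm = λ x y → same-coeff λ a → trans (coeff-++ x y a)
            (trans (xor-comm (coeff x a) (coeff y a)) (sym (coeff-++ y x a))) }
      ; isPreleftSemimodule = record
        { *ₗ-cong      = λ { {true} refl e → e ; {false} refl e → same-coeff λ a → refl }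
        ; *ₗ-zeroˡ     = λ x → same-coeff λ a → refl
        ; *ₗ-distribʳ  = λ { x true  true  → same-coeff λ a → sym (coeff-double x a)
                           ; x true  false → same-coeff λ a →
                               sym (trans (coeff-++ x [] a) (xor-identityʳ _))
                           ; x false c     → same-coeff λ a → refl }
        ; *ₗ-identityˡ = λ x → same-coeff λ a → refl
        ; *ₗ-assoc     = λ { true c x → same-coeff λ a → refl ; false c x → same-coeff λ a → refl }
        ; *ₗ-zeroʳ     = λ { true → same-coeff λ a → refl ; false → same-coeff λ a → refl }
        ; *ₗ-distribˡ  = λ { true x y → same-coeff λ a → refl
                           ; false x y → same-coeff λ a → refl } } }
    ; -ᴹ‿cong    = id
    ; -ᴹ‿inverse = (λ x → same-coeff (coeff-double x)) , (λ x → same-coeff (coeff-double x)) }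

  Free : Vect
  Free .LeftModule.Carrierᴹ     = List A
  Free .LeftModule._≈ᴹ_         = _≋_
  Free .LeftModule._+ᴹ_         = _++_
  Free .LeftModule._*ₗ_ b x     = if b then x else []
  Free .LeftModule.0ᴹ           = []
  Free .LeftModule.-ᴹ_          = id
  Free .LeftModule.isLeftModule = Free-isLeftModule

  Span : (A → Set) → Subspace Free
  Span P = mkSubspace Free (λ x → ∃[ y ] (All P y × x ≈[ Free ] y))
    (λ { e (y , p , q) → y , p , LeftModule.≈ᴹ-trans Free (LeftModule.≈ᴹ-sym Free e) q })
    ([] , [] , LeftModule.≈ᴹ-refl Free)
    (λ { (y , p , q) (z , p′ , q′) → y ++ z , All.++⁺ p p′ ,
         LeftModule.+ᴹ-cong Free q q′ })

  Span-mono : ∀ {P Q : A → Set} → (∀ {a} → P a → Q a) → ∀ {x} → Span P ∋ x → Span Q ∋ x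
  Span-mono f (y , p , q) = y , All.map f p , q

  total : (A → Bool) → List A → Bool
  total φ []      = false
  total φ (a ∷ x) = φ a xor total φ x

  total-++ : ∀ φ x y → total φ (x ++ y) ≡ total φ x xor total φ y
  total-++ φ []      y = refl
  total-++ φ (a ∷ x) y = trans (cong (φ a xor_) (total-++ φ x y))
    (sym (xor-assoc (φ a) (total φ x) (total φ y)))

  remove : A → List A → List A
  remove a []      = []
  remove a (b ∷ x) with b ≟ a
  ... | yes _ = remove a x
  ... | no  _ = b ∷ remove a x

  remove-length : ∀ a x → length (remove a x) ℕ.≤ length x
  remove-length a []      = ℕ.z≤n
  remove-length a (b ∷ x) with b ≟ a
  ... | yes _ = ℕ.m≤n⇒m≤1+n (remove-length a x)
  ... | no  _ = s≤s (remove-length a x)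

  total-remove : ∀ φ a x → total φ x ≡ (coeff x a ∧ φ a) xor total φ (remove a x)
  total-remove φ a []      = refl
  total-remove φ a (b ∷ x) with b ≟ a
  ... | yes refl with coeff x a | total-remove φ a x
  ...   | false | e = cong (φ a xor_) e
  ...   | true  | e = trans (cong (φ a xor_) e) (trans
                        (sym (xor-assoc (φ a) (φ a) (total φ (remove a x))))
                        (cong (_xor total φ (remove a x)) (xor-same (φ a))))
  total-remove φ a (b ∷ x) | no _ = trans (cong (φ b xor_) (total-remove φ a x))
    (trans (sym (xor-assoc (φ b) (coeff x a ∧ φ a) _))
      (trans (cong (_xor total φ (remove a x)) (xor-comm (φ b) (coeff x a ∧ φ a)))
             (xor-assoc (coeff x a ∧ φ a) (φ b) _)))

  coeff-remove : ∀ a x → coeff x a ≡ false → ∀ c → coeff (remove a x) c ≡ coeff x c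
  coeff-remove a x h c with a ≟ c
  ... | yes refl = trans (absent x) (sym h)
    where
    absent : ∀ x → coeff (remove a x) a ≡ false
    absent []      = refl
    absent (b ∷ x) with b ≟ a
    ... | yes _   = absent x
    ... | no  b≢a = trans (cong (_xor coeff (remove a x) a) (dec-false (b ≟ a) b≢a)) (absent x)
  ... | no a≢c = other x
    where
    other : ∀ x → coeff (remove a x) c ≡ coeff x c
    other []      = refl
    other (b ∷ x) with b ≟ a
    ... | yes refl = trans (other x) (sym (cong (_xor coeff x c) (dec-false (b ≟ c) a≢c)))
    ... | no  _    = cong (does (b ≟ c) xor_) (other x)

  total-zero : ∀ φ n x → length x ℕ.≤ n → (∀ a → coeff x a ≡ false) → total φ x ≡ false
  total-zero φ _       []      _       _ = refl
  total-zero φ (suc n) (a ∷ x) (s≤s l) h = trans (total-remove φ a (a ∷ x))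
    (trans (cong (λ b → (b ∧ φ a) xor total φ (remove a (a ∷ x))) (h a))
      (total-zero φ n (remove a (a ∷ x)) (shorter l)
        (λ c → trans (coeff-remove a (a ∷ x) (h a) c) (h c))))
    where
    shorter : length x ℕ.≤ n → length (remove a (a ∷ x)) ℕ.≤ n
    shorter l with a ≟ a
    ... | yes _   = ℕ.≤-trans (remove-length a x) l
    ... | no  a≢a = ⊥-elim (a≢a refl)

  total-cong : ∀ φ x y → x ≈[ Free ] y → total φ x ≡ total φ y
  total-cong φ x y e = xor≡false (trans (sym (total-++ φ x y))
    (total-zero φ _ (x ++ y) ℕ.≤-refl
      (λ a → trans (coeff-++ x y a)
        (trans (cong (_xor coeff y a) (coeff-≡ e a)) (xor-same (coeff y a))))))

  coeff-concatMap : ∀ (g : A → List A) x a →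
                    coeff (concatMap g x) a ≡ total (λ b → coeff (g b) a) x
  coeff-concatMap g []      a = refl
  coeff-concatMap g (b ∷ x) a = trans (coeff-++ (g b) (concatMap g x) a)
    (cong (coeff (g b) a xor_) (coeff-concatMap g x a))

  total-sum : ∀ {n} (φ : Fin n → A → Bool) x →
              total (λ a → sum (λ i → φ i a)) x ≡ sum (λ i → total (φ i) x)
  total-sum φ []      = sym (sum-false {f = λ i → total (φ i) []} (λ i → refl))
  total-sum φ (a ∷ x) = trans (cong (sum (λ i → φ i a) xor_) (total-sum φ x))
    (sym (∑-distrib-+ (λ i → φ i a) (λ i → total (φ i) x)))

  extend : (A → List A) → LinearMap Free Free
  extend g = mkLinear Free Free (concatMap g)
    (λ {x} {y} e → same-coeff λ a → trans (coeff-concatMap g x a)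
      (trans (total-cong (λ b → coeff (g b) a) x y e) (sym (coeff-concatMap g y a))))
    (λ x y → same-coeff λ a → trans (coeff-concatMap g (x ++ y) a)
      (trans (total-++ (λ b → coeff (g b) a) x y)
      (trans (cong₂ _xor_ (sym (coeff-concatMap g x a)) (sym (coeff-concatMap g y a)))
             (sym (coeff-++ (concatMap g x) (concatMap g y) a)))))

  extend-Span : ∀ (g : A → List A) {P Q : A → Set} → (∀ {a} → P a → All Q (g a)) →
                ∀ {x} → Span P ∋ x → Span Q ∋ extend g $ x
  extend-Span g {P} {Q} h {x} (y , p , q) = concatMap g y , go p , LinearMap.⟦⟧-cong (extend g) q
    where
    go : ∀ {y} → All P y → All Q (concatMap g y)
    go []       = []
    go (p ∷ ps) = All.++⁺ (h p) (go ps)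

  extend-ext : ∀ (f g : LinearMap Free Free) →
               (∀ a → f $ (a ∷ []) ≈[ Free ] g $ (a ∷ [])) →
               ∀ x → f $ x ≈[ Free ] g $ x
  extend-ext f g h []      = LeftModule.≈ᴹ-trans Free
    (LinearMap.0ᴹ-homo f) (LeftModule.≈ᴹ-sym Free (LinearMap.0ᴹ-homo g))
  extend-ext f g h (a ∷ x) = LeftModule.≈ᴹ-trans Free (LinearMap.+ᴹ-homo f (a ∷ []) x)
    (LeftModule.≈ᴹ-trans Free (LeftModule.+ᴹ-cong Free (h a) (extend-ext f g h x))
      (LeftModule.≈ᴹ-sym Free (LinearMap.+ᴹ-homo g (a ∷ []) x)))

  ⋃ : ∀ {n} → (Fin n → A → List A) → A → List A
  ⋃ g a = concat (tabulate (λ i → g i a))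

  coeff-⋃ : ∀ {n} (g : Fin n → A → List A) a c → coeff (⋃ g a) c ≡ sum (λ i → coeff (g i a) c)
  coeff-⋃ {zero}  g a c = refl
  coeff-⋃ {suc n} g a c = trans (coeff-++ (g zero a) _ c)
    (cong (coeff (g zero a) c xor_) (coeff-⋃ (g ∘ suc) a c))

  total-cong-φ : ∀ {φ ψ : A → Bool} → (∀ a → φ a ≡ ψ a) → ∀ x → total φ x ≡ total ψ x
  total-cong-φ e []      = refl
  total-cong-φ e (a ∷ x) = cong₂ _xor_ (e a) (total-cong-φ e x)

  total-⋃ : ∀ {n} (φ : A → Bool) (g : Fin n → A → List A) a →
            total φ (⋃ g a) ≡ sum (λ i → total φ (g i a))
  total-⋃ {zero}  φ g a = refl
  total-⋃ {suc n} φ g a = trans (total-++ φ (g zero a) _)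
    (cong (total φ (g zero a) xor_) (total-⋃ φ (g ∘ suc) a))

  coeff-⋃⋃ : ∀ {m n} (h : Fin m → A → List A) (g : Fin n → A → List A) a c →
             coeff (concatMap (⋃ h) (⋃ g a ++ [])) c
             ≡ sum (λ i → sum (λ j → coeff (concatMap (h j) (g i a)) c))
  coeff-⋃⋃ h g a c = begin
    coeff (concatMap (⋃ h) (⋃ g a ++ [])) c
      ≡⟨ coeff-concatMap (⋃ h) (⋃ g a ++ []) c ⟩
    total (λ b → coeff (⋃ h b) c) (⋃ g a ++ [])
      ≡⟨ trans (total-++ (λ b → coeff (⋃ h b) c) (⋃ g a) []) (xor-identityʳ _) ⟩
    total (λ b → coeff (⋃ h b) c) (⋃ g a)
      ≡⟨ total-cong-φ (λ b → coeff-⋃ h b c) (⋃ g a) ⟩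
    total (λ b → sum (λ j → coeff (h j b) c)) (⋃ g a)
      ≡⟨ total-⋃ _ g a ⟩
    sum (λ i → total (λ b → sum (λ j → coeff (h j b) c)) (g i a))
      ≡⟨ sum-cong-≗ (λ i → total-sum (λ j b → coeff (h j b) c) (g i a)) ⟩
    sum (λ i → sum (λ j → total (λ b → coeff (h j b) c) (g i a)))
      ≡⟨ sum-cong-≗ (λ i → sum-cong-≗ (λ j → sym (coeff-concatMap (h j) (g i a) c))) ⟩
    sum (λ i → sum (λ j → coeff (concatMap (h j) (g i a)) c)) ∎
    where open ≡-Reasoning

  compose : LinearMap Free Free → LinearMap Free Free → LinearMap Free Free
  compose f g = mkLinear Free Free (λ x → f $ (g $ x))
    (λ e → LinearMap.⟦⟧-cong f (LinearMap.⟦⟧-cong g e))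
    (λ x y → LeftModule.≈ᴹ-trans Free (LinearMap.⟦⟧-cong f (LinearMap.+ᴹ-homo g x y))
      (LinearMap.+ᴹ-homo f (g $ x) (g $ y)))

  zeroMap : LinearMap Free Free
  zeroMap = mkLinear Free Free (λ _ → [])
    (λ _ → LeftModule.≈ᴹ-refl Free) (λ _ _ → LeftModule.≈ᴹ-refl Free)

  ⋃-square : ∀ {n} (g : Fin n → A → List A) →
             (∀ i a → concatMap (g i) (g i a) ≡ []) →
             (∀ i j a → concatMap (g i) (g j a) ≈[ Free ] concatMap (g j) (g i a)) →
             ∀ x → extend (⋃ g) $ (extend (⋃ g) $ x) ≈[ Free ] []
  ⋃-square g sq comm = extend-ext (compose (extend (⋃ g)) (extend (⋃ g))) zeroMap
    (λ a → same-coeff λ c → trans (coeff-⋃⋃ g g a c)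
      (sum-symmetric _ (λ i → cong (λ y → coeff y c) (sq i a)) (λ i j → coeff-≡ (comm j i a) c)))

  ⋃-commute : ∀ {m n} (h : Fin m → A → List A) (g : Fin n → A → List A) →
              (∀ j a c → sum (λ i → coeff (concatMap (g i) (h j a)) c)
                       ≡ sum (λ i → coeff (concatMap (h j) (g i a)) c)) →
              ∀ x → extend (⋃ h) $ (extend (⋃ g) $ x) ≈[ Free ] extend (⋃ g) $ (extend (⋃ h) $ x)
  ⋃-commute h g comm = extend-ext (compose (extend (⋃ h)) (extend (⋃ g)))
                                  (compose (extend (⋃ g)) (extend (⋃ h)))
    (λ a → same-coeff λ c → trans (coeff-⋃⋃ h g a c)
      (trans (∑-comm (λ i j → coeff (concatMap (h j) (g i a)) c))
      (trans (sum-cong-≗ (λ j → sym (comm j a c)))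
             (sym (coeff-⋃⋃ g h a c)))))

record Graph : Set where
  field
    order size : ℕ

  Vertex : Set
  Vertex = Fin order

  Edge : Set
  Edge = Fin size

  field
    src tgt : Edge → Vertex

  -- The edges are undirected: src and tgt merely name the two ends.

  Joins : Edge → Vertex → Vertex → Set
  Joins e x y = (src e ≡ x × tgt e ≡ y) ⊎ (src e ≡ y × tgt e ≡ x)

  field
    loopless : ∀ e → src e ≢ tgt e
    simple   : ∀ {e f x y} → Joins e x y → Joins f x y → e ≡ f

  Adjacent : Vertex → Vertex → Set
  Adjacent x y = ∃[ e ] Joins e x y

  IsEndOf : Vertex → Edge → Set
  IsEndOf x e = src e ≡ x ⊎ tgt e ≡ x

record IsTree (T : Graph) : Set where
  open Graph T
  field
    nonempty  : NonZero order
    connected : ∀ x y → Star Adjacent x y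
    -- c lists the l + 3 distinct vertices of a would-be cycle.
    acyclic   : ∀ l (c : Fin (3 ℕ.+ l) → Vertex) → Injective _≡_ _≡_ c →
                (∀ i → Adjacent (c (inject₁ i)) (c (suc i))) →
                ¬ Adjacent (c (fromℕ (2 ℕ.+ l))) (c zero)

module Configurations (T : Graph) where
  open Graph T

  Mark : Set
  Mark = Maybe Sign

  _≟ᴹ_ : DecidableEquality Mark
  _≟ᴹ_ = Maybe.≡-dec Sign._≟_

  ValidAt : Vec Mark order → Subset size → Vertex → Set
  ValidAt mark red x =
      ((∃[ s ] lookup mark x ≡ just s) × (∀ e → e ∈ red → ¬ IsEndOf x e))
    ⊎ (lookup mark x ≡ nothing × ∃! _≡_ (λ e → e ∈ red × IsEndOf x e))

  -- Validity is irrelevant, so a configuration is determined by its marks and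
  -- its red edges.

  record Config : Set where
    constructor config
    field
      mark   : Vec Mark order
      red    : Subset size
      .valid : ∀ x → ValidAt mark red x

  open Config public

  config-≡ : ∀ {C C′} → mark C ≡ mark C′ → red C ≡ red C′ → C ≡ C′
  config-≡ {config _ _ _} {config _ _ _} refl refl = refl

  _≟ᶜ_ : DecidableEquality Config
  C ≟ᶜ C′ with Vec.≡-dec _≟ᴹ_ (mark C) (mark C′) | Vec.≡-dec Bool._≟_ (red C) (red C′)
  ... | yes p | yes q = yes (config-≡ p q)
  ... | no ¬p | _     = no λ e → ¬p (cong mark e)
  ... | _     | no ¬q = no λ e → ¬q (cong red e)

  Q : Config → ℕ
  Q C = count (_≟ᴹ just Sign.-) (mark C)

  E : Config → ℕ
  E C = Q C ℕ.+ card (red C)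

  breakMark : Vec Mark order → Edge → Sign → Vec Mark order
  breakMark m e s = m [ src e ]≔ just s [ tgt e ]≔ just (opposite s)

  lookup-≔ : ∀ {A : Set} {n} (v : Vec A n) i {a} → lookup (v [ i ]≔ a) i ≡ a
  lookup-≔ v i = Vec.lookup∘updateAt i v

  lookup-≔′ : ∀ {A : Set} {n} (v : Vec A n) i j {a} → j ≢ i → lookup (v [ i ]≔ a) j ≡ lookup v j
  lookup-≔′ v i j j≢i = Vec.lookup∘updateAt′ j i j≢i v

  ∉-removed : ∀ {n} (r : Subset n) e → ¬ (e ∈ r [ e ]≔ outside)
  ∉-removed r e p = case trans (sym (Vec.[]=⇒lookup p)) (lookup-≔ r e) of λ ()

  removed-≢ : ∀ {n} (r : Subset n) e {f} → f ∈ r [ e ]≔ outside → f ≢ e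
  removed-≢ r e p refl = ∉-removed r e p

  removed⊆ : ∀ {n} (r : Subset n) e {f} → f ∈ r [ e ]≔ outside → f ∈ r
  removed⊆ r e {f} p = Vec.lookup⇒[]= f r
    (trans (sym (lookup-≔′ r e f (removed-≢ r e p))) (Vec.[]=⇒lookup p))

  ∈-removed : ∀ {n} (r : Subset n) e {f} → f ≢ e → f ∈ r → f ∈ r [ e ]≔ outside
  ∈-removed r e {f} f≢e p = Vec.lookup⇒[]= f _
    (trans (lookup-≔′ r e f f≢e) (Vec.[]=⇒lookup p))

  red-end : ∀ {m r x e} → ValidAt m r x → e ∈ r → IsEndOf x e →
            lookup m x ≡ nothing × (∀ {f} → f ∈ r → IsEndOf x f → f ≡ e)
  red-end (inj₁ (_ , none)) e∈r end = ⊥-elim (none _ e∈r end)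
  red-end (inj₂ (m , _ , _ , uniq)) e∈r end =
    m , λ f∈r end′ → trans (sym (uniq (f∈r , end′))) (uniq (e∈r , end))

  breakMark-tgt : ∀ m e s → lookup (breakMark m e s) (tgt e) ≡ just (opposite s)
  breakMark-tgt m e s = lookup-≔ (m [ src e ]≔ just s) (tgt e)

  breakMark-src : ∀ m e s → lookup (breakMark m e s) (src e) ≡ just s
  breakMark-src m e s = trans (lookup-≔′ (m [ src e ]≔ just s) (tgt e) (src e) (loopless e))
                              (lookup-≔ m (src e))

  breakMark-other : ∀ m e s x → x ≢ src e → x ≢ tgt e → lookup (breakMark m e s) x ≡ lookup m x
  breakMark-other m e s x x≢s x≢t =
    trans (lookup-≔′ (m [ src e ]≔ just s) (tgt e) x x≢t) (lookup-≔′ m (src e) x x≢s)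

  break-valid : ∀ {m r e} s → (∀ x → ValidAt m r x) → e ∈ r →
                ∀ x → ValidAt (breakMark m e s) (r [ e ]≔ outside) x
  break-valid {m} {r} {e} s v e∈r x with x Fin.≟ tgt e
  ... | yes refl = inj₁ ((_ , breakMark-tgt m e s) , λ f f∈ end →
        removed-≢ r e f∈ (proj₂ (red-end {m} (v (tgt e)) e∈r (inj₂ refl)) (removed⊆ r e f∈) end))
  ... | no x≢t with x Fin.≟ src e
  ...   | yes refl = inj₁ ((_ , breakMark-src m e s) , λ f f∈ end →
          removed-≢ r e f∈ (proj₂ (red-end {m} (v (src e)) e∈r (inj₁ refl)) (removed⊆ r e f∈) end))
  ...   | no x≢s with v x
  ...     | inj₁ ((a , q) , none) =
            inj₁ ((a , trans (breakMark-other m e s x x≢s x≢t) q) ,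
                  λ f f∈ → none f (removed⊆ r e f∈))
  ...     | inj₂ (q , f , (f∈ , end) , uniq) =
            inj₂ (trans (breakMark-other m e s x x≢s x≢t) q ,
                  f , (∈-removed r e f≢e f∈ , end) ,
                  λ { (g∈ , end′) → uniq (removed⊆ r e g∈ , end′) })
            where
            f≢e : f ≢ e
            f≢e refl = case end of λ where
              (inj₁ p) → x≢s (sym p)
              (inj₂ p) → x≢t (sym p)

  flip-valid : ∀ {m r y} → (∀ x → ValidAt m r x) → lookup m y ≡ just Sign.+ →
               ∀ x → ValidAt (m [ y ]≔ just Sign.-) r x
  flip-valid {m} {r} {y} v q x with x Fin.≟ y
  flip-valid {m} {r} {y} v q x | yes refl with v y
  ... | inj₁ (_ , none) = inj₁ ((_ , lookup-≔ m y) , none)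
  ... | inj₂ (q′ , _)   = case trans (sym q) q′ of λ ()
  flip-valid {m} {r} {y} v q x | no x≢y with v x
  ... | inj₁ ((a , q′) , none) = inj₁ ((a , trans (lookup-≔′ m y x x≢y) q′) , none)
  ... | inj₂ (q′ , rest)       = inj₂ (trans (lookup-≔′ m y x x≢y) q′ , rest)

  -- Make the red edge e non-red, its ends being marked by s and its opposite.

  break : (C : Config) (e : Edge) → .(e ∈ red C) → Sign → Config
  break C e e∈ s .mark  = breakMark (mark C) e s
  break C e e∈ s .red   = red C [ e ]≔ outside
  break (config m _ v) e e∈ s .valid = break-valid {m} s v e∈

  flip : (C : Config) (x : Vertex) → .(lookup (mark C) x ≡ just Sign.+) → Config
  flip C x q .mark  = mark C [ x ]≔ just Sign.-
  flip C x q .red   = red C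
  flip (config m _ v) x q .valid = flip-valid {m} v q

  breakings : Edge → Config → List Config
  breakings e C with e ∈? red C
  ... | yes e∈ = break C e e∈ Sign.+ ∷ break C e e∈ Sign.- ∷ []
  ... | no  _  = []

  flips : Vertex → Config → List Config
  flips x C with lookup (mark C) x ≟ᴹ just Sign.+
  ... | yes q = flip C x q ∷ []
  ... | no  _ = []

  SC : Vect
  SC = Free _≟ᶜ_

  D : LinearMap SC SC
  D = extend _≟ᶜ_ (λ C → concat (tabulate (λ e → breakings e C)))

  d : LinearMap SC SC
  d = extend _≟ᶜ_ (λ C → concat (tabulate (λ x → flips x C)))

  breakings-yes : ∀ e C (p : e ∈ red C) →
                  breakings e C ≡ break C e p Sign.+ ∷ break C e p Sign.- ∷ []
  breakings-yes e C p with e ∈? red C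
  ... | yes _  = refl
  ... | no  e∉ = ⊥-elim (e∉ p)

  breakings-no : ∀ e C → ¬ (e ∈ red C) → breakings e C ≡ []
  breakings-no e C e∉ with e ∈? red C
  ... | yes p = ⊥-elim (e∉ p)
  ... | no  _ = refl

  flips-yes : ∀ x C (q : lookup (mark C) x ≡ just Sign.+) → flips x C ≡ flip C x q ∷ []
  flips-yes x C q with lookup (mark C) x ≟ᴹ just Sign.+
  ... | yes _ = refl
  ... | no ¬q = ⊥-elim (¬q q)

  flips-no : ∀ x C → lookup (mark C) x ≢ just Sign.+ → flips x C ≡ []
  flips-no x C ¬q with lookup (mark C) x ≟ᴹ just Sign.+
  ... | yes q = ⊥-elim (¬q q)
  ... | no  _ = refl

  unmarked : ∀ C {x e} → e ∈ red C → IsEndOf x e → lookup (mark C) x ≡ nothing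
  unmarked (config m _ v) {x} e∈ end = recompute (lookup m x ≟ᴹ nothing)
    (proj₁ (red-end {m} (v x) e∈ end))

  same-edge : ∀ C {x e f} → e ∈ red C → f ∈ red C → IsEndOf x e → IsEndOf x f → e ≡ f
  same-edge (config m _ v) {x} {e} {f} e∈ f∈ end end′ = recompute (e Fin.≟ f)
    (proj₂ (red-end {m} (v x) f∈ end′) e∈ end)

  breakings² : ∀ e C → concatMap (breakings e) (breakings e C) ≡ []
  breakings² e C with e ∈? red C
  ... | yes p rewrite breakings-no e (break C e p Sign.+) (∉-removed (red C) e)
                    | breakings-no e (break C e p Sign.-) (∉-removed (red C) e) = refl
  ... | no  _ = refl

  breakMark-commute : ∀ m e f s t → (∀ {x} → IsEndOf x e → ¬ IsEndOf x f) →
                      breakMark (breakMark m e s) f t ≡ breakMark (breakMark m f t) e s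
  breakMark-commute m e f s t apart = begin
    m [ se ]≔ S [ te ]≔ S′ [ sf ]≔ R [ tf ]≔ R′
      ≡⟨ cong (_[ tf ]≔ R′) (Vec.[]≔-commutes (m [ se ]≔ S) te sf (ne (inj₂ refl) (inj₁ refl))) ⟩
    m [ se ]≔ S [ sf ]≔ R [ te ]≔ S′ [ tf ]≔ R′
      ≡⟨ Vec.[]≔-commutes (m [ se ]≔ S [ sf ]≔ R) te tf (ne (inj₂ refl) (inj₂ refl)) ⟩
    m [ se ]≔ S [ sf ]≔ R [ tf ]≔ R′ [ te ]≔ S′
      ≡⟨ cong (λ v → v [ tf ]≔ R′ [ te ]≔ S′) (Vec.[]≔-commutes m se sf (ne (inj₁ refl) (inj₁ refl))) ⟩
    m [ sf ]≔ R [ se ]≔ S [ tf ]≔ R′ [ te ]≔ S′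
      ≡⟨ cong (_[ te ]≔ S′) (Vec.[]≔-commutes (m [ sf ]≔ R) se tf (ne (inj₁ refl) (inj₂ refl))) ⟩
    m [ sf ]≔ R [ tf ]≔ R′ [ se ]≔ S [ te ]≔ S′ ∎
    where
    open ≡-Reasoning
    se te sf tf : Vertex
    se = src e
    te = tgt e
    sf = src f
    tf = tgt f
    S S′ R R′ : Mark
    S  = just s
    S′ = just (opposite s)
    R  = just t
    R′ = just (opposite t)
    ne : ∀ {x y} → IsEndOf x e → IsEndOf y f → x ≢ y
    ne p q refl = apart p q

  break-commute : ∀ C {e f} (p : e ∈ red C) (q : f ∈ red C) (e≢f : e ≢ f) s t →
                  break (break C e p s) f (∈-removed (red C) e (e≢f ∘ sym) q) t
                  ≡ break (break C f q t) e (∈-removed (red C) f e≢f p) s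
  break-commute C {e} {f} p q e≢f s t = config-≡
    (breakMark-commute (mark C) e f s t (λ end end′ → e≢f (same-edge C p q end end′)))
    (Vec.[]≔-commutes (red C) e f e≢f)

  swap-middle : ∀ (a b c d : Config) →
                _≋_ _≟ᶜ_ (a ∷ b ∷ c ∷ d ∷ []) (a ∷ c ∷ b ∷ d ∷ [])
  swap-middle a b c d = LeftModule.+ᴹ-cong SC {a ∷ []} {a ∷ []} (LeftModule.≈ᴹ-refl SC)
    (LeftModule.+ᴹ-cong SC {b ∷ c ∷ []} {c ∷ b ∷ []} {d ∷ []} {d ∷ []}
      (LeftModule.+ᴹ-comm SC (b ∷ []) (c ∷ [])) (LeftModule.≈ᴹ-refl SC))

  ≡⇒≈ : ∀ {x y : List Config} → x ≡ y → x ≈[ SC ] y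
  ≡⇒≈ refl = LeftModule.≈ᴹ-refl SC

  breakings-commute : ∀ e f C → concatMap (breakings e) (breakings f C)
                                ≈[ SC ] concatMap (breakings f) (breakings e C)
  breakings-commute e f C with e Fin.≟ f
  ... | yes refl = LeftModule.≈ᴹ-refl SC
  ... | no  e≢f  = go (e ∈? red C) (f ∈? red C)
    where
    after : ∀ {e f} → ¬ (e ∈ red C) → ∀ .(p : f ∈ red C) s → breakings e (break C f p s) ≡ []
    after {e} {f} e∉ p s = breakings-no e (break C f p s) (e∉ ∘ removed⊆ (red C) f)
    go : Dec (e ∈ red C) → Dec (f ∈ red C) → concatMap (breakings e) (breakings f C)
                                ≈[ SC ] concatMap (breakings f) (breakings e C)
    go (no e∉) (no f∉) rewrite breakings-no e C e∉ | breakings-no f C f∉ = LeftModule.≈ᴹ-refl SC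
    go (no e∉) (yes q) rewrite breakings-no e C e∉ | breakings-yes f C q
                             | after e∉ q Sign.+ | after e∉ q Sign.- = LeftModule.≈ᴹ-refl SC
    go (yes p) (no f∉) rewrite breakings-yes e C p | breakings-no f C f∉
                             | after f∉ p Sign.+ | after f∉ p Sign.- = LeftModule.≈ᴹ-refl SC
    go (yes p) (yes q)
      rewrite breakings-yes e C p | breakings-yes f C q
            | breakings-yes e (break C f q Sign.+) (∈-removed (red C) f e≢f p)
            | breakings-yes e (break C f q Sign.-) (∈-removed (red C) f e≢f p)
            | breakings-yes f (break C e p Sign.+) (∈-removed (red C) e (e≢f ∘ sym) q)
            | breakings-yes f (break C e p Sign.-) (∈-removed (red C) e (e≢f ∘ sym) q)
            | break-commute C p q e≢f Sign.+ Sign.+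
            | break-commute C p q e≢f Sign.+ Sign.-
            | break-commute C p q e≢f Sign.- Sign.+
            | break-commute C p q e≢f Sign.- Sign.-
      = swap-middle _ _ _ _

  flips² : ∀ x C → concatMap (flips x) (flips x C) ≡ []
  flips² x C with lookup (mark C) x ≟ᴹ just Sign.+
  ... | no  _ = refl
  ... | yes q rewrite flips-no x (flip C x q)
                (λ e → case trans (sym (lookup-≔ (mark C) x)) e of λ ()) = refl

  flips-commute : ∀ x y C → concatMap (flips x) (flips y C)
                            ≈[ SC ] concatMap (flips y) (flips x C)
  flips-commute x y C with x Fin.≟ y
  ... | yes refl = LeftModule.≈ᴹ-refl SC
  ... | no  x≢y  = go (lookup (mark C) x ≟ᴹ just Sign.+) (lookup (mark C) y ≟ᴹ just Sign.+)
    where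
    keep : ∀ {x y} → x ≢ y → lookup (mark C [ y ]≔ just Sign.-) x ≡ lookup (mark C) x
    keep {x} {y} x≢y = lookup-≔′ (mark C) y x x≢y
    after : ∀ {x y} → x ≢ y → lookup (mark C) x ≢ just Sign.+ →
            ∀ .(q : lookup (mark C) y ≡ just Sign.+) → flips x (flip C y q) ≡ []
    after {x} {y} x≢y ¬p q = flips-no x (flip C y q) (λ e → ¬p (trans (sym (keep x≢y)) e))
    go : Dec (lookup (mark C) x ≡ just Sign.+) → Dec (lookup (mark C) y ≡ just Sign.+) →
         concatMap (flips x) (flips y C) ≈[ SC ] concatMap (flips y) (flips x C)
    go (no ¬p) (no ¬q) rewrite flips-no x C ¬p | flips-no y C ¬q = LeftModule.≈ᴹ-refl SC
    go (no ¬p) (yes q) rewrite flips-no x C ¬p | flips-yes y C q | after x≢y ¬p q =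
      LeftModule.≈ᴹ-refl SC
    go (yes p) (no ¬q) rewrite flips-yes x C p | flips-no y C ¬q | after (x≢y ∘ sym) ¬q p =
      LeftModule.≈ᴹ-refl SC
    go (yes p) (yes q)
      rewrite flips-yes x C p | flips-yes y C q
            | flips-yes x (flip C y q) (trans (keep x≢y) p)
            | flips-yes y (flip C x p) (trans (keep (x≢y ∘ sym)) q) =
      ≡⇒≈ (cong (_∷ []) (config-≡ (Vec.[]≔-commutes (mark C) y x (x≢y ∘ sym)) refl))

  mixed : ∀ e C c → sum (λ x → coeff _≟ᶜ_ (concatMap (flips x) (breakings e C)) c)
                  ≡ sum (λ x → coeff _≟ᶜ_ (concatMap (breakings e) (flips x C)) c)
  mixed e C c with e ∈? red C
  ... | no e∉ = trans (sum-false {f = λ (x : Vertex) → false} (λ _ → refl))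
                      (sym (sum-false (λ x → cong (λ y → coeff _≟ᶜ_ y c) (none x))))
    where
    none : ∀ x → concatMap (breakings e) (flips x C) ≡ []
    none x with lookup (mark C) x ≟ᴹ just Sign.+
    ... | no  _ = refl
    ... | yes q rewrite breakings-no e (flip C x q) e∉ = refl
  ... | yes p = xor≡false (trans (sym (∑-distrib-+ L R))
                  (sum-pair (src e) (tgt e) (λ x → L x xor R x) (loopless e) ends others))
    where
    m = mark C
    B : Sign → Config
    B = break C e p
    L R : Vertex → Bool
    L x = coeff _≟ᶜ_ (concatMap (flips x) (B Sign.+ ∷ B Sign.- ∷ [])) c
    R x = coeff _≟ᶜ_ (concatMap (breakings e) (flips x C)) c
    co : List Config → Bool
    co y = coeff _≟ᶜ_ y c
    R-end : ∀ x → IsEndOf x e → R x ≡ false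
    R-end x end rewrite flips-no x C (λ q → case trans (sym (unmarked C p end)) q of λ ()) = refl
    src+ : lookup (mark (B Sign.+)) (src e) ≡ just Sign.+
    src+ = breakMark-src m e Sign.+
    tgt+ : lookup (mark (B Sign.-)) (tgt e) ≡ just Sign.+
    tgt+ = breakMark-tgt m e Sign.-
    L-src : concatMap (flips (src e)) (B Sign.+ ∷ B Sign.- ∷ []) ≡ flip (B Sign.+) (src e) src+ ∷ []
    L-src rewrite flips-yes (src e) (B Sign.+) src+
                | flips-no (src e) (B Sign.-)
                    (λ q → case trans (sym (breakMark-src m e Sign.-)) q of λ ()) = refl
    L-tgt : concatMap (flips (tgt e)) (B Sign.+ ∷ B Sign.- ∷ []) ≡ flip (B Sign.-) (tgt e) tgt+ ∷ []
    L-tgt rewrite flips-yes (tgt e) (B Sign.-) tgt+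
                | flips-no (tgt e) (B Sign.+)
                    (λ q → case trans (sym (breakMark-tgt m e Sign.+)) q of λ ()) = refl
    both-minus : flip (B Sign.+) (src e) src+ ≡ flip (B Sign.-) (tgt e) tgt+
    both-minus = config-≡
      (trans (cong (_[ src e ]≔ just Sign.-)
               (Vec.[]≔-commutes m (src e) (tgt e) (loopless e)))
      (trans (Vec.[]≔-idempotent (m [ tgt e ]≔ just Sign.-) (src e))
      (trans (sym (Vec.[]≔-commutes m (src e) (tgt e) (loopless e)))
             (sym (Vec.[]≔-idempotent (m [ src e ]≔ just Sign.-) (tgt e))))))
      refl
    ends : L (src e) xor R (src e) ≡ L (tgt e) xor R (tgt e)
    ends = cong₂ _xor_
      (cong co (trans L-src (trans (cong (_∷ []) both-minus) (sym L-tgt))))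
      (trans (R-end (src e) (inj₁ refl)) (sym (R-end (tgt e) (inj₂ refl))))
    others : ∀ x → x ≢ src e → x ≢ tgt e → L x xor R x ≡ false
    others x x≢s x≢t = trans (cong (_xor R x) (cong co (go (lookup m x ≟ᴹ just Sign.+))))
                             (xor-same (R x))
      where
      keep : ∀ s → lookup (mark (B s)) x ≡ lookup m x
      keep s = breakMark-other m e s x x≢s x≢t
      go : Dec (lookup m x ≡ just Sign.+) →
           concatMap (flips x) (B Sign.+ ∷ B Sign.- ∷ []) ≡ concatMap (breakings e) (flips x C)
      go (no ¬q) rewrite flips-no x C ¬q
                       | flips-no x (B Sign.+) (λ q → ¬q (trans (sym (keep Sign.+)) q))
                       | flips-no x (B Sign.-) (λ q → ¬q (trans (sym (keep Sign.-)) q)) = refl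
      go (yes q) rewrite flips-yes x C q
                       | flips-yes x (B Sign.+) (trans (keep Sign.+) q)
                       | flips-yes x (B Sign.-) (trans (keep Sign.-) q)
                       | breakings-yes e (flip C x q) p =
        cong₂ (λ a b → a ∷ b ∷ []) (same Sign.+) (same Sign.-)
        where
        same : ∀ s → flip (B s) x (trans (keep s) q) ≡ break (flip C x q) e p s
        same s = config-≡
          (trans (Vec.[]≔-commutes (m [ src e ]≔ just s) (tgt e) x (x≢t ∘ sym))
                 (cong (_[ tgt e ]≔ just (opposite s))
                   (Vec.[]≔-commutes m (src e) x (x≢s ∘ sym))))
          refl

  D²≈0 : ∀ x → D $ (D $ x) ≈[ SC ] []
  D²≈0 = ⋃-square _≟ᶜ_ breakings breakings² breakings-commute

  d²≈0 : ∀ x → d $ (d $ x) ≈[ SC ] []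
  d²≈0 = ⋃-square _≟ᶜ_ flips flips² flips-commute

  Dd≈dD : ∀ x → D $ (d $ x) ≈[ SC ] d $ (D $ x)
  Dd≈dD = ⋃-commute _≟ᶜ_ breakings flips mixed

  ind : ∀ {P : Set} → Dec P → ℕ
  ind p = if does p then 1 else 0

  count-≔ : ∀ {A : Set} {P : A → Set} (P? : ∀ a → Dec (P a)) {n} (v : Vec A n) i a →
            ind (P? (lookup v i)) ℕ.+ count P? (v [ i ]≔ a) ≡ ind (P? a) ℕ.+ count P? v
  count-≔ P? (b Vec.∷ v) zero a with does (P? b) | does (P? a)
  ... | true  | true  = refl
  ... | true  | false = refl
  ... | false | true  = refl
  ... | false | false = refl
  count-≔ P? (b Vec.∷ v) (suc i) a with does (P? b)
  ... | false = count-≔ P? v i a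
  ... | true  = trans (ℕ.+-suc (ind (P? (lookup v i))) _)
               (trans (cong suc (count-≔ P? v i a)) (sym (ℕ.+-suc (ind (P? a)) _)))

  card-remove : ∀ {n} (r : Subset n) e → e ∈ r → suc (card (r [ e ]≔ outside)) ≡ card r
  card-remove (inside Vec.∷ r) zero Vec.here = refl
  card-remove (b Vec.∷ r) (suc e) (Vec.there e∈) with b
  ... | true  = cong suc (card-remove r e e∈)
  ... | false = card-remove r e e∈

  minus? : (a : Mark) → Dec (a ≡ just Sign.-)
  minus? = _≟ᴹ just Sign.-

  Q-break : ∀ C e (p : e ∈ red C) s → Q (break C e p s) ≡ suc (Q C)
  Q-break C e p s with count-≔ minus? (mark C) (src e) (just s)
                     | count-≔ minus? (mark C [ src e ]≔ just s) (tgt e) (just (opposite s))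
  ... | q₁ | q₂ rewrite lookup-≔′ (mark C) (src e) (tgt e) {just s} (loopless e ∘ sym)
                      | unmarked C p (inj₁ refl) | unmarked C p (inj₂ refl) with s
  ...   | Sign.+ = trans q₂ (cong suc q₁)
  ...   | Sign.- = trans q₂ q₁

  Q-flip : ∀ C x (q : lookup (mark C) x ≡ just Sign.+) → Q (flip C x q) ≡ suc (Q C)
  Q-flip C x q with count-≔ minus? (mark C) x (just Sign.-)
  ... | q₁ rewrite q = q₁

  -- The two maps have bidegrees (1 , 0) and (1 , 1) for (Q , E).

  D-degree : ∀ C → All (λ C′ → Q C′ ≡ suc (Q C) × E C′ ≡ E C)
                       (concat (tabulate (λ e → breakings e C)))
  D-degree C = All.concat⁺ (All.tabulate⁺ one)
    where
    E-break : ∀ e p s → E (break C e p s) ≡ E C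
    E-break e p s = trans (cong (ℕ._+ card (red C [ e ]≔ outside)) (Q-break C e p s))
      (trans (sym (ℕ.+-suc (Q C) _)) (cong (Q C ℕ.+_) (card-remove (red C) e p)))
    one : ∀ e → All (λ C′ → Q C′ ≡ suc (Q C) × E C′ ≡ E C) (breakings e C)
    one e with e ∈? red C
    ... | yes p = (Q-break C e p _ , E-break e p _) ∷ (Q-break C e p _ , E-break e p _) ∷ []
    ... | no  _ = []

  d-degree : ∀ C → All (λ C′ → Q C′ ≡ suc (Q C) × E C′ ≡ suc (E C))
                       (concat (tabulate (λ x → flips x C)))
  d-degree C = All.concat⁺ (All.tabulate⁺ one)
    where
    one : ∀ x → All (λ C′ → Q C′ ≡ suc (Q C) × E C′ ≡ suc (E C)) (flips x C)
    one x with lookup (mark C) x ≟ᴹ just Sign.+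
    ... | yes q = (Q-flip C x q , cong (ℕ._+ card (red C)) (Q-flip C x q)) ∷ []
    ... | no  _ = []

  SC^ : ℤ → Subspace SC
  SC^ k = Span _≟ᶜ_ (λ C → + Q C ≡ k)

  SC^[_,_] : ℤ → ℤ → Subspace SC
  SC^[ k , n ] = Span _≟ᶜ_ (λ C → + Q C ≡ k × + E C ≡ n)

  -- The degree k part of the direct sum of the SC^[ k , n ] with n ≥ p.

  F : (p k : ℤ) → Subspace SC
  F p k = Span _≟ᶜ_ (λ C → + Q C ≡ k × p ℤ.≤ + E C)

  ∂ : LinearMap SC SC
  ∂ = D ⊕ d

  next : ∀ {a b k} → + a ≡ k → b ≡ suc a → + b ≡ k ℤ.+ 1ℤ
  next {a} refl refl = ℤ.+-comm 1ℤ (+ a)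

  D-SC^ : ∀ {k x} → SC^ k ∋ x → SC^ (k ℤ.+ 1ℤ) ∋ D $ x
  D-SC^ = extend-Span _≟ᶜ_ _ λ {C} e → All.map (λ (q , _) → next e q) (D-degree C)

  d-SC^ : ∀ {k x} → SC^ k ∋ x → SC^ (k ℤ.+ 1ℤ) ∋ d $ x
  d-SC^ = extend-Span _≟ᶜ_ _ λ {C} e → All.map (λ (q , _) → next e q) (d-degree C)

  D-F : ∀ {p k x} → F p k ∋ x → F p (k ℤ.+ 1ℤ) ∋ D $ x
  D-F {p} = extend-Span _≟ᶜ_ _ λ {C} (e , l) →
    All.map (λ (q , q′) → next e q , subst (λ n → p ℤ.≤ + n) (sym q′) l) (D-degree C)

  d-F : ∀ {p k x} → F p k ∋ x → F p (k ℤ.+ 1ℤ) ∋ d $ x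
  d-F {p} = extend-Span _≟ᶜ_ _ λ {C} (e , l) →
    All.map (λ (q , q′) → next e q ,
               subst (λ n → p ℤ.≤ + n) (sym q′) (ℤ.≤-trans l (ℤ.+≤+ (ℕ.n≤1+n _)))) (d-degree C)

  d-SC^[] : ∀ {k n x} → SC^[ k , n ] ∋ x → SC^[ k ℤ.+ 1ℤ , n ℤ.+ 1ℤ ] ∋ d $ x
  d-SC^[] = extend-Span _≟ᶜ_ _ λ {C} (e , e′) →
    All.map (λ (q , q′) → next e q , next e′ q′) (d-degree C)

  open LeftModule SC using (+ᴹ-cong; +ᴹ-comm; +ᴹ-identityʳ; ≈ᴹ-refl; ≈ᴹ-sym; ≈ᴹ-trans)

  ∂²≈0 : ∀ x → ∂ $ (∂ $ x) ≈[ SC ] []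
  ∂²≈0 x = ≈ᴹ-trans
    (+ᴹ-cong
      (≈ᴹ-trans (LinearMap.+ᴹ-homo D (D $ x) (d $ x)) (+ᴹ-cong (D²≈0 x) ≈ᴹ-refl))
      (≈ᴹ-trans (LinearMap.+ᴹ-homo d (D $ x) (d $ x))
        (≈ᴹ-trans (+ᴹ-cong (≈ᴹ-sym (Dd≈dD x)) (d²≈0 x)) (+ᴹ-identityʳ _))))
    (char2 SC (D $ (d $ x)))

  -- F p k / F (p + 1) k is SC^[ k , p ], so on the pages below the filtration
  -- index is the grading by E and the degree is the grading by Q.

  SC-filtered : FilteredComplex
  SC-filtered = record
    { V = SC ; ∂ = ∂ ; C = SC^ ; F = F
    ; ∂²≈0 = ∂²≈0
    ; ∂-C  = λ {k} m → Subspace.+-mem (SC^ (k ℤ.+ 1ℤ)) (D-SC^ m) (d-SC^ m)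
    ; ∂-F  = λ {p} {k} m → Subspace.+-mem (F p (k ℤ.+ 1ℤ)) (D-F m) (d-F m)
    ; F⊆C  = Span-mono _≟ᶜ_ proj₁
    ; F-decreasing = λ p≤q → Span-mono _≟ᶜ_ (λ (e , l) → e , ℤ.≤-trans p≤q l) }

  SH^ : ℤ → Vect
  SH^ = Cohomology SC D SC^

  SH^[_,_] : ℤ → ℤ → Vect
  SH^[ k , n ] = Cohomology SC D (λ j → SC^[ j , n ]) k

  SH : Vect
  SH = ⨁ SH^

  ⨁SH^[,] : Vect
  ⨁SH^[,] = ⨁ λ ((n , k) : ℤ × ℤ) → SH^[ k , n ]

  forget : ∀ n k → LinearMap SH^[ k , n ] (SH^ k)
  forget n k = induced (idMap SC)
    (λ { (m , e) → Span-mono _≟ᶜ_ proj₁ m , e })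
    (λ { (y , m , e) → y , Span-mono _≟ᶜ_ proj₁ m , e })

  -- The map induced by d on D-cohomology.

  d∗ : ∀ {k k′} → k ℤ.+ 1ℤ ≡ k′ → LinearMap (SH^ k) (SH^ k′)
  d∗ {k} refl = induced d
    (λ {x} (m , e) → d-SC^ m ,
       ≈ᴹ-trans (Dd≈dD x) (≈ᴹ-trans (LinearMap.⟦⟧-cong d e) (LinearMap.0ᴹ-homo d)))
    (λ (y , m , e) → d $ y ,
       subst (λ j → SC^ j ∋ d $ y) (trans ([p-a]+a k 1ℤ) (sym ([p+a]-a k 1ℤ))) (d-SC^ m) ,
       ≈ᴹ-trans (LinearMap.⟦⟧-cong d e) (≈ᴹ-sym (Dd≈dD y)))

  SH-d : LinearMap SH SH
  SH-d = ⨁-map SH^ SH^ (ℤ._- 1ℤ) (ℤ._+ 1ℤ) (λ k → [p-a]+a k 1ℤ) (λ k → d∗ ([p-a]+a k 1ℤ))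

  open SpectralSequence SC-filtered public renaming (E to Eʳ; d to dʳ)
    hiding (Z; B)

  -- A D-cocycle x in SC^[ k , p ] satisfies ∂ x ∈ F (p + 1), so it has a class in
  -- the first page.

  leading : ∀ p k → Carrier SH^[ k , p ] → Carrier (Eʳ 1 p k)
  leading p k (x , m , e) = x , Span-mono _≟ᶜ_ (λ (q , q′) → q , ℤ.≤-reflexive (sym q′)) m ,
    Subspace.resp (F (p ℤ.+ 1ℤ) (k ℤ.+ 1ℤ)) (+ᴹ-cong (≈ᴹ-sym e) ≈ᴹ-refl)
      (Span-mono _≟ᶜ_ (λ (q , q′) → q , ℤ.≤-reflexive (sym q′)) (d-SC^[] m))

module Submission where

-- The spectral sequence facts hold for every filtered complex whose filtration is
-- bounded; the first page is read off by projecting on a fixed value of E, since D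
-- preserves E and d raises it.
--
-- The total cohomology is computed the other way round, with d first. The operation
-- h that turns the first marked vertex from - to + contracts d on the configurations
-- with at least one marked vertex, so on these ∂h + h∂ + 1 = Dh + hD lowers the number
-- of red edges and is nilpotent. Hence only the configurations without marks, which
-- are the perfect matchings of T, contribute. A tree has at most one of them: two
-- would give an endless walk without backtracking along their edges alternately.

open import Defs
open import Algebra.Bundles using (CommutativeMonoid; CommutativeRing)
open import Algebra.Module.Bundles using (LeftModule)
open import Data.Bool.Base using (Bool; true; false; _∧_; _xor_; if_then_else_)
import Data.Bool.Properties as Bool
open import Data.Empty using (⊥; ⊥-elim)
open import Data.Fin.Base using (Fin; zero; suc; toℕ; inject₁)
import Data.Fin.Properties as Fin
open import Data.Fin.Subset using (Subset; _∈_; _⊆_) renaming (∣_∣ to card)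
open import Data.Fin.Subset.Properties using (_∈?_; anySubset?; ⊆-antisym; ∣p∣≤n)
open import Data.Integer.Base as ℤ using (ℤ; +_; -[1+_]; 0ℤ; 1ℤ)
import Data.Integer.Properties as ℤ
open import Data.Integer.Properties using (_≟_)
open import Data.Integer.Solver using (module +-*-Solver)
open import Data.List.Base as List
  using (List; []; _∷_; _++_; concatMap; upTo; cartesianProduct)
import Data.List.Membership.Propositional as List
open import Data.List.Membership.Propositional.Properties
  using (∈-map⁺; ∈-upTo⁺; ∈-cartesianProduct⁺)
open import Data.List.Properties using (++-identityʳ)
open import Data.List.Relation.Unary.All as All using (All; []; _∷_)
import Data.List.Relation.Unary.All.Properties as All
open import Data.List.Relation.Unary.Any using (here; there)
open import Data.Maybe.Base as Maybe using (Maybe; just; nothing)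
open import Data.Nat.Base as ℕ using (ℕ; zero; suc)
open import Data.Nat.Induction using (<-rec)
import Data.Nat.Properties as ℕ
open import Data.Product using (_×_; _,_; proj₁; proj₂; ∃!; Σ-syntax; ∃-syntax)
open import Data.Sign.Base as Sign using (Sign)
open import Data.Sum.Base using (_⊎_; inj₁; inj₂)
open import Data.Unit.Base using (⊤; tt)
open import Data.Vec.Base as Vec using (Vec; lookup; _[_]≔_; replicate)
import Data.Vec.Properties as Vec
open import Function.Base using (_∘_; case_of_; id)
open import Function.Bundles using (mk⇔)
open import Relation.Binary.Definitions using (DecidableEquality; tri<; tri≈; tri>)
open import Relation.Binary.PropositionalEquality
  using (_≡_; _≢_; refl; sym; trans; cong; cong₂; subst; subst₂)
open import Relation.Nullary using (¬_; Dec; yes; no; does; recompute)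
open import Relation.Nullary.Decidable
  using (dec-true; dec-false; does-⇔; map′; _×-dec_; _⊎-dec_; _→-dec_)

open CommutativeRing Bool.xor-∧-commutativeRing using (+-commutativeMonoid)
open import Algebra.Properties.CommutativeMonoid.Sum +-commutativeMonoid
  using (sum; sum-cong-≗; ∑-distrib-+)

-- The operation `h` lowers `E` as well as `Q` by one, so it does not respect the filtration and
-- gives no information page by page. It is therefore applied to total cocycles only, and `E∞` is
-- evaluated straight from its definition as cocycles in `F p` modulo deeper cocycles and
-- boundaries. `h` acts at the first marked vertex because flipping a sign never changes which
-- vertex that is. Breaking a red edge can create an earlier mark, so `h` fails to commute with `D`;
-- the failure costs a red edge, whence nilpotency. A perfect matching `P` is not itself a cocycle.
-- Its replacement is a high power of `1 + ∂h + h∂` applied to `P`, whose further terms are marked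
-- and have smaller `E`. Hence the surviving position cannot be read off from `E P`; it is found by
-- a finite search, which is possible because membership in `F p` is decidable.

-- Linear algebra over the field with two elements

module Char2 (V : Vect) where
  open LeftModule V public
  open import Algebra.Properties.CommutativeSemigroup
    (CommutativeMonoid.commutativeSemigroup +ᴹ-commutativeMonoid) public
    using (interchange)

  x+0≈x : ∀ {x y} → y ≈ᴹ 0ᴹ → (x +ᴹ y) ≈ᴹ x
  x+0≈x e = ≈ᴹ-trans (+ᴹ-cong ≈ᴹ-refl e) (+ᴹ-identityʳ _)

  0+x≈x : ∀ {x y} → y ≈ᴹ 0ᴹ → (y +ᴹ x) ≈ᴹ x
  0+x≈x e = ≈ᴹ-trans (+ᴹ-cong e ≈ᴹ-refl) (+ᴹ-identityˡ _)

  x+y+y≈x : ∀ x y → ((x +ᴹ y) +ᴹ y) ≈ᴹ x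
  x+y+y≈x x y = ≈ᴹ-trans (+ᴹ-assoc x y y) (x+0≈x (char2 V y))

  x+y≈z⇒x≈z+y : ∀ {x y z} → (x +ᴹ y) ≈ᴹ z → x ≈ᴹ (z +ᴹ y)
  x+y≈z⇒x≈z+y {x} {y} e = ≈ᴹ-trans (≈ᴹ-sym (x+y+y≈x x y)) (+ᴹ-cong e ≈ᴹ-refl)

  x+y≈0⇒x≈y : ∀ {x y} → (x +ᴹ y) ≈ᴹ 0ᴹ → x ≈ᴹ y
  x+y≈0⇒x≈y e = ≈ᴹ-trans (x+y≈z⇒x≈z+y e) (+ᴹ-identityˡ _)

  x≈y⇒x+y≈0 : ∀ {x y} → x ≈ᴹ y → (x +ᴹ y) ≈ᴹ 0ᴹ
  x≈y⇒x+y≈0 e = ≈ᴹ-trans (+ᴹ-cong e ≈ᴹ-refl) (char2 V _)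

  x-y≈x+y : ∀ {x y} → (x +ᴹ -ᴹ y) ≈ᴹ (x +ᴹ y)
  x-y≈x+y = +ᴹ-cong ≈ᴹ-refl (neg≈ V _)

  x-0≈x : ∀ {x} → (x +ᴹ -ᴹ 0ᴹ) ≈ᴹ x
  x-0≈x = x+0≈x (neg≈ V 0ᴹ)

module _ (V W : Vect) where
  private
    module V = Char2 V
    module W = Char2 W

  -- In characteristic 2, `x ≈ y` amounts to `x + y ≈ 0`, so an additive function is well defined as
  -- soon as it respects zero.
  additive-cong : (f : Carrier V → Carrier W) →
    (∀ x y → f (x V.+ᴹ y) W.≈ᴹ (f x W.+ᴹ f y)) →
    (∀ {x} → x V.≈ᴹ V.0ᴹ → f x W.≈ᴹ W.0ᴹ) →
    ∀ {x y} → x V.≈ᴹ y → f x W.≈ᴹ f y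
  additive-cong f f-+ f-0 e =
    W.x+y≈0⇒x≈y (W.≈ᴹ-trans (W.≈ᴹ-sym (f-+ _ _)) (f-0 (V.x≈y⇒x+y≈0 e)))

  mkIso : (f : Carrier V → Carrier W) →
    (∀ x y → f (x V.+ᴹ y) W.≈ᴹ (f x W.+ᴹ f y)) →
    (∀ {x} → x V.≈ᴹ V.0ᴹ → f x W.≈ᴹ W.0ᴹ) →
    (∀ {x} → f x W.≈ᴹ W.0ᴹ → x V.≈ᴹ V.0ᴹ) →
    (∀ y → ∃[ x ] f x W.≈ᴹ y) →
    IsIso V W f
  mkIso f f-+ f-0 inj surj = record
    { isLeftModuleMonomorphism = record
      { isLeftModuleHomomorphism = LinearMap.isHomomorphism (mkLinear V W f f-cong f-+)
      ; injective = λ {x} {y} e →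
          V.x+y≈0⇒x≈y (inj (W.≈ᴹ-trans (f-+ x y) (W.x≈y⇒x+y≈0 e))) }
    ; surjective = λ y → let (x , e) = surj y in x , λ e′ → W.≈ᴹ-trans (f-cong e′) e }
    where
    f-cong : ∀ {x y} → x V.≈ᴹ y → f x W.≈ᴹ f y
    f-cong = additive-cong f f-+ f-0

  inverse⇒iso : (f : LinearMap V W) (g : LinearMap W V) →
    (∀ x → g $ (f $ x) V.≈ᴹ x) → (∀ y → f $ (g $ y) W.≈ᴹ y) → IsIso V W (f $_)
  inverse⇒iso f g gf fg = record
    { isLeftModuleMonomorphism = record
      { isLeftModuleHomomorphism = LinearMap.isHomomorphism f
      ; injective = λ {x} {y} e → V.≈ᴹ-trans (V.≈ᴹ-sym (gf x))
          (V.≈ᴹ-trans (LinearMap.⟦⟧-cong g e) (gf y)) }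
    ; surjective = λ y → g $ y , λ e → W.≈ᴹ-trans (LinearMap.⟦⟧-cong f e) (fg y) }

infixr 9 _∘ₗ_
_∘ₗ_ : ∀ {U V W} → LinearMap V W → LinearMap U V → LinearMap U W
_∘ₗ_ {U} {V} {W} f g = mkLinear U W (λ x → f $ (g $ x))
  (λ e → LinearMap.⟦⟧-cong f (LinearMap.⟦⟧-cong g e))
  (λ x y → LeftModule.≈ᴹ-trans W (LinearMap.⟦⟧-cong f (LinearMap.+ᴹ-homo g x y))
    (LinearMap.+ᴹ-homo f (g $ x) (g $ y)))

module _ {V : Vect} {Z B : Subspace V} where
  private
    module V = Char2 V
    Quot = Subquotient V Z B

  ~⁺ : ∀ {x y : Carrier Quot} → B ∋ (proj₁ x V.+ᴹ proj₁ y) → x ≈[ Quot ] y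
  ~⁺ m = difference∈ (Subspace.resp B (V.≈ᴹ-sym V.x-y≈x+y) m)

  ~⁻ : ∀ {x y : Carrier Quot} → x ≈[ Quot ] y → B ∋ (proj₁ x V.+ᴹ proj₁ y)
  ~⁻ (difference∈ m) = Subspace.resp B V.x-y≈x+y m

  ~0⁺ : ∀ {x : Carrier Quot} → B ∋ proj₁ x → x ≈[ Quot ] LeftModule.0ᴹ Quot
  ~0⁺ m = difference∈ (Subspace.resp B (V.≈ᴹ-sym V.x-0≈x) m)

  ~0⁻ : ∀ {x : Carrier Quot} → x ≈[ Quot ] LeftModule.0ᴹ Quot → B ∋ proj₁ x
  ~0⁻ (difference∈ m) = Subspace.resp B V.x-0≈x m

module _ {I : Set} (_≟_ : DecidableEquality I) {A : I → Vect} where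

  ι-same : ∀ i {x : Carrier (A i)} → component (ι _≟_ {A} i x) i ≡ x
  ι-same i with i ≟ i
  ... | yes refl = refl
  ... | no  i≢i  = ⊥-elim (i≢i refl)

  ι-other : ∀ {i j} {x : Carrier (A i)} → i ≢ j →
            component (ι _≟_ {A} i x) j ≡ LeftModule.0ᴹ (A j)
  ι-other {i} {j} i≢j with i ≟ j
  ... | yes e = ⊥-elim (i≢j e)
  ... | no  _ = refl

  ι-unique : ∀ i {x : Carrier (A i)} (f : Carrier (⨁ A)) →
             component f i ≈[ A i ] x →
             (∀ j → i ≢ j → component f j ≈[ A j ] LeftModule.0ᴹ (A j)) →
             f ≈[ ⨁ A ] ι _≟_ i x
  ι-unique i {x} f same other = pointwise go
    where
    go : ∀ j → component f j ≈[ A j ] component (ι _≟_ {A} i x) j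
    go j with i ≟ j
    ... | yes refl = same
    ... | no  i≢j  = other j i≢j

  ι-cong : ∀ i {x y : Carrier (A i)} → x ≈[ A i ] y → ι _≟_ {A} i x ≈[ ⨁ A ] ι _≟_ i y
  ι-cong i {x} e = ι-unique i _
    (subst (λ z → z ≈[ A i ] _) (sym (ι-same i)) e)
    (λ j i≢j → subst (λ z → z ≈[ A j ] _) (sym (ι-other i≢j)) (LeftModule.≈ᴹ-refl (A j)))

  -- A finitely supported family is the sum of its components.

  ⨁-ext : ∀ {W} (f g : LinearMap (⨁ A) W) →
          (∀ i x → f $ ι _≟_ i x ≈[ W ] g $ ι _≟_ i x) → ∀ ξ → f $ ξ ≈[ W ] g $ ξ
  ⨁-ext {W} f g agree ξ = go (support ξ) ξ (vanishes ξ)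
    where
    module W = Char2 W
    module S = Char2 (⨁ A)
    zeros : ∀ (h : LinearMap (⨁ A) W) ξ → ξ S.≈ᴹ S.0ᴹ → h $ ξ W.≈ᴹ W.0ᴹ
    zeros h ξ e = W.≈ᴹ-trans (LinearMap.⟦⟧-cong h e) (LinearMap.0ᴹ-homo h)
    -- The induction is on a list outside which `ξ` vanishes, not on `support ξ`: adding `ι i x`
    -- cancels the component at `i` but lengthens the stored support.
    go : ∀ l ξ → (∀ i → ¬ (i List.∈ l) → component ξ i ≈[ A i ] LeftModule.0ᴹ (A i)) →
         f $ ξ W.≈ᴹ g $ ξ
    go []      ξ v = W.≈ᴹ-trans (zeros f ξ ξ≈0) (W.≈ᴹ-sym (zeros g ξ ξ≈0))
      where
      ξ≈0 : ξ S.≈ᴹ S.0ᴹ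
      ξ≈0 = pointwise λ i → v i λ ()
    go (i ∷ l) ξ v = W.≈ᴹ-trans (split f)
      (W.≈ᴹ-trans (W.+ᴹ-cong (go l ξ′ v′) (agree i _)) (W.≈ᴹ-sym (split g)))
      where
      x = component ξ i
      ξ′ = LeftModule._+ᴹ_ (⨁ A) ξ (ι _≟_ i x)
      split : ∀ h → h $ ξ W.≈ᴹ ((h $ ξ′) W.+ᴹ (h $ ι _≟_ i x))
      split h = W.≈ᴹ-trans
        (LinearMap.⟦⟧-cong h (S.≈ᴹ-sym (S.x+y+y≈x ξ (ι _≟_ i x))))
        (LinearMap.+ᴹ-homo h ξ′ (ι _≟_ i x))
      v′ : ∀ j → ¬ (j List.∈ l) → component ξ′ j ≈[ A j ] LeftModule.0ᴹ (A j)
      v′ j j∉ = cases (i ≟ j)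
        where
        module Aⱼ = Char2 (A j)
        cases : Dec (i ≡ j) → (component ξ j Aⱼ.+ᴹ component (ι _≟_ {A} i x) j) Aⱼ.≈ᴹ Aⱼ.0ᴹ
        cases (yes refl) = Aⱼ.x≈y⇒x+y≈0 (Aⱼ.≈ᴹ-reflexive (sym (ι-same i)))
        cases (no i≢j)   = Aⱼ.≈ᴹ-trans
          (Aⱼ.0+x≈x (v j λ { (here e) → i≢j (sym e) ; (there m) → j∉ m }))
          (Aⱼ.≈ᴹ-reflexive (ι-other i≢j))

module _ {I J : Set} (_≟_ : DecidableEquality I) (_≟′_ : DecidableEquality J)
         (A : I → Vect) (B : J → Vect) (σ : J → I) (τ : I → J)
         (τσ : ∀ j → τ (σ j) ≡ j) (g : ∀ j → LinearMap (A (σ j)) (B j)) where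

  -- The left inverse `τ` makes `σ` injective, so the only component that reads the entry at `σ j`
  -- is the one at `j`.
  ⨁-map-ι : ∀ j x → ⨁-map A B σ τ τσ g $ ι _≟_ (σ j) x ≈[ ⨁ B ] ι _≟′_ j (g j $ x)
  ⨁-map-ι j x = ι-unique _≟′_ j (⨁-map A B σ τ τσ g $ ι _≟_ (σ j) x)
    (subst (λ z → g j $ z ≈[ B j ] g j $ x) (sym (ι-same _≟_ (σ j))) (LeftModule.≈ᴹ-refl (B j)))
    (λ i j≢i → subst (λ z → g i $ z ≈[ B i ] LeftModule.0ᴹ (B i))
      (sym (ι-other _≟_ (λ e → j≢i (trans (sym (τσ j)) (trans (cong τ e) (τσ i))))))
      (LinearMap.0ᴹ-homo (g i)))

-- Pages, limit and convergence for a filtered complex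

p-r+1+[r-1] : ∀ p r → (p ℤ.- r ℤ.+ 1ℤ) ℤ.+ (r ℤ.- 1ℤ) ≡ p
p-r+1+[r-1] = solve 2 (λ p r → (p :- r :+ con 1ℤ) :+ (r :- con 1ℤ) := p) refl
  where open +-*-Solver

p-[1+r]+1 : ∀ p r → p ℤ.- (1ℤ ℤ.+ r) ℤ.+ 1ℤ ≡ p ℤ.- r
p-[1+r]+1 = solve 2 (λ p r → p :- (con 1ℤ :+ r) :+ con 1ℤ := p :- r) refl
  where open +-*-Solver

p+[1+r] : ∀ p r → p ℤ.+ (1ℤ ℤ.+ r) ≡ p ℤ.+ r ℤ.+ 1ℤ
p+[1+r] = solve 2 (λ p r → p :+ (con 1ℤ :+ r) := p :+ r :+ con 1ℤ) refl
  where open +-*-Solver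

module FilteredComplexProperties (S : FilteredComplex) where
  open FilteredComplex S
  open SpectralSequence S
  open Char2 V
  private
    module ∂ = LinearMap ∂

  F-≤ : ∀ {p q k x} → q ≡ p → F q k ∋ x → F p k ∋ x
  F-≤ refl m = m

  ∂-image-closed : ∀ {w x} → x ≈ᴹ (∂ $ w) → ∂ $ x ≈ᴹ 0ᴹ
  ∂-image-closed e = ≈ᴹ-trans (∂.⟦⟧-cong e) (∂²≈0 _)

  -- The transport along the index equations does not touch representatives; this is how those
  -- equations are eliminated from all later computations.
  δ-rep : ∀ r {p k p′ k′} (e : p ℤ.+ + r ≡ p′) (e′ : k ℤ.+ 1ℤ ≡ k′) (x : Carrier (E r p k)) →
          proj₁ (δ r e e′ $ x) ≡ ∂ $ proj₁ x
  δ-rep r refl refl x = refl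

  δδ≈0 : ∀ r {p k p′ k′ p″ k″} (e : p ℤ.+ + r ≡ p′) (e′ : k ℤ.+ 1ℤ ≡ k′)
         (f : p′ ℤ.+ + r ≡ p″) (f′ : k′ ℤ.+ 1ℤ ≡ k″) (x : Carrier (E r p k)) →
         δ r f f′ $ (δ r e e′ $ x) ≈[ E r p″ k″ ] LeftModule.0ᴹ (E r p″ k″)
  δδ≈0 r {p″ = p″} {k″} e e′ f f′ x = ~0⁺ {x = δ r f f′ $ (δ r e e′ $ x)}
    (subst (B (+ r) p″ k″ ∋_)
      (sym (trans (δ-rep r f f′ (δ r e e′ $ x)) (cong (∂ $_) (δ-rep r e e′ x))))
      (Subspace.resp (B (+ r) p″ k″) (≈ᴹ-sym (∂²≈0 (proj₁ x))) (Subspace.0-mem (B (+ r) p″ k″))))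

  d² : ∀ r ξ → d r $ (d r $ ξ) ≈[ page r ] LeftModule.0ᴹ (page r)
  d² r ξ = pointwise λ (p , k) →
    δδ≈0 r {p ℤ.- + r ℤ.- + r} {k ℤ.- 1ℤ ℤ.- 1ℤ}
      ([p-a]+a (p ℤ.- + r) (+ r)) ([p-a]+a (k ℤ.- 1ℤ) 1ℤ) ([p-a]+a p (+ r)) ([p-a]+a k 1ℤ)
      (component ξ (p ℤ.- + r ℤ.- + r , k ℤ.- 1ℤ ℤ.- 1ℤ))

  d-ι : ∀ r p k x → d r $ at r (p ℤ.- + r) (k ℤ.- 1ℤ) x ≈[ page r ] at r p k (δ-in r p k $ x)
  d-ι r p k x = ⨁-map-ι ℤ²-≟ ℤ²-≟ (λ (p , k) → E r p k) (λ (p , k) → E r p k)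
    (λ (p , k) → p ℤ.- + r , k ℤ.- 1ℤ) (λ (p , k) → p ℤ.+ + r , k ℤ.+ 1ℤ)
    (λ (p , k) → cong₂ _,_ ([p-a]+a p (+ r)) ([p-a]+a k 1ℤ))
    (λ (p , k) → δ-in r p k) (p , k) x

  -- `d r` is defined by the components entering a position. The one entering `(p + r , k + 1)`
  -- starts at `(p + r - r , k + 1 - 1)`, so `go` generalizes these indices in order to identify
  -- them with `(p , k)`.
  d-bidegree : ∀ r → HasBidegree (d r) (+ r , 1ℤ)
  d-bidegree r p k x = go ([p+a]-a p (+ r)) ([p+a]-a k 1ℤ) x
    where
    go : ∀ {q l} → p ℤ.+ + r ℤ.- + r ≡ q → k ℤ.+ 1ℤ ℤ.- 1ℤ ≡ l → (x : Carrier (E r q l)) →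
         ∃[ y ] d r $ at r q l x ≈[ page r ] at r (p ℤ.+ + r) (k ℤ.+ 1ℤ) y
    go refl refl x = _ , d-ι r (p ℤ.+ + r) (k ℤ.+ 1ℤ) x

  F-suc : ∀ {p k x} → F (p ℤ.+ 1ℤ) k ∋ x → F p k ∋ x
  F-suc = F-decreasing (ℤ.i≤i+j _ 1ℤ)

  Z-mono : ∀ {r s p k x} → s ℤ.≤ r → Z r p k ∋ x → Z s p k ∋ x
  Z-mono {p = p} s≤r (m , n) = m , F-decreasing (ℤ.+-monoʳ-≤ p s≤r) n

  B⁺ : ∀ {r p k x} s t → Z (r ℤ.- 1ℤ) (p ℤ.+ 1ℤ) k ∋ s →
       Z (r ℤ.- 1ℤ) (p ℤ.- r ℤ.+ 1ℤ) (k ℤ.- 1ℤ) ∋ t → x ≈ᴹ (s +ᴹ (∂ $ t)) → B r p k ∋ x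
  B⁺ s t ms mt e = s , ∂ $ t , ms , (t , mt , ≈ᴹ-refl) , e

  Z⊆B : ∀ {r p k x} → Z (r ℤ.- 1ℤ) (p ℤ.+ 1ℤ) k ∋ x → B r p k ∋ x
  Z⊆B {r} {p} {k} {x} m = x , 0ᴹ , m , Subspace.0-mem (image ∂ (Z _ _ _)) , ≈ᴹ-sym (+ᴹ-identityʳ x)

  ≈δ-in : ∀ r p k (x : Carrier (E r p k)) w → B (+ r) p k ∋ (proj₁ x +ᴹ (∂ $ proj₁ w)) →
          x ≈[ E r p k ] δ-in r p k $ w
  ≈δ-in r p k x w m = ~⁺ {x = x} {y = δ-in r p k $ w}
    (subst (λ y → B (+ r) p k ∋ (proj₁ x +ᴹ y))
      (sym (δ-rep r ([p-a]+a p (+ r)) ([p-a]+a k 1ℤ) w)) m)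

  ≈δ-in⁻ : ∀ r p k (x : Carrier (E r p k)) w → x ≈[ E r p k ] δ-in r p k $ w →
           B (+ r) p k ∋ (proj₁ x +ᴹ (∂ $ proj₁ w))
  ≈δ-in⁻ r p k x w e = subst (λ y → B (+ r) p k ∋ (proj₁ x +ᴹ y))
    (δ-rep r ([p-a]+a p (+ r)) ([p-a]+a k 1ℤ) w)
    (~⁻ {x = x} {y = δ-in r p k $ w} e)

  -- If `x = s + ∂w` vanishes on page `r + 1`, then `w` has filtration `p - r` and represents a
  -- class on page `r`. Its differential is the class of `x`, because the remainder `s` has
  -- filtration `p + 1`.
  turn-zero : ∀ r p k {x} → x ≈[ E (suc r) p k ] LeftModule.0ᴹ (E (suc r) p k) →
              turn r p k x ≈[ HE r p k ] LeftModule.0ᴹ (HE r p k)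
  turn-zero r p k {x} e = ~0⁺ {x = turn r p k x} (go (~0⁻ {x = x} e))
    where
    go : B (+ suc r) p k ∋ proj₁ x → image (δ-in r p k) (whole _) ∋ proj₁ (turn r p k x)
    go (s , s′ , ms , (w , mw , q) , e′) = w′ , tt ,
      ≈δ-in r p k (proj₁ (turn r p k x)) w′ (Z⊆B {+ r} {p}
        (Subspace.resp (Z (+ r ℤ.- 1ℤ) (p ℤ.+ 1ℤ) k) (≈ᴹ-sym x+∂w≈s)
          (Z-mono {p = p ℤ.+ 1ℤ} (ℤ.i-j≤i (+ r) 1ℤ) ms)))
      where
      w′ : Carrier (E r (p ℤ.- + r) (k ℤ.- 1ℤ))
      w′ = w , subst (λ q → Z (+ r) q (k ℤ.- 1ℤ) ∋ w) (p-[1+r]+1 p (+ r)) mw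
      x+∂w≈s : (proj₁ x +ᴹ (∂ $ w)) ≈ᴹ s
      x+∂w≈s = ≈ᴹ-trans (+ᴹ-cong (≈ᴹ-trans e′ (+ᴹ-cong ≈ᴹ-refl q)) ≈ᴹ-refl) (x+y+y≈x s (∂ $ w))

  -- From `x + ∂w = s + ∂t` follows `x = s + ∂(t + w)`. The page `r` boundary condition puts `∂s`
  -- only into `F (p + r)`, but `∂s = ∂x`, and `∂x` lies in `F (p + r + 1)` because `x` lives on
  -- page `r + 1`.
  turn-injective : ∀ r p k {x} → turn r p k x ≈[ HE r p k ] LeftModule.0ᴹ (HE r p k) →
                   x ≈[ E (suc r) p k ] LeftModule.0ᴹ (E (suc r) p k)
  turn-injective r p k {x} e = ~0⁺ {x = x} (go (~0⁻ {x = turn r p k x} e))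
    where
    p+1+r : p ℤ.+ 1ℤ ℤ.+ + r ≡ p ℤ.+ + suc r
    p+1+r = ℤ.+-assoc p 1ℤ (+ r)
    go′ : ∀ w → B (+ r) p k ∋ (proj₁ x +ᴹ (∂ $ proj₁ w)) → B (+ suc r) p k ∋ proj₁ x
    go′ (w , mw , nw) (s , s′ , (ms , _) , (t , (mt , nt) , q) , e″) =
      B⁺ {+ suc r} {p} s (t +ᴹ w)
        (ms , F-≤ (sym p+1+r) (Subspace.resp (F _ _) (≈ᴹ-sym ∂s≈∂x) (proj₂ (proj₂ x))))
        (subst (λ q → Z (+ r) q (k ℤ.- 1ℤ) ∋ (t +ᴹ w)) (sym (p-[1+r]+1 p (+ r)))
          (Subspace.+-mem (Z (+ r) (p ℤ.- + r) (k ℤ.- 1ℤ))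
            (F-suc mt , F-≤ (trans (p-r+1+[r-1] p (+ r)) (sym ([p-a]+a p (+ r)))) nt) (mw , nw)))
        x≈
      where
      x≈ : proj₁ x ≈ᴹ (s +ᴹ (∂ $ (t +ᴹ w)))
      x≈ = ≈ᴹ-trans (x+y≈z⇒x≈z+y e″)
        (≈ᴹ-trans (+ᴹ-assoc s s′ _) (+ᴹ-cong ≈ᴹ-refl
          (≈ᴹ-trans (+ᴹ-cong q ≈ᴹ-refl) (≈ᴹ-sym (∂.+ᴹ-homo t w)))))
      ∂s≈∂x : ∂ $ s ≈ᴹ ∂ $ proj₁ x
      ∂s≈∂x = ≈ᴹ-sym (≈ᴹ-trans (∂.⟦⟧-cong x≈)
        (≈ᴹ-trans (∂.+ᴹ-homo s _) (x+0≈x (∂²≈0 _))))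
    go : image (δ-in r p k) (whole _) ∋ proj₁ (turn r p k x) → B (+ suc r) p k ∋ proj₁ x
    go (w , _ , e′) = go′ w (≈δ-in⁻ r p k (proj₁ (turn r p k x)) w e′)

  -- A class killed by `d r` has `∂x = s + ∂t` with `s` in `F (p + r + 1)` and `t` of filtration
  -- `p + 1`. Then `x + t` has boundary `s`, so it lives on page `r + 1`, and on page `r` the
  -- correction `t` is zero.
  turn-surjective : ∀ r p k y → ∃[ x ] turn r p k x ≈[ HE r p k ] y
  turn-surjective r p k y@(u@(x , m , n) , e) = go (~0⁻ {x = δ-out r p k $ u} e)
    where
    go : B (+ r) (p ℤ.+ + r) (k ℤ.+ 1ℤ) ∋ ∂ $ x → ∃[ x ] turn r p k x ≈[ HE r p k ] y
    go (s , s′ , (ms , _) , (t , mt , q) , e′) =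
      (x +ᴹ t , m′ , n′) , ~⁺ {x = turn r p k (x +ᴹ t , m′ , n′)} {y = y}
        (Subspace.resp (image (δ-in r p k) (whole _))
          (LeftModule.≈ᴹ-sym (E r p k) (~0⁺ {x = x +ᴹ t +ᴹ x , _} (Z⊆B {+ r} {p}
            (Subspace.resp (Z (+ r ℤ.- 1ℤ) (p ℤ.+ 1ℤ) k) t≈ mt′))))
          (Subspace.0-mem (image (δ-in r p k) (whole _))))
      where
      mt′ : Z (+ r ℤ.- 1ℤ) (p ℤ.+ 1ℤ) k ∋ t
      mt′ = subst₂ (λ p k → Z (+ r ℤ.- 1ℤ) p k ∋ t) ([p+r]-r+1 p (+ r)) ([p+a]-a k 1ℤ) mt
      t≈ : t ≈ᴹ (x +ᴹ t +ᴹ x)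
      t≈ = ≈ᴹ-sym (≈ᴹ-trans (+ᴹ-cong (+ᴹ-comm x t) ≈ᴹ-refl) (x+y+y≈x t x))
      m′ : F p k ∋ (x +ᴹ t)
      m′ = Subspace.+-mem (F p k) m (F-suc (proj₁ mt′))
      n′ : F (p ℤ.+ + suc r) (k ℤ.+ 1ℤ) ∋ ∂ $ (x +ᴹ t)
      n′ = Subspace.resp (F _ _)
        (≈ᴹ-sym (≈ᴹ-trans (∂.+ᴹ-homo x t)
          (≈ᴹ-trans (+ᴹ-cong (≈ᴹ-trans e′ (+ᴹ-cong ≈ᴹ-refl q)) ≈ᴹ-refl) (x+y+y≈x s (∂ $ t)))))
        (F-≤ (sym (p+[1+r] p (+ r))) ms)

  turn-iso : ∀ r p k → IsIso (E (suc r) p k) (HE r p k) (turn r p k)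
  turn-iso r p k = mkIso (E (suc r) p k) (HE r p k) (turn r p k)
    (λ x y → ≈⇒~ (E r p k) (kernel (δ-out r p k)) (image (δ-in r p k) (whole _))
      (≈⇒~ V (Z (+ r) p k) (B (+ r) p k) ≈ᴹ-refl))
    (λ {x} → turn-zero r p k {x}) (λ {x} → turn-injective r p k {x}) (turn-surjective r p k)

  isSpectralSequence : IsSpectralSequence
  isSpectralSequence r _ = d² r , turn-iso r

  -- For injectivity: if `x` is cohomologous to a cocycle `s` in `F (p + 1)`, the boundary `x + s`
  -- lies in `F p` since both terms do, hence in `B∞ p k`.
  E∞→grH-iso : ∀ p k → IsIso (E∞ p k) (grH p k) (E∞→grH p k)
  E∞→grH-iso p k = mkIso (E∞ p k) (grH p k) (E∞→grH p k)
    (λ x y → ≈⇒~ (H k) (FH p k) (FH (p ℤ.+ 1ℤ) k) (≈⇒~ V (C k ∩ kernel ∂) im ≈ᴹ-refl))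
    zero′ injective surjective
    where
    im = image ∂ (C (k ℤ.- 1ℤ))
    zero′ : ∀ {x} → x ≈[ E∞ p k ] LeftModule.0ᴹ (E∞ p k) →
            E∞→grH p k x ≈[ grH p k ] LeftModule.0ᴹ (grH p k)
    zero′ {x} e = ~0⁺ {x = E∞→grH p k x} (go (~0⁻ {x = x} e))
      where
      go : (Z∞ (p ℤ.+ 1ℤ) k ⊞ B∞ p k) ∋ proj₁ x → FH (p ℤ.+ 1ℤ) k ∋ proj₁ (E∞→grH p k x)
      go (s , b , ms , (_ , mb) , e′) = (s , ms) , tt ,
        ~⁺ {x = HF→H p k $ x} {y = HF→H (p ℤ.+ 1ℤ) k $ (s , ms)} (Subspace.resp im
          (≈ᴹ-sym (≈ᴹ-trans (+ᴹ-cong (≈ᴹ-trans e′ (+ᴹ-comm s b)) ≈ᴹ-refl) (x+y+y≈x b s))) mb)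
    injective : ∀ {x} → E∞→grH p k x ≈[ grH p k ] LeftModule.0ᴹ (grH p k) →
                x ≈[ E∞ p k ] LeftModule.0ᴹ (E∞ p k)
    injective {x} e = ~0⁺ {x = x} (go (~0⁻ {x = E∞→grH p k x} e))
      where
      go : FH (p ℤ.+ 1ℤ) k ∋ proj₁ (E∞→grH p k x) → (Z∞ (p ℤ.+ 1ℤ) k ⊞ B∞ p k) ∋ proj₁ x
      go ((s , ms , es) , _ , e′) = s , proj₁ x +ᴹ s , (ms , es) ,
        (Subspace.+-mem (F p k) (proj₁ (proj₂ x)) (F-suc ms) ,
         ~⁻ {x = HF→H p k $ x} {y = HF→H (p ℤ.+ 1ℤ) k $ (s , ms , es)} e′) ,
        ≈ᴹ-trans (≈ᴹ-sym (x+y+y≈x _ s)) (+ᴹ-comm _ s)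
    surjective : ∀ y → ∃[ x ] E∞→grH p k x ≈[ grH p k ] y
    surjective y@(z , w , _ , e) = w , ~⁺ {x = E∞→grH p k w} {y = y}
      (Subspace.resp (FH (p ℤ.+ 1ℤ) k) {LeftModule.0ᴹ (H k)}
        (LeftModule.≈ᴹ-sym (H k) (Char2.x≈y⇒x+y≈0 (H k) (LeftModule.≈ᴹ-sym (H k) e)))
        (Subspace.0-mem (FH (p ℤ.+ 1ℤ) k)))

  module Bounded (N : ℕ) (F-top : ∀ {p k x} → + N ℤ.< p → F p k ∋ x → x ≈ᴹ 0ᴹ)
                 (F-bot : ∀ {p k x} → p ℤ.≤ 0ℤ → C k ∋ x → F p k ∋ x) where

    -- For `p < 0` the steps `F p` and `F (p + 1)` both contain every chain, so nothing is left in
    -- the quotient.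
    Z-negative : ∀ {r p k x} → p ℤ.< 0ℤ → Z r p k ∋ x → B r p k ∋ x
    Z-negative {r} {p} p<0 (m , n) = Z⊆B {r} {p}
      (F-bot (subst (ℤ._≤ 0ℤ) (ℤ.+-comm 1ℤ p) (ℤ.i<j⇒suc[i]≤j p<0)) (F⊆C m) ,
       F-≤ (sym ([p+1]+[r-1] p r)) n)

    above : ∀ {p r} → suc N ℕ.≤ r → 0ℤ ℤ.≤ p → + N ℤ.< p ℤ.+ + r
    above {p} {r} N<r 0≤p = ℤ.<-≤-trans (ℤ.+<+ N<r)
      (ℤ.≤-trans (ℤ.≤-reflexive (sym (ℤ.+-identityˡ (+ r)))) (ℤ.+-monoˡ-≤ (+ r) 0≤p))

    Z-nonnegative : ∀ {p r k x} → suc N ℕ.≤ r → 0ℤ ℤ.≤ p → Z (+ r) p k ∋ x → ∂ $ x ≈ᴹ 0ᴹ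
    Z-nonnegative N<r 0≤p (_ , n) = F-top (above N<r 0≤p) n

    E-negative : ∀ r p k x → p ℤ.< 0ℤ → x ≈[ E r p k ] LeftModule.0ᴹ (E r p k)
    E-negative r p k x p<0 = ~0⁺ {x = x} (Z-negative p<0 (proj₂ x))

    -- A differential of length `r > N` either starts at a negative index, where the page is zero,
    -- or lands above `N`, where the filtration is zero.
    d≈0 : ∀ r → suc N ℕ.≤ r → ∀ ξ → d r $ ξ ≈[ page r ] LeftModule.0ᴹ (page r)
    d≈0 r N<r ξ = pointwise λ (p , k) → go p k (component ξ _) (p ℤ.- + r ℤ.<? 0ℤ)
      where
      go : ∀ p k x → Dec (p ℤ.- + r ℤ.< 0ℤ) → δ-in r p k $ x ≈[ E r p k ] LeftModule.0ᴹ (E r p k)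
      go p k x (yes p<0) = LeftModule.≈ᴹ-trans (E r p k)
        (LinearMap.⟦⟧-cong (δ-in r p k) {x} (E-negative r _ _ x p<0))
        (LinearMap.0ᴹ-homo (δ-in r p k))
      go p k x (no p≮0) = ~0⁺ {x = δ-in r p k $ x} (Subspace.resp (B (+ r) p k)
        (≈ᴹ-sym (subst (_≈ᴹ 0ᴹ) (sym (δ-rep r ([p-a]+a p (+ r)) ([p-a]+a k 1ℤ) x))
          (Z-nonnegative {p ℤ.- + r} N<r (ℤ.≮⇒≥ p≮0) (proj₂ x))))
        (Subspace.0-mem (B (+ r) p k)))

    -- Surjectivity: for `p ≥ 0` an element of `Z r p k` has its boundary above `N`, so it is a
    -- cocycle. Boundaries agree as well: if `p ≤ N` then `p - r + 1 ≤ 0`, so every chain may serve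
    -- as a primitive, and if `p > N` then `F p` is zero.
    E∞→E-iso : ∀ r → suc N ℕ.≤ r → ∀ p k → IsIso (E∞ p k) (E r p k) (E∞→E r p k)
    E∞→E-iso r N<r p k = mkIso (E∞ p k) (E r p k) (E∞→E r p k)
      (λ x y → ≈⇒~ V (Z (+ r) p k) (B (+ r) p k) ≈ᴹ-refl)
      zero′ injective surjective
      where
      zero′ : ∀ {x} → x ≈[ E∞ p k ] LeftModule.0ᴹ (E∞ p k) →
              E∞→E r p k x ≈[ E r p k ] LeftModule.0ᴹ (E r p k)
      zero′ {x} e = ~0⁺ {x = E∞→E r p k x} (go (~0⁻ {x = x} e))
        where
        go : (Z∞ (p ℤ.+ 1ℤ) k ⊞ B∞ p k) ∋ proj₁ x → B (+ r) p k ∋ proj₁ x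
        go (s , b , (ms , es) , (mb , y , my , q) , e′) = cases (+ N ℤ.<? p)
          where
          ms′ : Z (+ r ℤ.- 1ℤ) (p ℤ.+ 1ℤ) k ∋ s
          ms′ = ms , Subspace.resp (F _ _) (≈ᴹ-sym es) (Subspace.0-mem (F _ _))
          cases : Dec (+ N ℤ.< p) → B (+ r) p k ∋ proj₁ x
          cases (yes N<p) = Z⊆B {+ r} {p} (Subspace.resp (Z _ _ _)
            (≈ᴹ-sym (≈ᴹ-trans e′ (x+0≈x (F-top N<p mb)))) ms′)
          cases (no N≮p) = B⁺ {+ r} {p} s y ms′
            (F-bot p-r+1≤0 my , F-≤ (sym (p-r+1+[r-1] p (+ r)))
              (subst (λ k → F p k ∋ ∂ $ y) (sym ([p-a]+a k 1ℤ)) (Subspace.resp (F p k) q mb)))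
            (≈ᴹ-trans e′ (+ᴹ-cong ≈ᴹ-refl q))
            where
            p-r+1≤0 : p ℤ.- + r ℤ.+ 1ℤ ℤ.≤ 0ℤ
            p-r+1≤0 = subst (ℤ._≤ 0ℤ) (ℤ.+-comm 1ℤ (p ℤ.- + r)) (ℤ.i<j⇒suc[i]≤j
              (ℤ.≤-<-trans (ℤ.+-monoˡ-≤ (ℤ.- + r) (ℤ.≮⇒≥ N≮p))
                (subst (+ N ℤ.- + r ℤ.<_) (ℤ.+-inverseʳ (+ r))
                  (ℤ.+-monoˡ-< (ℤ.- + r) (ℤ.+<+ N<r)))))
      injective : ∀ {x} → E∞→E r p k x ≈[ E r p k ] LeftModule.0ᴹ (E r p k) →
                  x ≈[ E∞ p k ] LeftModule.0ᴹ (E∞ p k)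
      injective {x} e = ~0⁺ {x = x} (go (~0⁻ {x = E∞→E r p k x} e))
        where
        go : B (+ r) p k ∋ proj₁ x → (Z∞ (p ℤ.+ 1ℤ) k ⊞ B∞ p k) ∋ proj₁ x
        go (s , b , (ms , _) , (t , (mt , nt) , q) , e′) =
          s , b , (ms , ∂s≈0) , (Subspace.resp (F p k) (≈ᴹ-sym q) ∂t∈F , t , F⊆C mt , q) , e′
          where
          ∂t∈F : F p k ∋ ∂ $ t
          ∂t∈F = subst₂ (λ p k → F p k ∋ ∂ $ t) (p-r+1+[r-1] p (+ r)) ([p-a]+a k 1ℤ) nt
          ∂s≈0 : ∂ $ s ≈ᴹ 0ᴹ
          ∂s≈0 = ≈ᴹ-trans (≈ᴹ-sym (≈ᴹ-trans (∂.⟦⟧-cong e′)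
            (≈ᴹ-trans (∂.+ᴹ-homo s b) (x+0≈x (∂-image-closed q))))) (proj₂ (proj₂ x))
      surjective : ∀ y → ∃[ x ] E∞→E r p k x ≈[ E r p k ] y
      surjective y@(z , m) = go (p ℤ.<? 0ℤ)
        where
        go : Dec (p ℤ.< 0ℤ) → ∃[ x ] E∞→E r p k x ≈[ E r p k ] y
        go (yes p<0) = LeftModule.0ᴹ (E∞ p k) ,
          LeftModule.≈ᴹ-sym (E r p k) (E-negative r p k y p<0)
        go (no p≮0) = (z , proj₁ m , Z-nonnegative N<r (ℤ.≮⇒≥ p≮0) m) ,
          ≈⇒~ V (Z (+ r) p k) (B (+ r) p k) ≈ᴹ-refl

    converges : Converges
    converges = (suc N , λ r N<r → d≈0 r N<r , E∞→E-iso r N<r) , E∞→grH-iso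

-- Supports of formal sums and projections to part of the basis

∧-true : ∀ {a b} → a ∧ b ≡ true → a ≡ true × b ≡ true
∧-true {true} {true} _ = refl , refl

does-true : ∀ {P : Set} (P? : Dec P) → does P? ≡ true → P
does-true (yes p) _ = p

≢true⇒≡false : ∀ {b} → b ≢ true → b ≡ false
≢true⇒≡false {true}  b≢ = ⊥-elim (b≢ refl)
≢true⇒≡false {false} _  = refl

module Coefficients {A : Set} (_≟_ : DecidableEquality A) where
  open Char2 (Free _≟_)

  private
    co = coeff _≟_

  coeff⇒∈ : ∀ x a → co x a ≡ true → a List.∈ x
  coeff⇒∈ (b ∷ x) a e with b ≟ a
  ... | yes b≡a = here (sym b≡a)
  ... | no  _   = there (coeff⇒∈ x a e)

  coeff-Span⁻ : ∀ {P : A → Set} {x} → Span _≟_ P ∋ x → ∀ {a} → co x a ≡ true → P a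
  coeff-Span⁻ (y , ps , e) {a} c = All.lookup ps (coeff⇒∈ y a (trans (sym (coeff-≡ e a)) c))

  restrict : (A → Bool) → LinearMap (Free _≟_) (Free _≟_)
  restrict φ = extend _≟_ (λ a → if φ a then a ∷ [] else [])

  coeff-restrict : ∀ φ x a → co (restrict φ $ x) a ≡ φ a ∧ co x a
  coeff-restrict φ []      a = sym (Bool.∧-zeroʳ (φ a))
  coeff-restrict φ (b ∷ x) a with φ b in e | b ≟ a
  ... | true  | yes refl rewrite dec-true (b ≟ b) refl | coeff-restrict φ x b | e = refl
  ... | true  | no  b≢a  rewrite dec-false (b ≟ a) b≢a = coeff-restrict φ x a
  ... | false | yes refl rewrite coeff-restrict φ x b | e = refl
  ... | false | no  _    = coeff-restrict φ x a

  restrict-All : ∀ φ x → All (λ a → φ a ≡ true) (restrict φ $ x)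
  restrict-All φ []      = []
  restrict-All φ (b ∷ x) with φ b in e
  ... | true  = e ∷ restrict-All φ x
  ... | false = restrict-All φ x

  -- The list `x` may contain terms outside `P` that cancel in pairs. Restricting `x` to its own
  -- coefficient function discards them and keeps every coefficient, since `b ∧ b = b`.
  coeff-Span⁺ : ∀ {P : A → Set} {x} → (∀ {a} → co x a ≡ true → P a) → Span _≟_ P ∋ x
  coeff-Span⁺ {x = x} h = restrict (co x) $ x , All.map h (restrict-All (co x) x) ,
    same-coeff λ a → sym (trans (coeff-restrict (co x) x a) (Bool.∧-idem (co x a)))

  coeff≡false⇒≈0 : ∀ {x} → (∀ a → co x a ≢ true) → x ≈ᴹ []
  coeff≡false⇒≈0 h = same-coeff λ a → ≢true⇒≡false (h a)

  Span-∅ : ∀ {P : A → Set} {x} → (∀ a → ¬ P a) → Span _≟_ P ∋ x → x ≈ᴹ []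
  Span-∅ ¬P m = coeff≡false⇒≈0 λ a c → ¬P a (coeff-Span⁻ m c)

  restrict⁺ : ∀ {P R : A → Set} φ {x} → (∀ {a} → φ a ≡ true → P a → R a) →
              Span _≟_ P ∋ x → Span _≟_ R ∋ restrict φ $ x
  restrict⁺ φ {x} h m = coeff-Span⁺ λ {a} c →
    let (φa , xa) = ∧-true (trans (sym (coeff-restrict φ x a)) c) in h φa (coeff-Span⁻ m xa)

  restrict-id : ∀ {P : A → Set} φ {x} → (∀ {a} → P a → φ a ≡ true) → Span _≟_ P ∋ x →
                restrict φ $ x ≈ᴹ x
  restrict-id φ {x} h m = same-coeff λ a → trans (coeff-restrict φ x a) (go a (co x a) refl)
    where
    go : ∀ a c → co x a ≡ c → φ a ∧ c ≡ c
    go a false _ = Bool.∧-zeroʳ (φ a)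
    go a true  e = trans (Bool.∧-identityʳ (φ a)) (h (coeff-Span⁻ m e))

  restrict-zero : ∀ {P : A → Set} φ {x} → (∀ {a} → P a → φ a ≢ true) → Span _≟_ P ∋ x →
                  restrict φ $ x ≈ᴹ []
  restrict-zero φ {x} h m = coeff≡false⇒≈0 λ a c →
    let (φa , xa) = ∧-true (trans (sym (coeff-restrict φ x a)) c) in h (coeff-Span⁻ m xa) φa

  restrict-complement : ∀ {P R : A → Set} φ {x} → (∀ {a} → φ a ≢ true → P a → R a) →
                        Span _≟_ P ∋ x → Span _≟_ R ∋ (restrict φ $ x) ++ x
  restrict-complement φ {x} h m = coeff-Span⁺ λ {a} c → go a (φ a) (co x a) refl refl
    (trans (sym (trans (coeff-++ _≟_ (restrict φ $ x) x a)
                       (cong (_xor co x a) (coeff-restrict φ x a)))) c)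
    where
    go : ∀ a p q → φ a ≡ p → co x a ≡ q → (φ a ∧ co x a) xor co x a ≡ true → _
    go a false q     e e′ c = h (λ e″ → case trans (sym e) e″ of λ ())
      (coeff-Span⁻ m (trans (sym (cong (λ b → (b ∧ co x a) xor co x a) e)) c))
    go a true  q     e e′ c rewrite e | Bool.xor-same (co x a) = case c of λ ()

  -- All terms of `g a` share the value `ψ a` of `φ`, so the projection keeps `g a` whole or kills
  -- it. Two predicates are allowed because `d` shifts `E`.
  restrict-extend : ∀ φ ψ (g : A → List A) → (∀ a → All (λ b → φ b ≡ ψ a) (g a)) →
                    ∀ x → restrict φ $ (extend _≟_ g $ x) ≈ᴹ extend _≟_ g $ (restrict ψ $ x)
  restrict-extend φ ψ g h = extend-ext _≟_
    (compose _≟_ (restrict φ) (extend _≟_ g)) (compose _≟_ (extend _≟_ g) (restrict ψ)) single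
    where
    keep : ∀ {y} → All (λ b → φ b ≡ true) y → restrict φ $ y ≡ y
    keep []       = refl
    keep (e ∷ es) rewrite e = cong (_ ∷_) (keep es)
    drop : ∀ {y} → All (λ b → φ b ≡ false) y → restrict φ $ y ≡ []
    drop []       = refl
    drop (e ∷ es) rewrite e = drop es
    single : ∀ a → restrict φ $ (extend _≟_ g $ (a ∷ [])) ≈ᴹ extend _≟_ g $ (restrict ψ $ (a ∷ []))
    single a with ψ a | h a
    ... | true  | es = same-coeff λ b → cong (λ y → co y b) (keep (All.++⁺ es []))
    ... | false | es = same-coeff λ b → cong (λ y → co y b) (drop (All.++⁺ es []))

-- The first page is the Seifert cohomology

module SeifertCohomology (T : Graph) where
  open Graph T
  open Configurations T
  open Coefficients _≟ᶜ_
  open Char2 SC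
  private
    module d = LinearMap d

  π : ℤ → LinearMap SC SC
  π n = restrict (λ C → does (+ E C ℤ.≟ n))

  private
    module π n = LinearMap (π n)

  E≡ : ∀ {C n} → does (+ E C ℤ.≟ n) ≡ true → + E C ≡ n
  E≡ {C} {n} = does-true (+ E C ℤ.≟ n)

  π-D : ∀ n x → π n $ (D $ x) ≈ᴹ D $ (π n $ x)
  π-D n = restrict-extend _ _ _
    (λ C → All.map (λ {C′} (_ , e) → cong (λ m → does (+ m ℤ.≟ n)) e) (D-degree C))

  π-d : ∀ n x → π n $ (d $ x) ≈ᴹ d $ (π (n ℤ.- 1ℤ) $ x)
  π-d n = restrict-extend _ _ _ (λ C → All.map (λ {C′} (_ , e) → shift C C′ e) (d-degree C))
    where
    shift : ∀ C C′ → E C′ ≡ suc (E C) → does (+ E C′ ℤ.≟ n) ≡ does (+ E C ℤ.≟ n ℤ.- 1ℤ)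
    shift C C′ e rewrite e = does-⇔ (mk⇔
      (λ e′ → trans (sym ([p+a]-a (+ E C) 1ℤ)) (cong (ℤ._- 1ℤ) (trans (ℤ.+-comm (+ E C) 1ℤ) e′)))
      (λ e′ → trans (ℤ.+-comm 1ℤ (+ E C)) (trans (cong (ℤ._+ 1ℤ) e′) ([p-a]+a n 1ℤ))))
      (+ suc (E C) ℤ.≟ n) (+ E C ℤ.≟ n ℤ.- 1ℤ)

  π-∂ : ∀ n x → π n $ (∂ $ x) ≈ᴹ ((D $ (π n $ x)) +ᴹ (d $ (π (n ℤ.- 1ℤ) $ x)))
  π-∂ n x = ≈ᴹ-trans (π.+ᴹ-homo n (D $ x) (d $ x)) (+ᴹ-cong (π-D n x) (π-d n x))

  π-SC : ∀ {k} n {x} → SC^ k ∋ x → SC^[ k , n ] ∋ π n $ x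
  π-SC n = restrict⁺ _ (λ {C} e q → q , E≡ {C} e)

  π-F : ∀ {p k} n {x} → F p k ∋ x → SC^[ k , n ] ∋ π n $ x
  π-F n = restrict⁺ _ (λ {C} e (q , _) → q , E≡ {C} e)

  π-same : ∀ {k n x} → SC^[ k , n ] ∋ x → π n $ x ≈ᴹ x
  π-same {n = n} = restrict-id _ (λ {C} (_ , e) → dec-true (+ E C ℤ.≟ n) e)

  π-other : ∀ {k m n x} → m ≢ n → SC^[ k , m ] ∋ x → π n $ x ≈ᴹ []
  π-other m≢n = restrict-zero _ (λ {C} (_ , e) e′ → m≢n (trans (sym e) (E≡ {C} e′)))

  π-below : ∀ {p n k x} → n ℤ.< p → F p k ∋ x → π n $ x ≈ᴹ []
  π-below n<p = restrict-zero _ (λ {C} (_ , p≤E) e → ℤ.<⇒≱ n<p (subst (_ ℤ.≤_) (E≡ {C} e) p≤E))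

  n<n+1 : ∀ n → n ℤ.< n ℤ.+ 1ℤ
  n<n+1 n = ℤ.suc[i]≤j⇒i<j (ℤ.≤-reflexive (ℤ.+-comm 1ℤ n))

  n-1<n : ∀ n → n ℤ.- 1ℤ ℤ.< n
  n-1<n n = subst (n ℤ.- 1ℤ ℤ.<_) ([p-a]+a n 1ℤ) (n<n+1 (n ℤ.- 1ℤ))

  π+id-F : ∀ {p k x} → F p k ∋ x → F (p ℤ.+ 1ℤ) k ∋ ((π p $ x) +ᴹ x)
  π+id-F {p} = restrict-complement _ λ {C} e (q , p≤E) → q ,
    subst (ℤ._≤ + E C) (ℤ.+-comm 1ℤ p)
      (ℤ.i<j⇒suc[i]≤j (ℤ.≤∧≢⇒< p≤E (λ p≡E → e (dec-true (+ E C ℤ.≟ p) (sym p≡E)))))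

  SC[]⊆F : ∀ {k n x} → SC^[ k , n ] ∋ x → F n k ∋ x
  SC[]⊆F = Span-mono _≟ᶜ_ (λ (q , q′) → q , ℤ.≤-reflexive (sym q′))

  -- In `E`-degree `p` the map `d` contributes only the image of the part with `E = p - 1`, and on
  -- `F p` that part is zero. Hence the first page sees only `D`.
  π∂-F : ∀ {p k x} → F p k ∋ x → π p $ (∂ $ x) ≈ᴹ D $ (π p $ x)
  π∂-F {p} {k} {x} m = ≈ᴹ-trans (π-∂ p x)
    (x+0≈x (≈ᴹ-trans (d.⟦⟧-cong (π-below (n-1<n p) m)) d.0ᴹ-homo))

  open SpectralSequence SC-filtered using (Z; B)

  -- The inverse of `leading`: take the lowest part of a representative. Among the page 1
  -- boundaries, the summand in `F (p + 1)` has no such part, and the other is `∂t` with `t` in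
  -- `F (p - 1 + 1) = F p`, where `π∂-F` turns `∂` into `D`.
  unlead : ∀ p k → LinearMap (Eʳ 1 p k) SH^[ k , p ]
  unlead p k = induced (π p) {Z (+ 1) p k} {B (+ 1) p k} fZ fB
    where
    fZ : ∀ {x} → Z (+ 1) p k ∋ x → (SC^[ k , p ] ∩ kernel D) ∋ π p $ x
    fZ (m , n) = π-F p m , ≈ᴹ-trans (≈ᴹ-sym (π∂-F m)) (π-below (n<n+1 p) n)
    fB : ∀ {x} → B (+ 1) p k ∋ x → image D SC^[ k ℤ.- 1ℤ , p ] ∋ π p $ x
    fB (s , s′ , (ms , _) , (t , (mt , _) , q) , e) = π p $ t , π-F p mt ,
      ≈ᴹ-trans (π.⟦⟧-cong p e) (≈ᴹ-trans (π.+ᴹ-homo p s s′)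
        (≈ᴹ-trans (0+x≈x (π-below (n<n+1 p) ms))
          (≈ᴹ-trans (π.⟦⟧-cong p q) (π∂-F (subst (λ q → F q (k ℤ.- 1ℤ) ∋ t) ([p-a]+a p 1ℤ) mt)))))

  leadingₗ : ∀ p k → LinearMap SH^[ k , p ] (Eʳ 1 p k)
  leadingₗ p k = mkLinear SH^[ k , p ] (Eʳ 1 p k) (leading p k)
    (additive-cong SH^[ k , p ] (Eʳ 1 p k) (leading p k) homo (λ {x} → zero′ {x}))
    homo
    where
    open FilteredComplexProperties SC-filtered using (B⁺)
    homo : ∀ x y → leading p k (LeftModule._+ᴹ_ SH^[ k , p ] x y) ≈[ Eʳ 1 p k ]
                   LeftModule._+ᴹ_ (Eʳ 1 p k) (leading p k x) (leading p k y)
    homo x y = ≈⇒~ SC (Z (+ 1) p k) (B (+ 1) p k) ≈ᴹ-refl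
    zero′ : ∀ {x} → x ≈[ SH^[ k , p ] ] LeftModule.0ᴹ SH^[ k , p ] →
            leading p k x ≈[ Eʳ 1 p k ] LeftModule.0ᴹ (Eʳ 1 p k)
    zero′ {x} e = ~0⁺ {x = leading p k x} (go (~0⁻ {x = x} e))
      where
      go : image D SC^[ k ℤ.- 1ℤ , p ] ∋ proj₁ x → B (+ 1) p k ∋ proj₁ x
      -- `D y = d y + ∂ y`, where `d y` already has filtration `p + 1`.
      go (y , my , q) = B⁺ {+ 1} {p} (d $ y) y
        (mdy , subst (λ q → F q (k ℤ.+ 1ℤ) ∋ ∂ $ (d $ y)) (sym (ℤ.+-identityʳ (p ℤ.+ 1ℤ)))
          (Subspace.+-mem (F (p ℤ.+ 1ℤ) (k ℤ.+ 1ℤ)) (D-F mdy) (d-F mdy)))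
        (subst (λ q → F q (k ℤ.- 1ℤ) ∋ y) (sym ([p-a]+a p 1ℤ)) (SC[]⊆F my) ,
         subst (λ q → F q (k ℤ.- 1ℤ ℤ.+ 1ℤ) ∋ ∂ $ y) (sym (trans (ℤ.+-identityʳ _) ([p-a]+a p 1ℤ)))
          (Subspace.+-mem (F p (k ℤ.- 1ℤ ℤ.+ 1ℤ)) (D-F (SC[]⊆F my)) (d-F (SC[]⊆F my))))
        (≈ᴹ-sym (≈ᴹ-trans (+ᴹ-comm (d $ y) (∂ $ y))
          (≈ᴹ-trans (x+y+y≈x (D $ y) (d $ y)) (≈ᴹ-sym q))))
        where
        mdy : F (p ℤ.+ 1ℤ) k ∋ d $ y
        mdy = subst (λ l → F (p ℤ.+ 1ℤ) l ∋ d $ y) ([p-a]+a k 1ℤ) (SC[]⊆F (d-SC^[] my))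

  unlead-leading : ∀ p k x → unlead p k $ (leadingₗ p k $ x) ≈[ SH^[ k , p ] ] x
  unlead-leading p k (x , m , e) =
    ≈⇒~ SC (SC^[ k , p ] ∩ kernel D) (image D SC^[ k ℤ.- 1ℤ , p ]) (π-same m)

  leading-unlead : ∀ p k x → leadingₗ p k $ (unlead p k $ x) ≈[ Eʳ 1 p k ] x
  leading-unlead p k u@(x , m , n) = ~⁺ {x = leadingₗ p k $ (unlead p k $ u)} {y = u}
    (Z⊆B {+ 1} {p} (π+id-F m ,
      subst (λ q → F q (k ℤ.+ 1ℤ) ∋ ∂ $ ((π p $ x) +ᴹ x)) (sym (ℤ.+-identityʳ (p ℤ.+ 1ℤ)))
        (Subspace.+-mem (F (p ℤ.+ 1ℤ) (k ℤ.+ 1ℤ)) (D-F (π+id-F m)) (d-F (π+id-F m)))))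
    where open FilteredComplexProperties SC-filtered using (Z⊆B)

  leading-iso : ∀ p k → IsIso SH^[ k , p ] (Eʳ 1 p k) (leading p k)
  leading-iso p k = inverse⇒iso SH^[ k , p ] (Eʳ 1 p k) (leadingₗ p k) (unlead p k)
    (unlead-leading p k) (leading-unlead p k)

-- Regrouping a bigraded direct sum by one of its gradings

module _ {V W : Vect} where
  private
    module W = Char2 W

  zeroₗ : LinearMap V W
  zeroₗ = mkLinear V W (λ _ → W.0ᴹ) (λ _ → W.≈ᴹ-refl) (λ _ _ → W.≈ᴹ-sym (W.+ᴹ-identityˡ W.0ᴹ))

  Σₗ : ℕ → (ℕ → LinearMap V W) → LinearMap V W
  Σₗ zero    f = zeroₗ
  Σₗ (suc n) f = Σₗ n f ⊕ f n

  Σₗ-zero : ∀ n f {x} → (∀ i → i ℕ.< n → f i $ x W.≈ᴹ W.0ᴹ) → Σₗ n f $ x W.≈ᴹ W.0ᴹ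
  Σₗ-zero zero    f z = W.≈ᴹ-refl
  Σₗ-zero (suc n) f z = W.≈ᴹ-trans (W.0+x≈x (Σₗ-zero n f (λ i i<n → z i (ℕ.m<n⇒m<1+n i<n))))
    (z n (ℕ.n<1+n n))

  Σₗ-only : ∀ n f {x m} → m ℕ.< n → (∀ i → i ≢ m → f i $ x W.≈ᴹ W.0ᴹ) → Σₗ n f $ x W.≈ᴹ f m $ x
  Σₗ-only (suc n) f {x} {m} m<1+n z = go (m ℕ.≟ n)
    where
    go : Dec (m ≡ n) → Σₗ (suc n) f $ x W.≈ᴹ f m $ x
    go (yes refl) = W.0+x≈x (Σₗ-zero n f (λ i i<n → z i (ℕ.<⇒≢ i<n)))
    go (no m≢n)   = W.≈ᴹ-trans (W.x+0≈x (z n (m≢n ∘ sym)))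
      (Σₗ-only n f (ℕ.≤∧≢⇒< (ℕ.s≤s⁻¹ m<1+n) m≢n) z)

module _ {I : Set} (A : I → Vect) where

  projₗ : ∀ i → LinearMap (⨁ A) (A i)
  projₗ i = mkLinear (⨁ A) (A i) (λ ξ → component ξ i) (λ e → at-index e i)
    (λ _ _ → LeftModule.≈ᴹ-refl (A i))

InRange : ℕ → ℤ → Set
InRange M n = ∃[ m ] (m ℕ.< M × n ≡ + m)

inRange? : ∀ M n → Dec (InRange M n)
inRange? M -[1+ _ ] = no λ ()
inRange? M (+ m) with m ℕ.<? M
... | yes m<M = yes (m , m<M , refl)
... | no  m≮M = no λ { (_ , m<M , refl) → m≮M m<M }

-- The first grading is bounded, so regrouping along the second one takes finite sums.

module Regroup (A : ℤ → ℤ → Vect) (B : ℤ → Vect) (M : ℕ)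
  (inc  : ∀ n k → LinearMap (A n k) (B k))
  (part : ∀ n k → LinearMap (B k) (A n k))
  (part-inc : ∀ n k x → part n k $ (inc n k $ x) ≈[ A n k ] x)
  (part-inc-other : ∀ {m n} → m ≢ n → ∀ k x →
    part n k $ (inc m k $ x) ≈[ A n k ] LeftModule.0ᴹ (A n k))
  (part-injective : ∀ k y → (∀ n → part n k $ y ≈[ A n k ] LeftModule.0ᴹ (A n k)) →
    y ≈[ B k ] LeftModule.0ᴹ (B k))
  (bounded : ∀ {n k} → ¬ InRange M n → ∀ x → x ≈[ A n k ] LeftModule.0ᴹ (A n k))
  where
  private
    module A {n k} = LeftModule (A n k)
    module B {k} = LeftModule (B k)

    summand : ∀ k n → LinearMap (⨁ (λ ((n , k) : ℤ × ℤ) → A n k)) (B k)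
    summand k n = inc (+ n) k ∘ₗ projₗ (λ ((n , k) : ℤ × ℤ) → A n k) (+ n , k)

    summand-0 : ∀ k n ξ → component ξ (+ n , k) A.≈ᴹ A.0ᴹ → summand k n $ ξ B.≈ᴹ B.0ᴹ
    summand-0 k n ξ e = B.≈ᴹ-trans (LinearMap.⟦⟧-cong (inc (+ n) k) e)
      (LinearMap.0ᴹ-homo (inc (+ n) k))

    summand-ι : ∀ k n k′ n′ x → (n , k) ≢ (+ n′ , k′) →
                summand k′ n′ $ ι ℤ²-≟ {λ ((n , k) : ℤ × ℤ) → A n k} (n , k) x B.≈ᴹ B.0ᴹ
    summand-ι k n k′ n′ x distinct = summand-0 k′ n′
      (ι ℤ²-≟ {λ ((n , k) : ℤ × ℤ) → A n k} (n , k) x)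
      (A.≈ᴹ-reflexive (ι-other ℤ²-≟ {λ ((n , k) : ℤ × ℤ) → A n k} distinct))

  opaque
    φ : LinearMap (⨁ (λ ((n , k) : ℤ × ℤ) → A n k)) (⨁ B)
    φ = mkLinear (⨁ (λ ((n , k) : ℤ × ℤ) → A n k)) (⨁ B)
      (λ ξ → family (λ k → Σₗ M (summand k) $ ξ) (List.map proj₂ (support ξ))
        (λ k k∉ → Σₗ-zero M (summand k) (λ n _ → summand-0 k n ξ
          (vanishes ξ (+ n , k) (λ m → k∉ (∈-map⁺ proj₂ m))))))
      (λ e → pointwise λ k → LinearMap.⟦⟧-cong (Σₗ M (summand k)) e)
      (λ ξ ζ → pointwise λ k → LinearMap.+ᴹ-homo (Σₗ M (summand k)) ξ ζ)

    φ-ι : ∀ n k x → φ $ ι ℤ²-≟ (n , k) x ≈[ ⨁ B ] ι ℤ._≟_ k (inc n k $ x)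
    φ-ι n k x = ι-unique ℤ._≟_ k (φ $ ι ℤ²-≟ (n , k) x) (same (inRange? M n) x)
      (λ k′ k≢k′ → Σₗ-zero M (summand k′) (λ n′ _ → summand-ι k n k′ n′ x (k≢k′ ∘ cong proj₂)))
      where
      same : ∀ {n} → Dec (InRange M n) → (x : Carrier (A n k)) →
             Σₗ M (summand k) $ ι ℤ²-≟ (n , k) x ≈[ B k ] inc n k $ x
      same (yes (m , m<M , refl)) x = B.≈ᴹ-trans
        (Σₗ-only M (summand k) m<M (λ i i≢m → summand-ι k (+ m) k i x
          (λ e → i≢m (sym (ℤ.+-injective (cong proj₁ e))))))
        (LinearMap.⟦⟧-cong (inc (+ m) k) (A.≈ᴹ-reflexive {+ m} {k}
          (ι-same ℤ²-≟ {λ ((n , k) : ℤ × ℤ) → A n k} (+ m , k))))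
      same {n} (no ¬range) x = B.≈ᴹ-trans
        (Σₗ-zero M (summand k) (λ i i<M → summand-ι k n k i x
          (λ e → ¬range (i , i<M , cong proj₁ e))))
        (B.≈ᴹ-sym (B.≈ᴹ-trans (LinearMap.⟦⟧-cong (inc n k) (bounded ¬range x))
          (LinearMap.0ᴹ-homo (inc n k))))

    φ⁻¹ : LinearMap (⨁ B) (⨁ (λ ((n , k) : ℤ × ℤ) → A n k))
    φ⁻¹ = mkLinear (⨁ B) (⨁ (λ ((n , k) : ℤ × ℤ) → A n k))
      (λ η → family (λ (n , k) → part n k $ component η k)
        (cartesianProduct (List.map +_ (upTo M)) (support η))
        (λ (n , k) ∉ → vanish η n k (inRange? M n) ∉))
      (λ e → pointwise λ (n , k) → LinearMap.⟦⟧-cong (part n k) (at-index e k))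
      (λ η θ → pointwise λ (n , k) → LinearMap.+ᴹ-homo (part n k) (component η k) (component θ k))
      where
      vanish : ∀ (η : Carrier (⨁ B)) n k → Dec (InRange M n) →
        ¬ ((n , k) List.∈ cartesianProduct (List.map +_ (upTo M)) (support η)) →
        part n k $ component η k A.≈ᴹ A.0ᴹ
      vanish η n k (no ¬range) ∉ = bounded ¬range (part n k $ component η k)
      vanish η n k (yes (m , m<M , refl)) ∉ = A.≈ᴹ-trans
        (LinearMap.⟦⟧-cong (part n k)
          (vanishes η k (λ k∈ → ∉ (∈-cartesianProduct⁺ (∈-map⁺ +_ (∈-upTo⁺ m<M)) k∈))))
        (LinearMap.0ᴹ-homo (part n k))

    φ⁻¹φ : ∀ ξ → φ⁻¹ $ (φ $ ξ) ≈[ ⨁ (λ ((n , k) : ℤ × ℤ) → A n k) ] ξ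
    φ⁻¹φ = ⨁-ext ℤ²-≟ (φ⁻¹ ∘ₗ φ) (idMap (⨁ (λ ((n , k) : ℤ × ℤ) → A n k))) λ (n , k) x →
      LeftModule.≈ᴹ-trans (⨁ (λ ((n , k) : ℤ × ℤ) → A n k)) (LinearMap.⟦⟧-cong φ⁻¹ (φ-ι n k x))
        (ι-unique ℤ²-≟ (n , k) (φ⁻¹ $ ι ℤ._≟_ k (inc n k $ x))
          (A.≈ᴹ-trans (LinearMap.⟦⟧-cong (part n k) (B.≈ᴹ-reflexive (ι-same ℤ._≟_ {B} k)))
            (part-inc n k x))
          (λ (n′ , k′) → other n k n′ k′ x (k ℤ.≟ k′)))
      where
      other : ∀ n k n′ k′ x → Dec (k ≡ k′) → (n , k) ≢ (n′ , k′) →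
        part n′ k′ $ component (ι ℤ._≟_ {B} k (inc n k $ x)) k′ A.≈ᴹ A.0ᴹ
      other n k n′ k′ x (yes refl) distinct = A.≈ᴹ-trans
        (LinearMap.⟦⟧-cong (part n′ k) (B.≈ᴹ-reflexive (ι-same ℤ._≟_ {B} k)))
        (part-inc-other (λ e → distinct (cong (_, k) e)) k x)
      other n k n′ k′ x (no k≢k′) distinct = A.≈ᴹ-trans
        (LinearMap.⟦⟧-cong (part n′ k′) (B.≈ᴹ-reflexive (ι-other ℤ._≟_ {B} k≢k′)))
        (LinearMap.0ᴹ-homo (part n′ k′))

    -- `part-injective` says that `φ⁻¹` is injective, and by `φ⁻¹φ` it takes the same value on both
    -- sides.
    φφ⁻¹ : ∀ η → φ $ (φ⁻¹ $ η) ≈[ ⨁ B ] η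
    φφ⁻¹ η = pointwise λ k → Char2.x+y≈0⇒x≈y (B k) (part-injective k _ λ n →
      A.≈ᴹ-trans (LinearMap.+ᴹ-homo (part n k) (component (φ $ (φ⁻¹ $ η)) k) (component η k))
        (Char2.x≈y⇒x+y≈0 (A n k) (at-index (φ⁻¹φ (φ⁻¹ $ η)) (n , k))))

    φ-iso : IsIso (⨁ (λ ((n , k) : ℤ × ℤ) → A n k)) (⨁ B) (φ $_)
    φ-iso = inverse⇒iso (⨁ (λ ((n , k) : ℤ × ℤ) → A n k)) (⨁ B) φ φ⁻¹ φ⁻¹φ φφ⁻¹

  module Precompose (E : ℤ → ℤ → Vect)
    (f : ∀ n k → LinearMap (A n k) (E n k)) (g : ∀ n k → LinearMap (E n k) (A n k))
    (gf : ∀ n k x → g n k $ (f n k $ x) ≈[ A n k ] x)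
    (fg : ∀ n k x → f n k $ (g n k $ x) ≈[ E n k ] x)
    where
    private
      f⨁ : LinearMap (⨁ (λ ((n , k) : ℤ × ℤ) → A n k)) (⨁ (λ ((n , k) : ℤ × ℤ) → E n k))
      f⨁ = ⨁-map (λ ((n , k) : ℤ × ℤ) → A n k) (λ ((n , k) : ℤ × ℤ) → E n k)
        id id (λ _ → refl) (λ (n , k) → f n k)

      g⨁ : LinearMap (⨁ (λ ((n , k) : ℤ × ℤ) → E n k)) (⨁ (λ ((n , k) : ℤ × ℤ) → A n k))
      g⨁ = ⨁-map (λ ((n , k) : ℤ × ℤ) → E n k) (λ ((n , k) : ℤ × ℤ) → A n k)
        id id (λ _ → refl) (λ (n , k) → g n k)

    opaque
      ψ : LinearMap (⨁ (λ ((n , k) : ℤ × ℤ) → E n k)) (⨁ B)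
      ψ = φ ∘ₗ g⨁

      ψ-iso : IsIso (⨁ (λ ((n , k) : ℤ × ℤ) → E n k)) (⨁ B) (ψ $_)
      ψ-iso = inverse⇒iso (⨁ (λ ((n , k) : ℤ × ℤ) → E n k)) (⨁ B) ψ (f⨁ ∘ₗ φ⁻¹)
        (λ ξ → LeftModule.≈ᴹ-trans (⨁ (λ ((n , k) : ℤ × ℤ) → E n k))
          (LinearMap.⟦⟧-cong f⨁ (φ⁻¹φ (g⨁ $ ξ)))
          (pointwise λ (n , k) → fg n k (component ξ (n , k))))
        (λ η → LeftModule.≈ᴹ-trans (⨁ B)
          (LinearMap.⟦⟧-cong φ (pointwise λ (n , k) → gf n k (component (φ⁻¹ $ η) (n , k))))
          (φφ⁻¹ η))

      ψ-ι : ∀ n k x → ψ $ ι ℤ²-≟ (n , k) x ≈[ ⨁ B ] ι ℤ._≟_ k (inc n k $ (g n k $ x))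
      ψ-ι n k x = LeftModule.≈ᴹ-trans (⨁ B)
        (LinearMap.⟦⟧-cong φ
          (⨁-map-ι ℤ²-≟ ℤ²-≟ (λ ((n , k) : ℤ × ℤ) → E n k) (λ ((n , k) : ℤ × ℤ) → A n k)
            id id (λ _ → refl) (λ (n , k) → g n k) (n , k) x))
        (φ-ι n k (g n k $ x))

      ψ-f : ∀ n k x → ψ $ ι ℤ²-≟ (n , k) (f n k $ x) ≈[ ⨁ B ] ι ℤ._≟_ k (inc n k $ x)
      ψ-f n k x = LeftModule.≈ᴹ-trans (⨁ B) (ψ-ι n k (f n k $ x))
        (ι-cong ℤ._≟_ k (LinearMap.⟦⟧-cong (inc n k) (gf n k x)))

-- The first differential as the map induced by `d`

module SeifertSum (T : Graph) where
  open Graph T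
  open Configurations T
  open Coefficients _≟ᶜ_
  open SeifertCohomology T
  open Char2 SC
  private
    module π n = LinearMap (π n)

  -- A crude bound for `E`: at most `order` minuses and `size` red edges. It also bounds the length
  -- of the filtration.
  N : ℕ
  N = order ℕ.+ size

  E≤N : ∀ C → E C ℕ.≤ N
  E≤N C = ℕ.+-mono-≤ (Vec.count≤n (_≟ᴹ _) (mark C)) (∣p∣≤n (red C))

  SC[]-range : ∀ {k n x} → (∀ m → m ℕ.< suc N → n ≢ + m) → SC^[ k , n ] ∋ x → x ≈ᴹ []
  SC[]-range h = Span-∅ (λ C (_ , e) → h (E C) (ℕ.s≤s (E≤N C)) (sym e))

  SH[]-range : ∀ {n k} → ¬ InRange (suc N) n →
               (x : Carrier SH^[ k , n ]) → x ≈[ SH^[ k , n ] ] LeftModule.0ᴹ SH^[ k , n ]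
  SH[]-range {n} {k} h (x , m , _) = ≈⇒~ SC (SC^[ k , n ] ∩ kernel D) (image D SC^[ k ℤ.- 1ℤ , n ])
    (SC[]-range (λ i i<1+N e → h (i , i<1+N , e)) m)

  part : ∀ n k → LinearMap (SH^ k) SH^[ k , n ]
  part n k = induced (π n) {SC^ k ∩ kernel D} {image D (SC^ (k ℤ.- 1ℤ))}
    (λ {x} (m , e) → π-SC n m ,
      ≈ᴹ-trans (≈ᴹ-sym (π-D n x)) (≈ᴹ-trans (π.⟦⟧-cong n e) (π.0ᴹ-homo n)))
    (λ (y , m , e) → π n $ y , π-SC n m , ≈ᴹ-trans (π.⟦⟧-cong n e) (π-D n y))

  part-forget : ∀ n k x → part n k $ (forget n k $ x) ≈[ SH^[ k , n ] ] x
  part-forget n k (x , m , _) =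
    ≈⇒~ SC (SC^[ k , n ] ∩ kernel D) (image D SC^[ k ℤ.- 1ℤ , n ]) (π-same m)

  part-forget-other : ∀ {m n} → m ≢ n → ∀ k x →
                      part n k $ (forget m k $ x) ≈[ SH^[ k , n ] ] LeftModule.0ᴹ SH^[ k , n ]
  part-forget-other {m} {n} m≢n k (x , mx , _) =
    ≈⇒~ SC (SC^[ k , n ] ∩ kernel D) (image D SC^[ k ℤ.- 1ℤ , n ]) (π-other m≢n mx)

  -- `y` is the sum of its finitely many parts `π n`, each a `D`-boundary by hypothesis. The sums
  -- `partial n` collect the parts with `E < n`, so they reach `y` at `n = N + 1`.
  part-injective : ∀ k y →
    (∀ n → part n k $ y ≈[ SH^[ k , n ] ] LeftModule.0ᴹ SH^[ k , n ]) →
    y ≈[ SH^ k ] LeftModule.0ᴹ (SH^ k)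
  part-injective k u@(y , _) h = ~0⁺ {x = u}
    (Subspace.resp (image D (SC^ (k ℤ.- 1ℤ)))
      (same-coeff λ C → coefficient (suc N) C (ℕ.s≤s (E≤N C)))
      (bounding (suc N)))
    where
    co = coeff _≟ᶜ_
    partial : ℕ → List Config
    partial zero    = []
    partial (suc n) = partial n ++ (π (+ n) $ y)
    bounding : ∀ n → image D (SC^ (k ℤ.- 1ℤ)) ∋ partial n
    bounding zero    = Subspace.0-mem (image D (SC^ (k ℤ.- 1ℤ)))
    bounding (suc n) = Subspace.+-mem (image D (SC^ (k ℤ.- 1ℤ))) (bounding n)
      (let (w , mw , e) = ~0⁻ {x = part (+ n) k $ u} (h (+ n)) in w , Span-mono _≟ᶜ_ proj₁ mw , e)
    step : ∀ n C → co (partial (suc n)) C ≡ co (partial n) C xor (does (+ E C ℤ.≟ + n) ∧ co y C)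
    step n C = trans (coeff-++ _≟ᶜ_ (partial n) (π (+ n) $ y) C)
      (cong (co (partial n) C xor_) (coeff-restrict _ y C))
    not-yet : ∀ n C → n ℕ.≤ E C → co (partial n) C ≡ false
    not-yet zero    C _   = refl
    not-yet (suc n) C n<E = trans (step n C) (cong₂ (λ a b → a xor (b ∧ co y C))
      (not-yet n C (ℕ.<⇒≤ n<E))
      (dec-false (+ E C ℤ.≟ + n) (λ e → ℕ.<⇒≢ n<E (sym (ℤ.+-injective e)))))
    coefficient : ∀ n C → E C ℕ.< n → co (partial n) C ≡ co y C
    coefficient (suc n) C E<1+n = trans (step n C) (go (E C ℕ.≟ n))
      where
      go : Dec (E C ≡ n) → co (partial n) C xor (does (+ E C ℤ.≟ + n) ∧ co y C) ≡ co y C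
      go (yes e) = cong₂ (λ a b → a xor (b ∧ co y C))
        (not-yet n C (ℕ.≤-reflexive (sym e))) (dec-true (+ E C ℤ.≟ + n) (cong +_ e))
      go (no E≢n) = trans (cong₂ (λ a b → a xor (b ∧ co y C))
        (coefficient n C (ℕ.≤∧≢⇒< (ℕ.s≤s⁻¹ E<1+n) E≢n))
        (dec-false (+ E C ℤ.≟ + n) (λ e → E≢n (ℤ.+-injective e)))) (Bool.xor-identityʳ _)

  open FilteredComplexProperties SC-filtered using (d-ι; δ-rep)

  d∗-rep : ∀ {k k′} (e : k ℤ.+ 1ℤ ≡ k′) (x : Carrier (SH^ k)) → proj₁ (d∗ e $ x) ≡ d $ proj₁ x
  d∗-rep refl x = refl

  -- For `u` in `F (p - 1)`, the part of `∂u` with `E = p` is `d` of the leading part of `u` plus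
  -- `D` of the next part. The latter is a `D`-boundary, which leaves the map induced by `d`.
  ψ-δ : ∀ p k x → forget p k $ (unlead p k $ (δ-in 1 p k $ x)) ≈[ SH^ k ]
        d∗ ([p-a]+a k 1ℤ) $ (forget (p ℤ.- 1ℤ) (k ℤ.- 1ℤ) $ (unlead (p ℤ.- 1ℤ) (k ℤ.- 1ℤ) $ x))
  ψ-δ p k x@(u , m , _) = ~⁺ {x = forget p k $ (unlead p k $ (δ-in 1 p k $ x))} {y = d∗ k-1+1 $ y}
    (subst₂ (λ a b → image D (SC^ (k ℤ.- 1ℤ)) ∋ ((π p $ a) +ᴹ b))
      (sym (δ-rep 1 ([p-a]+a p (+ 1)) k-1+1 x))
      (sym (d∗-rep k-1+1 y))
      (π p $ u , Span-mono _≟ᶜ_ proj₁ (π-F p m) ,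
       ≈ᴹ-trans (+ᴹ-cong (π-∂ p u) ≈ᴹ-refl) (x+y+y≈x (D $ (π p $ u)) (d $ (π (p ℤ.- 1ℤ) $ u)))))
    where
    k-1+1 : k ℤ.- 1ℤ ℤ.+ 1ℤ ≡ k
    k-1+1 = [p-a]+a k 1ℤ
    y : Carrier (SH^ (k ℤ.- 1ℤ))
    y = forget (p ℤ.- 1ℤ) (k ℤ.- 1ℤ) $ (unlead (p ℤ.- 1ℤ) (k ℤ.- 1ℤ) $ x)

  module Sum = Regroup (λ n k → SH^[ k , n ]) SH^ (suc N) forget part
    part-forget part-forget-other part-injective SH[]-range

  module Page = Sum.Precompose (λ p k → Eʳ 1 p k) leadingₗ unlead unlead-leading leading-unlead

  open Page using (ψ)

  ψ-ι : ∀ p k x → ψ $ at 1 p k x ≈[ SH ] ι ℤ._≟_ k (forget p k $ (unlead p k $ x))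
  ψ-ι = Page.ψ-ι

  ψ-leading : ∀ p k x → ψ $ at 1 p k (leading p k x) ≈[ SH ] ι ℤ._≟_ k (forget p k $ x)
  ψ-leading = Page.ψ-f

  SH-d-ι : ∀ k y → SH-d $ ι ℤ._≟_ (k ℤ.- 1ℤ) y ≈[ SH ] ι ℤ._≟_ k (d∗ ([p-a]+a k 1ℤ) $ y)
  SH-d-ι = ⨁-map-ι ℤ._≟_ ℤ._≟_ SH^ SH^ (ℤ._- 1ℤ) (ℤ._+ 1ℤ)
      (λ k → [p-a]+a k 1ℤ) (λ k → d∗ ([p-a]+a k 1ℤ))

  ψ-d-target : ∀ p k x → ψ $ (dʳ 1 $ at 1 (p ℤ.- 1ℤ) (k ℤ.- 1ℤ) x) ≈[ SH ]
                         SH-d $ (ψ $ at 1 (p ℤ.- 1ℤ) (k ℤ.- 1ℤ) x)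
  ψ-d-target p k x =
      LinearMap.⟦⟧-cong ψ (d-ι 1 p k x)
    ⨾ ψ-ι p k (δ-in 1 p k $ x)
    ⨾ ι-cong ℤ._≟_ k (ψ-δ p k x)
    ⨾ LeftModule.≈ᴹ-sym SH
        (SH-d-ι k (forget (p ℤ.- 1ℤ) (k ℤ.- 1ℤ) $ (unlead (p ℤ.- 1ℤ) (k ℤ.- 1ℤ) $ x)))
    ⨾ LinearMap.⟦⟧-cong SH-d (LeftModule.≈ᴹ-sym SH (ψ-ι (p ℤ.- 1ℤ) (k ℤ.- 1ℤ) x))
    where
    infixr 2 _⨾_
    _⨾_ : ∀ {x y z} → equal SH x y → equal SH y z → equal SH x z
    _⨾_ = LeftModule.≈ᴹ-trans SH

  ψ-d : ∀ ξ → ψ $ (dʳ 1 $ ξ) ≈[ SH ] SH-d $ (ψ $ ξ)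
  ψ-d = ⨁-ext ℤ²-≟ (ψ ∘ₗ dʳ 1) (SH-d ∘ₗ ψ)
    (λ (p , k) x → go {p ℤ.+ 1ℤ} {k ℤ.+ 1ℤ} ([p+a]-a p 1ℤ) ([p+a]-a k 1ℤ) x)
    where
    go : ∀ {p k p′ k′} → p ℤ.- 1ℤ ≡ p′ → k ℤ.- 1ℤ ≡ k′ → (x : Carrier (Eʳ 1 p′ k′)) →
         ψ $ (dʳ 1 $ at 1 p′ k′ x) ≈[ SH ] SH-d $ (ψ $ at 1 p′ k′ x)
    go {p} {k} refl refl x = ψ-d-target p k x

-- Uniqueness of the perfect matching of a tree

module PerfectMatchings (T : Graph) where
  open Graph T

  PerfectMatching : Subset size → Set
  PerfectMatching r = ∀ x → ∃! _≡_ (λ e → e ∈ r × IsEndOf x e)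

  -- Decidability serves twice: it recovers a matching from the irrelevant validity of an unmarked
  -- configuration, and it settles which of the two dimensions occurs.
  perfectMatching? : ∀ r → Dec (PerfectMatching r)
  perfectMatching? r = Fin.all? λ x → map′
    (λ (e , p , unique) → e , p , λ {f} q → unique f q)
    (λ (e , p , unique) → e , p , λ f q → unique {f} q)
    (Fin.any? λ e → covers? x e ×-dec Fin.all? λ f → covers? x f →-dec (e Fin.≟ f))
    where
    covers? : ∀ x e → Dec (e ∈ r × IsEndOf x e)
    covers? x e = (e ∈? r) ×-dec ((src e Fin.≟ x) ⊎-dec (tgt e Fin.≟ x))

  Joins-sym : ∀ {e x y} → Joins e x y → Joins e y x
  Joins-sym (inj₁ p) = inj₂ p
  Joins-sym (inj₂ p) = inj₁ p

  Joins⇒end : ∀ {e x y} → Joins e x y → IsEndOf x e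
  Joins⇒end (inj₁ (p , _)) = inj₁ p
  Joins⇒end (inj₂ (_ , q)) = inj₂ q

  Adjacent-irrefl : ∀ {x} → ¬ Adjacent x x
  Adjacent-irrefl (e , inj₁ (p , q)) = loopless e (trans p (sym q))
  Adjacent-irrefl (e , inj₂ (p , q)) = loopless e (trans p (sym q))

  module Partner {r : Subset size} (M : PerfectMatching r) where

    edge : Vertex → Edge
    edge x = proj₁ (M x)

    edge∈ : ∀ x → edge x ∈ r
    edge∈ x = proj₁ (proj₁ (proj₂ (M x)))

    edge-unique : ∀ {x y e} → e ∈ r → Joins e x y → edge x ≡ e
    edge-unique {x} e∈r j = proj₂ (proj₂ (M x)) (e∈r , Joins⇒end j)

    other-end : ∀ {x e} → IsEndOf x e → ∃[ y ] Joins e x y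
    other-end {e = e} (inj₁ p) = tgt e , inj₁ (p , refl)
    other-end {e = e} (inj₂ q) = src e , inj₂ (refl , q)

    partner : Vertex → Vertex
    partner x = proj₁ (other-end {x} (proj₂ (proj₁ (proj₂ (M x)))))

    joins : ∀ x → Joins (edge x) x (partner x)
    joins x = proj₂ (other-end {x} (proj₂ (proj₁ (proj₂ (M x)))))

    partner-unique : ∀ {x y e} → e ∈ r → Joins e x y → partner x ≡ y
    partner-unique {x} {y} e∈r j =
      ends (subst (λ f → Joins f x (partner x)) (edge-unique e∈r j) (joins x)) j
      where
      ends : ∀ {e y z} → Joins e x y → Joins e x z → y ≡ z
      ends (inj₁ (_ , q)) (inj₁ (_ , q′)) = trans (sym q) q′
      ends {e} (inj₁ (p , _)) (inj₂ (_ , q′)) = ⊥-elim (loopless e (trans p (sym q′)))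
      ends {e} (inj₂ (_ , q)) (inj₁ (p′ , _)) = ⊥-elim (loopless e (trans p′ (sym q)))
      ends (inj₂ (p , _)) (inj₂ (p′ , _)) = trans (sym p) p′

    partner-involutive : ∀ x → partner (partner x) ≡ x
    partner-involutive x = partner-unique (edge∈ x) (Joins-sym (joins x))

    adjacent : ∀ x → Adjacent x (partner x)
    adjacent x = edge x , joins x

  -- The first return of a walk without backtracking would close a cycle.

  module _ (tree : IsTree T) where
    open IsTree tree

    module _ (w : ℕ → Vertex) (step : ∀ n → Adjacent (w n) (w (suc n)))
             (no-backtracking : ∀ n → w n ≢ w (suc (suc n))) where

      no-return : ∀ g i → w i ≢ w (i ℕ.+ suc g)
      no-return = <-rec (λ g → ∀ i → w i ≢ w (i ℕ.+ suc g)) return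
        where
        return : ∀ g → (∀ {h} → h ℕ.< g → ∀ i → w i ≢ w (i ℕ.+ suc h)) → ∀ i → w i ≢ w (i ℕ.+ suc g)
        return zero _ i e = Adjacent-irrefl
          (subst (Adjacent (w i)) (trans (cong w (sym (ℕ.+-comm i 1))) (sym e)) (step i))
        return (suc zero) _ i e = no-backtracking i (trans e (cong w (ℕ.+-comm i 2)))
        -- The walk returns after `l + 3` steps. A coincidence among the vertices at `i` to
        -- `i + l + 2` would be a shorter return, so they are distinct, and the last step closes the
        -- cycle.
        return (suc (suc l)) shorter i e = acyclic l c c-injective c-step
          (subst₂ Adjacent
            (cong (λ n → w (i ℕ.+ n)) (sym (Fin.toℕ-fromℕ (2 ℕ.+ l))))
            (trans (sym e) (cong w (sym (ℕ.+-identityʳ i))))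
            (subst (λ n → Adjacent (w (i ℕ.+ (2 ℕ.+ l))) (w n))
              (sym (ℕ.+-suc i (2 ℕ.+ l))) (step _)))
          where
          c : Fin (3 ℕ.+ l) → Vertex
          c a = w (i ℕ.+ toℕ a)
          c-step : ∀ a → Adjacent (c (inject₁ a)) (c (suc a))
          c-step a = subst₂ (λ m n → Adjacent (w m) (w n))
            (cong (i ℕ.+_) (sym (Fin.toℕ-inject₁ a))) (sym (ℕ.+-suc i (toℕ a))) (step (i ℕ.+ toℕ a))
          apart : ∀ {a b : Fin (3 ℕ.+ l)} → toℕ a ℕ.< toℕ b → c a ≢ c b
          apart {a} {b} a<b e′ = shorter gap<g (i ℕ.+ toℕ a) (trans e′ (cong w index))
            where
            gap : ℕ
            gap = toℕ b ℕ.∸ suc (toℕ a)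
            gap<g : gap ℕ.< 2 ℕ.+ l
            gap<g = ℕ.<-≤-trans (ℕ.∸-monoʳ-< {toℕ b} {suc (toℕ a)} {0} ℕ.z<s a<b)
              (ℕ.s≤s⁻¹ (Fin.toℕ<n b))
            index : i ℕ.+ toℕ b ≡ i ℕ.+ toℕ a ℕ.+ suc gap
            index = trans (cong (i ℕ.+_) (sym (trans (ℕ.+-suc (toℕ a) gap) (ℕ.m+[n∸m]≡n a<b))))
              (sym (ℕ.+-assoc i (toℕ a) (suc gap)))
          c-injective : ∀ {a b} → c a ≡ c b → a ≡ b
          c-injective {a} {b} e′ with ℕ.<-cmp (toℕ a) (toℕ b)
          ... | tri< a<b _ _ = ⊥-elim (apart {a} {b} a<b e′)
          ... | tri≈ _ a≡b _ = Fin.toℕ-injective a≡b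
          ... | tri> _ _ b<a = ⊥-elim (apart {b} {a} b<a (sym e′))

      no-infinite-walk : ⊥
      no-infinite-walk with Fin.pigeonhole (ℕ.n<1+n order) (w ∘ toℕ)
      ... | i , j , i<j , e = no-return (toℕ j ℕ.∸ suc (toℕ i)) (toℕ i)
        (trans e (cong w (sym (trans (ℕ.+-suc (toℕ i) _) (ℕ.m+[n∸m]≡n i<j)))))

    alternate : (f g : Vertex → Vertex) → Vertex → ℕ → Vertex
    alternate f g v zero    = v
    alternate f g v (suc n) = alternate g f (f v) n

    -- If `f v ≢ g v`, the walk `v`, `f v`, `g (f v)`, ... never backtracks: `g (f v) = v` would
    -- give `f v = g v`. The inequality passes on to `f v` with `f` and `g` exchanged, since
    -- `f (f v) = v`.
    partners-agree : ∀ (f g : Vertex → Vertex) →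
      (∀ x → f (f x) ≡ x) → (∀ x → g (g x) ≡ x) →
      (∀ x → Adjacent x (f x)) → (∀ x → Adjacent x (g x)) → ∀ v → f v ≡ g v
    partners-agree f g ff gg f-adj g-adj v with f v Fin.≟ g v
    ... | yes e  = e
    ... | no fv≢gv = ⊥-elim (no-infinite-walk (alternate f g v)
                    (step f g f-adj g-adj v) (forward f g ff gg v fv≢gv))
      where
      step : ∀ f g → (∀ x → Adjacent x (f x)) → (∀ x → Adjacent x (g x)) →
             ∀ v n → Adjacent (alternate f g v n) (alternate f g v (suc n))
      step f g f-adj g-adj v zero    = f-adj v
      step f g f-adj g-adj v (suc n) = step g f g-adj f-adj (f v) n
      forward : ∀ f g → (∀ x → f (f x) ≡ x) → (∀ x → g (g x) ≡ x) → ∀ v → f v ≢ g v →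
                ∀ n → alternate f g v n ≢ alternate f g v (suc (suc n))
      forward f g ff gg v fv≢gv zero    e = fv≢gv (trans (sym (gg (f v))) (cong g (sym e)))
      forward f g ff gg v fv≢gv (suc n) = forward g f gg ff (f v)
        (λ e → fv≢gv (trans (sym (gg (f v))) (cong g (trans e (ff v))))) n

    -- Equal partners yield two edges with the same ends, and these coincide because the graph is
    -- simple.
    perfectMatching-⊆ : ∀ {r s} → PerfectMatching r → PerfectMatching s → r ⊆ s
    perfectMatching-⊆ {r} {s} M M′ {e} e∈r =
      subst (_∈ s) (simple (M′.joins x) join) (M′.edge∈ x)
      where
      module M  = Partner M
      module M′ = Partner M′
      x = src e
      join : Joins e x (M′.partner x)
      join = subst (Joins e x)
        (trans (sym (M.partner-unique e∈r (inj₁ (refl , refl))))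
          (partners-agree M.partner M′.partner M.partner-involutive M′.partner-involutive
            M.adjacent M′.adjacent x))
        (inj₁ (refl , refl))

    perfectMatching-unique : ∀ {r s} → PerfectMatching r → PerfectMatching s → r ≡ s
    perfectMatching-unique M M′ = ⊆-antisym (perfectMatching-⊆ M M′) (perfectMatching-⊆ M′ M)

-- The contraction of `d` and the nilpotent chain map

module _ {A : Set} where

  firstJust : ∀ {n} → Vec (Maybe A) n → Maybe (Fin n)
  firstJust Vec.[]             = nothing
  firstJust (just _  Vec.∷ _)  = just zero
  firstJust (nothing Vec.∷ v)  = Maybe.map suc (firstJust v)

  firstJust≡nothing : ∀ {n} (v : Vec (Maybe A) n) → firstJust v ≡ nothing → v ≡ replicate n nothing
  firstJust≡nothing Vec.[]            _ = refl
  firstJust≡nothing (nothing Vec.∷ v) e with firstJust v in e′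
  ... | nothing = cong (nothing Vec.∷_) (firstJust≡nothing v e′)

  firstJust≡just : ∀ {n} (v : Vec (Maybe A) n) {i} → firstJust v ≡ just i →
                   ∃[ a ] lookup v i ≡ just a
  firstJust≡just (just a  Vec.∷ v) refl = a , refl
  firstJust≡just (nothing Vec.∷ v) e with firstJust v in e′
  firstJust≡just (nothing Vec.∷ v) refl | just i = firstJust≡just v e′

  -- Changing a sign does not move the first marked vertex, so `h` acts at the same vertex before
  -- and after a flip.
  firstJust-≔ : ∀ {n} (v : Vec (Maybe A) n) {i a b} → lookup v i ≡ just a →
                firstJust (v [ i ]≔ just b) ≡ firstJust v
  firstJust-≔ (just _  Vec.∷ v) {zero}  e = refl
  firstJust-≔ (just _  Vec.∷ v) {suc i} e = refl
  firstJust-≔ (nothing Vec.∷ v) {suc i} e = cong (Maybe.map suc) (firstJust-≔ v e)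

  firstJust≢nothing : ∀ {n} (v : Vec (Maybe A) n) {i a} → lookup v i ≡ just a →
                      firstJust v ≢ nothing
  firstJust≢nothing v {i} e p rewrite firstJust≡nothing v p =
    case trans (sym (Vec.lookup-replicate i nothing)) e of λ ()

module _ {A : Set} (_≟_ : DecidableEquality A) where

  coeff-concatMap-⋃ : ∀ {n} (g : Fin n → A → List A) x c →
    coeff _≟_ (concatMap (⋃ _≟_ g) x) c ≡ sum (λ i → coeff _≟_ (concatMap (g i) x) c)
  coeff-concatMap-⋃ g x c = trans (coeff-concatMap _≟_ (⋃ _≟_ g) x c)
    (trans (total-cong-φ _≟_ (λ b → coeff-⋃ _≟_ g b c) x)
    (trans (total-sum _≟_ (λ i b → coeff _≟_ (g i b) c) x)
           (sum-cong-≗ (λ i → sym (coeff-concatMap _≟_ (g i) x c)))))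

  coeff-concatMap-of-⋃ : ∀ {n} (k : A → List A) (g : Fin n → A → List A) a c →
    coeff _≟_ (concatMap k (⋃ _≟_ g a)) c ≡ sum (λ i → coeff _≟_ (concatMap k (g i a)) c)
  coeff-concatMap-of-⋃ k g a c = trans (coeff-concatMap _≟_ k (⋃ _≟_ g a) c)
    (trans (total-⋃ _≟_ (λ b → coeff _≟_ (k b) c) g a)
           (sum-cong-≗ (λ i → sym (coeff-concatMap _≟_ k (g i a) c))))

  agree-on-Span : ∀ {P : A → Set} (f g : LinearMap (Free _≟_) (Free _≟_)) →
    (∀ {a} → P a → f $ (a ∷ []) ≈[ Free _≟_ ] g $ (a ∷ [])) →
    ∀ {x} → Span _≟_ P ∋ x → f $ x ≈[ Free _≟_ ] g $ x
  agree-on-Span {P} f g agree (y , ps , e) =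
    ≈ᴹ-trans (LinearMap.⟦⟧-cong f e) (≈ᴹ-trans (go ps) (≈ᴹ-sym (LinearMap.⟦⟧-cong g e)))
    where
    open LeftModule (Free _≟_)
    go : ∀ {y} → All P y → f $ y ≈ᴹ g $ y
    go []                   = ≈ᴹ-trans (LinearMap.0ᴹ-homo f) (≈ᴹ-sym (LinearMap.0ᴹ-homo g))
    go {a ∷ y} (p ∷ ps) = ≈ᴹ-trans (LinearMap.+ᴹ-homo f (a ∷ []) y)
      (≈ᴹ-trans (+ᴹ-cong (agree p) (go ps)) (≈ᴹ-sym (LinearMap.+ᴹ-homo g (a ∷ []) y)))

module Homotopy (T : Graph) where
  open Graph T
  open Configurations T
  open Coefficients _≟ᶜ_
  open Char2 SC

  Marked : Config → Set
  Marked C = ∃[ v ] firstJust (mark C) ≡ just v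

  marked : ∀ C {v s} → lookup (mark C) v ≡ just s → Marked C
  marked C e with firstJust (mark C) in p
  ... | just v  = v , refl
  ... | nothing = ⊥-elim (firstJust≢nothing (mark C) e p)

  unflip-valid : ∀ {m r y} → (∀ x → ValidAt m r x) → lookup m y ≡ just Sign.- →
                 ∀ x → ValidAt (m [ y ]≔ just Sign.+) r x
  unflip-valid {m} {r} {y} v q x with x Fin.≟ y
  unflip-valid {m} {r} {y} v q x | yes refl with v y
  ... | inj₁ (_ , none) = inj₁ ((_ , lookup-≔ m y) , none)
  ... | inj₂ (q′ , _)   = case trans (sym q) q′ of λ ()
  unflip-valid {m} {r} {y} v q x | no x≢y with v x
  ... | inj₁ ((a , q′) , none) = inj₁ ((a , trans (lookup-≔′ m y x x≢y) q′) , none)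
  ... | inj₂ (q′ , rest)       = inj₂ (trans (lookup-≔′ m y x x≢y) q′ , rest)

  unflip : (C : Config) (x : Vertex) → .(lookup (mark C) x ≡ just Sign.-) → Config
  unflip C x q .mark  = mark C [ x ]≔ just Sign.+
  unflip C x q .red   = red C
  unflip (config m _ v) x q .valid = unflip-valid {m} v q

  unflips : Vertex → Config → List Config
  unflips x C with lookup (mark C) x ≟ᴹ just Sign.-
  ... | yes q = unflip C x q ∷ []
  ... | no  _ = []

  unflips-yes : ∀ x C (q : lookup (mark C) x ≡ just Sign.-) → unflips x C ≡ unflip C x q ∷ []
  unflips-yes x C q with lookup (mark C) x ≟ᴹ just Sign.-
  ... | yes _ = refl
  ... | no ¬q = ⊥-elim (¬q q)

  unflips-no : ∀ x C → lookup (mark C) x ≢ just Sign.- → unflips x C ≡ []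
  unflips-no x C ¬q with lookup (mark C) x ≟ᴹ just Sign.-
  ... | yes q = ⊥-elim (¬q q)
  ... | no  _ = refl

  unflipFirst : Config → List Config
  unflipFirst C = Maybe.maybe′ (λ v → unflips v C) [] (firstJust (mark C))

  h : LinearMap SC SC
  h = extend _≟ᶜ_ unflipFirst

  unflipFirst-just : ∀ C {v} → firstJust (mark C) ≡ just v → unflipFirst C ≡ unflips v C
  unflipFirst-just C e rewrite e = refl

  module _ (C : Config) {v : Vertex} (first : firstJust (mark C) ≡ just v) where

    unflipFirst-flips : ∀ x → concatMap unflipFirst (flips x C) ≡ concatMap (unflips v) (flips x C)
    unflipFirst-flips x with lookup (mark C) x ≟ᴹ just Sign.+
    ... | no  _ = refl
    ... | yes q = cong (_++ [])
          (unflipFirst-just (flip C x q) (trans (firstJust-≔ (mark C) q) first))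

    flips-unflips : ∀ x → x ≢ v →
                    concatMap (flips x) (unflips v C) ≡ concatMap (unflips v) (flips x C)
    flips-unflips x x≢v = go (lookup (mark C) x ≟ᴹ just Sign.+) (lookup (mark C) v ≟ᴹ just Sign.-)
      where
      m = mark C
      go : Dec (lookup m x ≡ just Sign.+) → Dec (lookup m v ≡ just Sign.-) →
           concatMap (flips x) (unflips v C) ≡ concatMap (unflips v) (flips x C)
      go (no ¬p) (no ¬q) rewrite unflips-no v C ¬q | flips-no x C ¬p = refl
      go (no ¬p) (yes q) rewrite unflips-yes v C q | flips-no x C ¬p
        | flips-no x (unflip C v q) (λ e → ¬p (trans (sym (lookup-≔′ m v x x≢v)) e)) = refl
      go (yes p) (no ¬q) rewrite unflips-no v C ¬q | flips-yes x C p
        | unflips-no v (flip C x p) (λ e → ¬q (trans (sym (lookup-≔′ m x v (x≢v ∘ sym))) e)) = refl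
      go (yes p) (yes q) rewrite unflips-yes v C q | flips-yes x C p
        | flips-yes x (unflip C v q) (trans (lookup-≔′ m v x x≢v) p)
        | unflips-yes v (flip C x p) (trans (lookup-≔′ m x v (x≢v ∘ sym)) q) =
        cong (_∷ []) (config-≡ (Vec.[]≔-commutes m v x (x≢v ∘ sym)) refl)

    restore : ∀ {s t} → lookup (mark C) v ≡ just s → mark C [ v ]≔ just t [ v ]≔ just s ≡ mark C
    restore {s} {t} e = trans (Vec.[]≔-idempotent (mark C) v)
      (trans (cong (mark C [ v ]≔_) (sym e)) (Vec.[]≔-lookup (mark C) v))

    flips-unflips-first : concatMap (flips v) (unflips v C) ++ concatMap (unflips v) (flips v C)
                          ≡ C ∷ []
    flips-unflips-first = go (firstJust≡just (mark C) first)
      where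
      go : ∃[ s ] lookup (mark C) v ≡ just s →
           concatMap (flips v) (unflips v C) ++ concatMap (unflips v) (flips v C) ≡ C ∷ []
      go (Sign.+ , e) rewrite flips-yes v C e
        | unflips-no v C (λ q → case trans (sym e) q of λ ())
        | unflips-yes v (flip C v e) (lookup-≔ (mark C) v) =
        cong (_∷ []) (config-≡ (restore e) refl)
      go (Sign.- , e) rewrite unflips-yes v C e
        | flips-no v C (λ q → case trans (sym e) q of λ ())
        | flips-yes v (unflip C v e) (lookup-≔ (mark C) v) =
        cong (_∷ []) (config-≡ (restore e) refl)

    -- Both composites are sums over the flipped vertex `x`. For `x ≢ v` the flip commutes with the
    -- change at `v` and the contributions cancel. For `x = v` the sign of `v` makes exactly one of
    -- them nonzero, and that one restores `C`.
    d-homotopy : ((d $ (h $ (C ∷ []))) +ᴹ (h $ (d $ (C ∷ [])))) ≈ᴹ (C ∷ [])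
    d-homotopy = same-coeff λ c → trans (coeff-++ _≟ᶜ_ (d $ (h $ (C ∷ []))) (h $ (d $ (C ∷ []))) c)
      (trans (cong₂ _xor_ (left c) (right c))
      (trans (sym (∑-distrib-+ (L c) (R c)))
      (trans (sum-delta v (λ x → L c x xor R c x) (others c))
      (trans (sym (coeff-++ _≟ᶜ_ (concatMap (flips v) (unflips v C))
                                 (concatMap (unflips v) (flips v C)) c))
             (cong (λ y → coeff _≟ᶜ_ y c) flips-unflips-first)))))
      where
      L R : Config → Vertex → Bool
      L c x = coeff _≟ᶜ_ (concatMap (flips x) (unflips v C)) c
      R c x = coeff _≟ᶜ_ (concatMap (unflips v) (flips x C)) c
      left : ∀ c → coeff _≟ᶜ_ (d $ (h $ (C ∷ []))) c ≡ sum (L c)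
      left c = trans (coeff-concatMap-⋃ _≟ᶜ_ flips (unflipFirst C ++ []) c)
        (sum-cong-≗ (λ x → cong (λ y → coeff _≟ᶜ_ (concatMap (flips x) y) c)
          (trans (++-identityʳ (unflipFirst C)) (unflipFirst-just C first))))
      right : ∀ c → coeff _≟ᶜ_ (h $ (d $ (C ∷ []))) c ≡ sum (R c)
      right c = trans (cong (λ y → coeff _≟ᶜ_ (concatMap unflipFirst y) c)
          (++-identityʳ (⋃ _≟ᶜ_ flips C)))
        (trans (coeff-concatMap-of-⋃ _≟ᶜ_ unflipFirst flips C c)
          (sum-cong-≗ (λ x → cong (λ y → coeff _≟ᶜ_ y c) (unflipFirst-flips x))))
      others : ∀ c x → x ≢ v → L c x xor R c x ≡ false
      others c x x≢v = trans (cong (λ y → coeff _≟ᶜ_ y c xor R c x) (flips-unflips x x≢v))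
        (Bool.xor-same (R c x))

  breakings-marked : ∀ C → All (λ C′ → Marked C′ × suc (card (red C′)) ≡ card (red C))
                               (⋃ _≟ᶜ_ breakings C)
  breakings-marked C = All.concat⁺ (All.tabulate⁺ one)
    where
    one : ∀ e → All (λ C′ → Marked C′ × suc (card (red C′)) ≡ card (red C)) (breakings e C)
    one e with e ∈? red C
    ... | no  _ = []
    ... | yes p = broken Sign.+ ∷ broken Sign.- ∷ []
      where
      broken : ∀ s → Marked (break C e p s) × suc (card (red (break C e p s))) ≡ card (red C)
      broken s = marked (break C e p s) (breakMark-src (mark C) e s) , card-remove (red C) e p

  flips-marked : ∀ C → All Marked (⋃ _≟ᶜ_ flips C)
  flips-marked C = All.concat⁺ (All.tabulate⁺ one)
    where
    one : ∀ x → All Marked (flips x C)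
    one x with lookup (mark C) x ≟ᴹ just Sign.+
    ... | no  _ = []
    ... | yes q = marked (flip C x q) (lookup-≔ (mark C) x) ∷ []

  unflipFirst-All : ∀ C → All (λ C′ → Marked C′ × red C′ ≡ red C × suc (Q C′) ≡ Q C) (unflipFirst C)
  unflipFirst-All C with firstJust (mark C)
  ... | nothing = []
  ... | just v with lookup (mark C) v ≟ᴹ just Sign.-
  ...   | no  _ = []
  ...   | yes q = (marked (unflip C v q) (lookup-≔ (mark C) v) , refl , Q-unflip) ∷ []
    where
    Q-unflip : suc (Q (unflip C v q)) ≡ Q C
    Q-unflip with count-≔ minus? (mark C) v (just Sign.+)
    ... | e rewrite q = e

  -- The strict inequality makes `W 0` zero, while `W (suc size)` contains all marked chains; so
  -- `suc size` applications of `g` annihilate these.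
  W : ℕ → Subspace SC
  W m = Span _≟ᶜ_ (λ C → Marked C × card (red C) ℕ.< m)

  W∞ : Subspace SC
  W∞ = Span _≟ᶜ_ Marked

  W∞⊆W : ∀ {x} → W∞ ∋ x → W (suc size) ∋ x
  W∞⊆W = Span-mono _≟ᶜ_ (λ {C} m → m , ℕ.s≤s (∣p∣≤n (red C)))

  all-basis : ∀ x → Span _≟ᶜ_ (λ _ → ⊤) ∋ x
  all-basis x = x , All.universal (λ _ → tt) x , ≈ᴹ-refl

  -- Breaking an edge or flipping a sign leaves a mark behind, so this holds even for unmarked `x`.
  ∂-W∞ : ∀ x → W∞ ∋ ∂ $ x
  ∂-W∞ x = Subspace.+-mem W∞
    (extend-Span _≟ᶜ_ _ (λ {C} _ → All.map proj₁ (breakings-marked C)) (all-basis x))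
    (extend-Span _≟ᶜ_ _ (λ {C} _ → flips-marked C) (all-basis x))

  h-W∞ : ∀ x → W∞ ∋ h $ x
  h-W∞ x = extend-Span _≟ᶜ_ _ (λ {C} _ → All.map proj₁ (unflipFirst-All C)) (all-basis x)

  D-W : ∀ {m x} → W (suc m) ∋ x → W m ∋ D $ x
  D-W = extend-Span _≟ᶜ_ _ λ {C} (_ , c<1+m) →
    All.map (λ (mk , e) → mk , subst (ℕ._≤ _) (sym e) (ℕ.s≤s⁻¹ c<1+m)) (breakings-marked C)

  h-W : ∀ {m x} → W m ∋ x → W m ∋ h $ x
  h-W {m} = extend-Span _≟ᶜ_ _ λ {C} (_ , c<m) →
    All.map (λ (mk , e , _) → mk , subst (λ r → card r ℕ.< m) (sym e) c<m) (unflipFirst-All C)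

  h-SC : ∀ {k x} → SC^ k ∋ x → SC^ (k ℤ.- 1ℤ) ∋ h $ x
  h-SC = extend-Span _≟ᶜ_ _ λ {C} e → All.map
    (λ {C′} (_ , _ , q) → trans (sym ([p+a]-a (+ Q C′) 1ℤ))
      (cong (ℤ._- 1ℤ) (trans (ℤ.+-comm (+ Q C′) 1ℤ) (trans (cong +_ q) e))))
    (unflipFirst-All C)

  ∂-SC : ∀ {k x} → SC^ (k ℤ.- 1ℤ) ∋ x → SC^ k ∋ ∂ $ x
  ∂-SC {k} {x} m = subst (λ k → SC^ k ∋ ∂ $ x) ([p-a]+a k 1ℤ)
    (Subspace.+-mem (SC^ (k ℤ.- 1ℤ ℤ.+ 1ℤ)) (D-SC^ m) (d-SC^ m))

  private
    module ∂ = LinearMap ∂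
    module h = LinearMap h

  -- g is chain homotopic to the identity, and it lowers the number of red edges
  -- on marked configurations because h contracts d there.

  g : LinearMap SC SC
  g = idMap SC ⊕ ((∂ ∘ₗ h) ⊕ (h ∘ₗ ∂))

  g′ : LinearMap SC SC
  g′ = (D ∘ₗ h) ⊕ (h ∘ₗ D)

  g≈g′ : ∀ {x} → W∞ ∋ x → g $ x ≈ᴹ g′ $ x
  g≈g′ = agree-on-Span _≟ᶜ_ g g′ λ {C} (v , first) → let c = C ∷ [] in
    ≈ᴹ-trans (+ᴹ-cong {c} {c} ≈ᴹ-refl (≈ᴹ-trans
      (+ᴹ-cong {∂ $ (h $ c)} {∂ $ (h $ c)} ≈ᴹ-refl (h.+ᴹ-homo (D $ c) (d $ c)))
      (interchange (D $ (h $ c)) (d $ (h $ c)) (h $ (D $ c)) (h $ (d $ c)))))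
    (≈ᴹ-trans (+ᴹ-comm c _) (≈ᴹ-trans (+ᴹ-assoc (g′ $ c) _ c)
      (x+0≈x {g′ $ c} (x≈y⇒x+y≈0 (d-homotopy C first)))))

  g-W : ∀ {m x} → W (suc m) ∋ x → W m ∋ g $ x
  g-W {m} w = Subspace.resp (W m) (≈ᴹ-sym (g≈g′ (Span-mono _≟ᶜ_ proj₁ w)))
    (Subspace.+-mem (W m) (D-W (h-W w)) (h-W (D-W w)))

  g-∂ : ∀ x → ∂ $ (g $ x) ≈ᴹ g $ (∂ $ x)
  g-∂ x = ≈ᴹ-trans (∂.+ᴹ-homo x ((∂ $ (h $ x)) ++ (h $ (∂ $ x))))
    (+ᴹ-cong {∂ $ x} {∂ $ x} ≈ᴹ-refl (≈ᴹ-trans (∂.+ᴹ-homo (∂ $ (h $ x)) (h $ (∂ $ x)))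
      (≈ᴹ-trans (0+x≈x (∂²≈0 (h $ x)))
        (≈ᴹ-sym (x+0≈x (≈ᴹ-trans (h.⟦⟧-cong (∂²≈0 x)) h.0ᴹ-homo))))))

  g-SC : ∀ {k x} → SC^ k ∋ x → SC^ k ∋ g $ x
  g-SC {k} {x} m = Subspace.+-mem (SC^ k) m (Subspace.+-mem (SC^ k) (∂-SC (h-SC m))
    (subst (λ l → SC^ l ∋ h $ (∂ $ x)) ([p+a]-a k 1ℤ)
      (h-SC (Subspace.+-mem (SC^ (k ℤ.+ 1ℤ)) (D-SC^ m) (d-SC^ m)))))

  g-cocycle : ∀ {x} → ∂ $ x ≈ᴹ [] → g $ x ≈ᴹ (x +ᴹ (∂ $ (h $ x)))
  g-cocycle {x} e = +ᴹ-cong {x} {x} ≈ᴹ-refl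
    (x+0≈x (≈ᴹ-trans (h.⟦⟧-cong e) h.0ᴹ-homo))

  g^ : ℕ → LinearMap SC SC
  g^ zero    = idMap SC
  g^ (suc n) = g^ n ∘ₗ g

  g^-W : ∀ n {x} → W n ∋ x → g^ n $ x ≈ᴹ []
  g^-W zero    w = Span-∅ (λ { C (_ , ()) }) w
  g^-W (suc n) w = g^-W n (g-W w)

  g^-∂ : ∀ n x → ∂ $ (g^ n $ x) ≈ᴹ g^ n $ (∂ $ x)
  g^-∂ zero    x = ≈ᴹ-refl
  g^-∂ (suc n) x = ≈ᴹ-trans (g^-∂ n (g $ x)) (LinearMap.⟦⟧-cong (g^ n) (g-∂ x))

  g^-SC : ∀ n {k x} → SC^ k ∋ x → SC^ k ∋ g^ n $ x
  g^-SC zero    m = m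
  g^-SC (suc n) m = g^-SC n (g-SC m)

  -- `g` differs from the identity by values of `∂` and `h`, which are all marked. Its powers
  -- therefore preserve the coefficients of unmarked configurations.
  g^-W∞ : ∀ n x → W∞ ∋ ((g^ n $ x) +ᴹ x)
  g^-W∞ zero    x = Subspace.resp W∞ {[]} (≈ᴹ-sym (char2 SC x)) (Subspace.0-mem W∞)
  g^-W∞ (suc n) x = Subspace.resp W∞ eq (Subspace.+-mem W∞ (g^-W∞ n (g $ x)) w)
    where
    y = (∂ $ (h $ x)) +ᴹ (h $ (∂ $ x))
    w : W∞ ∋ y
    w = Subspace.+-mem W∞ (∂-W∞ (h $ x)) (h-W∞ (∂ $ x))
    eq : (((g^ n $ (g $ x)) +ᴹ (g $ x)) +ᴹ y) ≈ᴹ ((g^ n $ (g $ x)) +ᴹ x)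
    eq = ≈ᴹ-trans (+ᴹ-assoc (g^ n $ (g $ x)) (g $ x) y)
      (+ᴹ-cong {g^ n $ (g $ x)} ≈ᴹ-refl (x+y+y≈x x y))

  g^-cocycle : ∀ n {k x} → SC^ k ∋ x → ∂ $ x ≈ᴹ [] →
               ∃[ y ] (SC^ (k ℤ.- 1ℤ) ∋ y × g^ n $ x ≈ᴹ (x +ᴹ (∂ $ y)))
  g^-cocycle zero    {k} {x} m e = [] , Subspace.0-mem (SC^ (k ℤ.- 1ℤ)) , ≈ᴹ-sym (+ᴹ-identityʳ x)
  g^-cocycle (suc n) {k} {x} m e = extend-by (g^-cocycle n (g-SC m)
    (≈ᴹ-trans (g-∂ x) (≈ᴹ-trans (LinearMap.⟦⟧-cong g e) (LinearMap.0ᴹ-homo g))))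
    where
    extend-by : ∃[ y ] (SC^ (k ℤ.- 1ℤ) ∋ y × g^ n $ (g $ x) ≈ᴹ ((g $ x) +ᴹ (∂ $ y))) →
                ∃[ y ] (SC^ (k ℤ.- 1ℤ) ∋ y × g^ n $ (g $ x) ≈ᴹ (x +ᴹ (∂ $ y)))
    extend-by (y , my , e′) = (h $ x) +ᴹ y , Subspace.+-mem (SC^ (k ℤ.- 1ℤ)) (h-SC m) my ,
      ≈ᴹ-trans e′ (≈ᴹ-trans
        (+ᴹ-cong {g $ x} {x +ᴹ (∂ $ (h $ x))} {∂ $ y} (g-cocycle {x} e) ≈ᴹ-refl)
        (≈ᴹ-trans (+ᴹ-assoc x (∂ $ (h $ x)) (∂ $ y))
          (+ᴹ-cong {x} {x} ≈ᴹ-refl (≈ᴹ-sym (∂.+ᴹ-homo (h $ x) y)))))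

-- Total cohomology and the dimension of the limit page

module _ (V : Vect) where
  open LeftModule V

  dimension-0 : (∀ x → x ≈ᴹ 0ᴹ) → HasDimension V 0
  dimension-0 z = record
    { basis       = λ ()
    ; spanning    = λ x → (λ ()) , z x
    ; independent = λ _ _ () }

  dimension-1 : ∀ b → ¬ (b ≈ᴹ 0ᴹ) → (∀ x → x ≈ᴹ 0ᴹ ⊎ x ≈ᴹ b) → HasDimension V 1
  dimension-1 b b≉0 span = record
    { basis       = λ _ → b
    ; spanning    = λ x → spanning x (span x)
    ; independent = λ { c e zero →
        independent (c zero) (≈ᴹ-trans (≈ᴹ-sym (+ᴹ-identityʳ _)) e) } }
    where
    spanning : ∀ x → x ≈ᴹ 0ᴹ ⊎ x ≈ᴹ b → ∃[ c ] x ≈ᴹ combination V {1} c (λ _ → b)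
    spanning x (inj₁ e) = (λ _ → false) ,
      ≈ᴹ-trans e (≈ᴹ-sym (≈ᴹ-trans (+ᴹ-identityʳ _) (*ₗ-zeroˡ b)))
    spanning x (inj₂ e) = (λ _ → true) ,
      ≈ᴹ-trans e (≈ᴹ-sym (≈ᴹ-trans (+ᴹ-identityʳ _) (*ₗ-identityˡ b)))
    independent : ∀ c → (c *ₗ b) ≈ᴹ 0ᴹ → c ≡ false
    independent false _ = refl
    independent true  e = ⊥-elim (b≉0 (≈ᴹ-trans (≈ᴹ-sym (*ₗ-identityˡ b)) e))

-- Only the terms listed in `x` can have a nonzero coefficient, so finitely many checks suffice.
Span? : {A : Set} (_≟_ : DecidableEquality A) {P : A → Set} → (∀ a → Dec (P a)) →
        ∀ x → Dec (Span _≟_ P ∋ x)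
Span? _≟_ {P} P? x = map′
  (λ h → coeff-Span⁺ λ {a} c → All.lookup h (coeff⇒∈ x a c) c)
  (λ m → All.tabulate λ {a} _ → coeff-Span⁻ m {a})
  (All.all? (λ a → (coeff _≟_ x a Bool.≟ true) →-dec P? a) x)
  where open Coefficients _≟_

last : {P : ℕ → Set} → (∀ n → Dec (P n)) → P 0 → ∀ n → ¬ P n → ∃[ m ] (P m × ¬ P (suc m))
last P? p zero    ¬p = ⊥-elim (¬p p)
last P? p (suc n) ¬p with P? n
... | yes q = n , q , ¬p
... | no ¬q = last P? p n ¬q

module TotalCohomology (T : Graph) where
  open Graph T
  open Configurations T
  open Coefficients _≟ᶜ_
  open PerfectMatchings T
  open Homotopy T
  open Char2 SC
  open SeifertSum T using (N; E≤N)
  private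
    co = coeff _≟ᶜ_

  F-top : ∀ {p k x} → + N ℤ.< p → F p k ∋ x → x ≈ᴹ []
  F-top N<p = Span-∅ λ C (_ , p≤E) → ℤ.<⇒≱ N<p (ℤ.≤-trans p≤E (ℤ.+≤+ (E≤N C)))

  F-bot : ∀ {p k x} → p ℤ.≤ 0ℤ → SC^ k ∋ x → F p k ∋ x
  F-bot p≤0 = Span-mono _≟ᶜ_ (λ e → e , ℤ.≤-trans p≤0 (ℤ.+≤+ ℕ.z≤n))

  converges : Converges
  converges = FilteredComplexProperties.Bounded.converges SC-filtered N F-top F-bot

  F? : ∀ p k x → Dec (F p k ∋ x)
  F? p k = Span? _≟ᶜ_ (λ C → (+ Q C ℤ.≟ k) ×-dec (p ℤ.≤? + E C))

  Unmarked : Config → Set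
  Unmarked C = firstJust (mark C) ≡ nothing

  marked⊎unmarked : ∀ C → Marked C ⊎ Unmarked C
  marked⊎unmarked C with firstJust (mark C)
  ... | just v  = inj₁ (v , refl)
  ... | nothing = inj₂ refl

  unmarked⇒matching : ∀ C → Unmarked C → PerfectMatching (red C)
  unmarked⇒matching C@(config m r v) u = recompute (perfectMatching? r) (λ x → at-vertex (v x))
    where
    at-vertex : ∀ {x} → ValidAt m r x → ∃! _≡_ (λ e → e ∈ r × IsEndOf x e)
    at-vertex {x} (inj₂ (_ , p)) = p
    at-vertex {x} (inj₁ ((s , e) , _)) = ⊥-elim (firstJust≢nothing m e u)

  matching⇒unmarked : ∀ r → PerfectMatching r → Σ[ C ∈ Config ] Unmarked C
  matching⇒unmarked r M = config (replicate order nothing) r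
    (λ x → inj₂ (Vec.lookup-replicate x nothing , M x)) , blank order
    where
    blank : ∀ n → firstJust (replicate n (nothing {A = Sign})) ≡ nothing
    blank zero    = refl
    blank (suc n) = cong (Maybe.map suc) (blank n)

  -- The power `g^ (suc size)` changes a cocycle by a boundary and sends a marked one to zero.
  exact : ∀ {k z} → W∞ ∋ z → SC^ k ∋ z → ∂ $ z ≈ᴹ [] → ∃[ y ] (SC^ (k ℤ.- 1ℤ) ∋ y × z ≈ᴹ ∂ $ y)
  exact {k} {z} w m e = shrink (g^-cocycle (suc size) m e)
    where
    shrink : ∃[ y ] (SC^ (k ℤ.- 1ℤ) ∋ y × g^ (suc size) $ z ≈ᴹ (z +ᴹ (∂ $ y))) →
             ∃[ y ] (SC^ (k ℤ.- 1ℤ) ∋ y × z ≈ᴹ ∂ $ y)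
    shrink (y , my , e′) = y , my ,
      x+y≈0⇒x≈y (≈ᴹ-trans (≈ᴹ-sym e′) (g^-W (suc size) (W∞⊆W w)))

  boundary⇒0 : ∀ {p k} (ξ : Carrier (E∞ p k)) y → SC^ (k ℤ.- 1ℤ) ∋ y → proj₁ ξ ≈ᴹ ∂ $ y →
               ξ ≈[ E∞ p k ] LeftModule.0ᴹ (E∞ p k)
  boundary⇒0 {p} {k} ξ@(z , m , _) y my e = ~0⁺ {x = ξ}
    ([] , z , Subspace.0-mem (F (p ℤ.+ 1ℤ) k ∩ kernel ∂) , (m , y , my , e) , ≈ᴹ-refl)

  deeper⇒0 : ∀ {p k} (ξ : Carrier (E∞ p k)) → F (p ℤ.+ 1ℤ) k ∋ proj₁ ξ →
             ξ ≈[ E∞ p k ] LeftModule.0ᴹ (E∞ p k)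
  deeper⇒0 {p} {k} ξ@(z , _ , e) m = ~0⁺ {x = ξ}
    (z , [] , (m , e) , Subspace.0-mem (F p k ∩ image ∂ (SC^ (k ℤ.- 1ℤ))) , ≈ᴹ-sym (+ᴹ-identityʳ z))

  acyclic⇒0 : (∀ C → ¬ Unmarked C) → HasDimension page∞ 0
  acyclic⇒0 none = dimension-0 page∞ λ ξ → pointwise λ (p , k) → zeros (component ξ (p , k))
    where
    zeros : ∀ {p k} (ξ : Carrier (E∞ p k)) → ξ ≈[ E∞ p k ] LeftModule.0ᴹ (E∞ p k)
    zeros {p} {k} ξ@(z , m , e) =
      let (y , my , q) = exact {k} {z} all-marked (Span-mono _≟ᶜ_ proj₁ m) e
      in boundary⇒0 ξ y my q
      where
      all-marked : W∞ ∋ z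
      all-marked = coeff-Span⁺ λ {C} _ → case marked⊎unmarked C of λ where
        (inj₁ m) → m
        (inj₂ u) → ⊥-elim (none C u)

  -- `Q` is never negative. Consequently degree 0 has no nonzero boundaries, and cohomologous
  -- cocycles there are equal.
  SC^-1 : ∀ {y} → SC^ (0ℤ ℤ.- 1ℤ) ∋ y → y ≈ᴹ []
  SC^-1 = Span-∅ λ { C () }

  ∂SC^-1 : ∀ {y} → SC^ (0ℤ ℤ.- 1ℤ) ∋ y → ∂ $ y ≈ᴹ []
  ∂SC^-1 my = ≈ᴹ-trans (LinearMap.⟦⟧-cong ∂ (SC^-1 my)) (LinearMap.0ᴹ-homo ∂)

  module OneClass (x₀ : Carrier SC) (∂x₀≈0 : ∂ $ x₀ ≈ᴹ [])
    (degree-0 : ∀ {z} → SC^ 0ℤ ∋ z → ∂ $ z ≈ᴹ [] → z ≈ᴹ [] ⊎ z ≈ᴹ x₀)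
    (other-degrees : ∀ {k z} → k ≢ 0ℤ → SC^ k ∋ z → ∂ $ z ≈ᴹ [] →
                     ∃[ y ] (SC^ (k ℤ.- 1ℤ) ∋ y × z ≈ᴹ ∂ $ y))
    (p₀ : ℤ) (x₀∈F : F p₀ 0ℤ ∋ x₀) (x₀∉F′ : ¬ (F (p₀ ℤ.+ 1ℤ) 0ℤ ∋ x₀))
    where

    x₀∉F : ∀ {p} → p₀ ℤ.< p → ¬ (F p 0ℤ ∋ x₀)
    x₀∉F {p} p₀<p m = x₀∉F′
      (Span-mono _≟ᶜ_ (λ (q , p≤E) → q ,
        ℤ.≤-trans (subst (ℤ._≤ p) (ℤ.+-comm 1ℤ p₀) (ℤ.i<j⇒suc[i]≤j p₀<p)) p≤E) m)

    class : Carrier (E∞ p₀ 0ℤ)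
    class = x₀ , x₀∈F , ∂x₀≈0

    zero-class : ∀ {p k} (ξ : Carrier (E∞ p k)) → proj₁ ξ ≈ᴹ [] →
                 ξ ≈[ E∞ p k ] LeftModule.0ᴹ (E∞ p k)
    zero-class {p} {k} ξ e = deeper⇒0 ξ
      (Subspace.resp (F (p ℤ.+ 1ℤ) k) (≈ᴹ-sym e) (Subspace.0-mem (F (p ℤ.+ 1ℤ) k)))

    -- As boundaries in degree 0 are zero, a vanishing class would put `x₀` itself into
    -- `F (p₀ + 1)`.
    class≉0 : ¬ (class ≈[ E∞ p₀ 0ℤ ] LeftModule.0ᴹ (E∞ p₀ 0ℤ))
    class≉0 e = absurd (~0⁻ {x = class} e)
      where
      absurd : ¬ (((F (p₀ ℤ.+ 1ℤ) 0ℤ ∩ kernel ∂) ⊞ (F p₀ 0ℤ ∩ image ∂ (SC^ (0ℤ ℤ.- 1ℤ)))) ∋ x₀)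
      absurd (s , b , (ms , _) , (_ , y , my , q) , e′) = x₀∉F (n<n+1 p₀)
        (Subspace.resp (F (p₀ ℤ.+ 1ℤ) 0ℤ)
          (≈ᴹ-sym (≈ᴹ-trans e′ (x+0≈x (≈ᴹ-trans q (∂SC^-1 my))))) ms)
        where open SeifertCohomology T using (n<n+1)

    at-class : (ξ : Carrier (E∞ p₀ 0ℤ)) →
               ξ ≈[ E∞ p₀ 0ℤ ] LeftModule.0ᴹ (E∞ p₀ 0ℤ) ⊎ ξ ≈[ E∞ p₀ 0ℤ ] class
    at-class ξ@(z , m , e) = cases (degree-0 {z} (Span-mono _≟ᶜ_ proj₁ m) e)
      where
      cases : z ≈ᴹ [] ⊎ z ≈ᴹ x₀ →
              ξ ≈[ E∞ p₀ 0ℤ ] LeftModule.0ᴹ (E∞ p₀ 0ℤ) ⊎ ξ ≈[ E∞ p₀ 0ℤ ] class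
      cases (inj₁ z≈0)  = inj₁ (zero-class ξ z≈0)
      cases (inj₂ z≈x₀) = inj₂ (≈⇒~ SC (F p₀ 0ℤ ∩ kernel ∂)
        ((F (p₀ ℤ.+ 1ℤ) 0ℤ ∩ kernel ∂) ⊞ (F p₀ 0ℤ ∩ image ∂ (SC^ (0ℤ ℤ.- 1ℤ)))) z≈x₀)

    -- In degree 0 only `x₀` has to be placed: for `p < p₀` it already lies in `F (p + 1)` and dies
    -- in the quotient, and for `p > p₀` it is not in `F p` at all.
    elsewhere : ∀ p k (ξ : Carrier (E∞ p k)) → (p₀ , 0ℤ) ≢ (p , k) →
                ξ ≈[ E∞ p k ] LeftModule.0ᴹ (E∞ p k)
    elsewhere p k ξ@(z , m , e) distinct = cases (k ℤ.≟ 0ℤ)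
      where
      in-degree-0 : ∀ p (ξ : Carrier (E∞ p 0ℤ)) → p₀ ≢ p → ξ ≈[ E∞ p 0ℤ ] LeftModule.0ᴹ (E∞ p 0ℤ)
      in-degree-0 p ξ@(z , m , e) p₀≢p =
        split (degree-0 {z} (Span-mono _≟ᶜ_ proj₁ m) e) (ℤ.<-cmp p p₀)
        where
        split : z ≈ᴹ [] ⊎ z ≈ᴹ x₀ → _ → ξ ≈[ E∞ p 0ℤ ] LeftModule.0ᴹ (E∞ p 0ℤ)
        split (inj₁ z≈0)  _ = zero-class ξ z≈0
        split (inj₂ z≈x₀) (tri< p<p₀ _ _) = deeper⇒0 ξ
          (Subspace.resp (F (p ℤ.+ 1ℤ) 0ℤ) (≈ᴹ-sym z≈x₀) (Span-mono _≟ᶜ_ (λ {C} (q , p₀≤E) → q ,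
            ℤ.≤-trans (subst (ℤ._≤ p₀) (ℤ.+-comm 1ℤ p) (ℤ.i<j⇒suc[i]≤j p<p₀)) p₀≤E) x₀∈F))
        split (inj₂ z≈x₀) (tri≈ _ p≡p₀ _) = ⊥-elim (p₀≢p (sym p≡p₀))
        split (inj₂ z≈x₀) (tri> _ _ p₀<p) = ⊥-elim (x₀∉F p₀<p (Subspace.resp (F p 0ℤ) z≈x₀ m))
      cases : Dec (k ≡ 0ℤ) → ξ ≈[ E∞ p k ] LeftModule.0ᴹ (E∞ p k)
      cases (yes refl) = in-degree-0 p ξ (λ p₀≡p → distinct (cong (_, 0ℤ) p₀≡p))
      cases (no k≢0) = let (y , my , q) = other-degrees k≢0 (Span-mono _≟ᶜ_ proj₁ m) e in
        boundary⇒0 ξ y my q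

    one-dimensional : HasDimension page∞ 1
    one-dimensional = dimension-1 page∞ (ι ℤ²-≟ (p₀ , 0ℤ) class)
      (λ e → class≉0 (LeftModule.≈ᴹ-trans (E∞ p₀ 0ℤ)
        (LeftModule.≈ᴹ-reflexive (E∞ p₀ 0ℤ)
          (sym (ι-same ℤ²-≟ {λ ((p , k) : ℤ × ℤ) → E∞ p k} (p₀ , 0ℤ))))
        (at-index e (p₀ , 0ℤ))))
      (λ ξ → spanned ξ (at-class (component ξ (p₀ , 0ℤ))))
      where
      others : (ξ : Carrier page∞) → ∀ j → (p₀ , 0ℤ) ≢ j →
        component ξ j ≈[ E∞ (proj₁ j) (proj₂ j) ] LeftModule.0ᴹ (E∞ (proj₁ j) (proj₂ j))
      others ξ (p , k) distinct = elsewhere p k (component ξ (p , k)) distinct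
      spanned : (ξ : Carrier page∞) →
        component ξ (p₀ , 0ℤ) ≈[ E∞ p₀ 0ℤ ] LeftModule.0ᴹ (E∞ p₀ 0ℤ) ⊎
        component ξ (p₀ , 0ℤ) ≈[ E∞ p₀ 0ℤ ] class →
        ξ ≈[ page∞ ] LeftModule.0ᴹ page∞ ⊎ ξ ≈[ page∞ ] ι ℤ²-≟ (p₀ , 0ℤ) class
      spanned ξ (inj₁ e) = inj₁ (pointwise λ (p , k) → zeros p k (ℤ²-≟ (p₀ , 0ℤ) (p , k)))
        where
        zeros : ∀ p k → Dec ((p₀ , 0ℤ) ≡ (p , k)) →
                component ξ (p , k) ≈[ E∞ p k ] LeftModule.0ᴹ (E∞ p k)
        zeros p k (yes refl)     = e
        zeros p k (no distinct) = elsewhere p k (component ξ (p , k)) distinct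
      spanned ξ (inj₂ e) = inj₂ (ι-unique ℤ²-≟ (p₀ , 0ℤ) ξ e (others ξ))

  module OneUnmarked (P : Config) (blank : Unmarked P) (only : ∀ C → Unmarked C → C ≡ P) where

    P∉W∞ : ¬ Marked P
    P∉W∞ (v , e) = case trans (sym e) blank of λ ()

    W∞⇒coeff≡false : ∀ {x} → W∞ ∋ x → co x P ≡ false
    W∞⇒coeff≡false w = ≢true⇒≡false (λ c → P∉W∞ (coeff-Span⁻ w c))

    coeff≡false⇒W∞ : ∀ {x} → co x P ≡ false → W∞ ∋ x
    coeff≡false⇒W∞ {x} e = coeff-Span⁺ λ {C} c → case marked⊎unmarked C of λ where
      (inj₁ m) → m
      (inj₂ u) → case trans (sym c) (trans (cong (co x) (only C u)) e) of λ ()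

    P∈SC⁰ : SC^ 0ℤ ∋ (P ∷ [])
    P∈SC⁰ = P ∷ [] , cong +_ Q≡0 ∷ [] , ≈ᴹ-refl
      where
      count-blank : ∀ n → Vec.count minus? (replicate n nothing) ≡ 0
      count-blank zero    = refl
      count-blank (suc n) = count-blank n
      Q≡0 : Q P ≡ 0
      Q≡0 = trans (cong (Vec.count minus?) (firstJust≡nothing (mark P) blank)) (count-blank order)

    -- Since `∂ P` is marked, this power of `g` kills it; as `g` commutes with `∂`, the result is a
    -- cocycle. It still has coefficient 1 at `P`.
    x₀ : Carrier SC
    x₀ = g^ (suc size) $ (P ∷ [])

    x₀-coeff : co x₀ P ≡ true
    x₀-coeff = trans (xor≡false (trans (sym (coeff-++ _≟ᶜ_ x₀ (P ∷ []) P))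
        (W∞⇒coeff≡false (g^-W∞ (suc size) (P ∷ [])))))
      (trans (Bool.xor-identityʳ _) (dec-true (P ≟ᶜ P) refl))

    x₀∈SC⁰ : SC^ 0ℤ ∋ x₀
    x₀∈SC⁰ = g^-SC (suc size) P∈SC⁰

    ∂x₀≈0 : ∂ $ x₀ ≈ᴹ []
    ∂x₀≈0 = ≈ᴹ-trans (g^-∂ (suc size) (P ∷ [])) (g^-W (suc size) (W∞⊆W (∂-W∞ (P ∷ []))))

    x₀≉0 : ¬ (x₀ ≈ᴹ [])
    x₀≉0 e = case trans (sym x₀-coeff) (coeff-≡ e P) of λ ()

    -- The coefficient at `P` decides. If it is 0, then `z` is marked, hence a boundary, hence zero;
    -- if it is 1, the same applies to `z + x₀`.
    cocycle-degree-0 : ∀ {z} → SC^ 0ℤ ∋ z → ∂ $ z ≈ᴹ [] → z ≈ᴹ [] ⊎ z ≈ᴹ x₀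
    cocycle-degree-0 {z} m e = cases (co z P) refl
      where
      vanish : ∀ {z} → SC^ 0ℤ ∋ z → ∂ $ z ≈ᴹ [] → co z P ≡ false → z ≈ᴹ []
      vanish {z} m e c = let (y , my , q) = exact (coeff≡false⇒W∞ {z} c) m e in
        ≈ᴹ-trans q (∂SC^-1 my)
      cases : ∀ b → co z P ≡ b → z ≈ᴹ [] ⊎ z ≈ᴹ x₀
      cases false c = inj₁ (vanish m e c)
      cases true  c = inj₂ (x+y≈0⇒x≈y (vanish {z +ᴹ x₀} (Subspace.+-mem (SC^ 0ℤ) m x₀∈SC⁰)
        (≈ᴹ-trans (LinearMap.+ᴹ-homo ∂ z x₀) (≈ᴹ-trans (x+0≈x ∂x₀≈0) e))
        (trans (coeff-++ _≟ᶜ_ z x₀ P) (cong₂ _xor_ c x₀-coeff))))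

    cocycle-other-degrees : ∀ {k z} → k ≢ 0ℤ → SC^ k ∋ z → ∂ $ z ≈ᴹ [] →
                            ∃[ y ] (SC^ (k ℤ.- 1ℤ) ∋ y × z ≈ᴹ ∂ $ y)
    cocycle-other-degrees k≢0 m = exact (coeff≡false⇒W∞ (≢true⇒≡false λ c → k≢0
      (trans (sym (coeff-Span⁻ m c)) (coeff-Span⁻ P∈SC⁰
        (trans (Bool.xor-identityʳ _) (dec-true (P ≟ᶜ P) refl)))))) m

    -- The class of x₀ lives in E∞ at the least value of E occurring in x₀.

    depth : ∃[ p ] (F (+ p) 0ℤ ∋ x₀ × ¬ (F (+ suc p) 0ℤ ∋ x₀))
    depth = last (λ p → F? (+ p) 0ℤ x₀) (F-bot ℤ.≤-refl x₀∈SC⁰) (suc N)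
      (λ m → x₀≉0 (F-top (ℤ.+<+ (ℕ.n<1+n N)) m))

    dimension : HasDimension page∞ 1
    dimension = generate depth
      where
      generate : ∃[ p ] (F (+ p) 0ℤ ∋ x₀ × ¬ (F (+ suc p) 0ℤ ∋ x₀)) → HasDimension page∞ 1
      generate (p , m , m′) = OneClass.one-dimensional
        x₀ ∂x₀≈0 cocycle-degree-0 cocycle-other-degrees (+ p) m
        (m′ ∘ subst (λ q → F q 0ℤ ∋ x₀) (ℤ.+-comm (+ p) 1ℤ))

  page∞-dimension : IsTree T → HasDimension page∞ 0 ⊎ HasDimension page∞ 1
  page∞-dimension tree = cases (anySubset? perfectMatching?)
    where
    cases : Dec (∃[ r ] PerfectMatching r) → HasDimension page∞ 0 ⊎ HasDimension page∞ 1
    cases (no none) = inj₁ (acyclic⇒0 (λ C u → none (red C , unmarked⇒matching C u)))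
    cases (yes (r , M)) = let (P , blank) = matching⇒unmarked r M in
      inj₂ (OneUnmarked.dimension P blank λ C u → config-≡
        (trans (firstJust≡nothing (mark C) u) (sym (firstJust≡nothing (mark P) blank)))
        (perfectMatching-unique tree (unmarked⇒matching C u) (unmarked⇒matching P blank)))

theorem1 :
  (T : Graph) → IsTree T →
  let open Configurations T in
    IsSpectralSequence
  × (∀ p k → IsIso SH^[ k , p ] (Eʳ 1 p k) (leading p k))
  × (Σ[ φ ∈ LinearMap ⨁SH^[,] SH ]
       IsIso ⨁SH^[,] SH (φ $_)
     × (∀ n k x → φ $ ι ℤ²-≟ (n , k) x ≈[ SH ] ι _≟_ k (forget n k $ x)))
  × (Σ[ ψ ∈ LinearMap (page 1) SH ]
       IsIso (page 1) SH (ψ $_)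
     × (∀ p k x → ψ $ at 1 p k (leading p k x) ≈[ SH ] ι _≟_ k (forget p k $ x))
     × (∀ ξ → ψ $ (dʳ 1 $ ξ) ≈[ SH ] SH-d $ (ψ $ ξ)))
  × (∀ n → 2 ℕ.≤ n → HasBidegree (dʳ n) (+ n , 1ℤ))
  × Converges
  × (HasDimension page∞ 0 ⊎ HasDimension page∞ 1)
theorem1 T tree =
    isSpectralSequence
  , leading-iso
  , (Sum.φ , Sum.φ-iso , Sum.φ-ι)
  , (Page.ψ , Page.ψ-iso , ψ-leading , ψ-d)
  , (λ n _ → d-bidegree n)
  , converges
  , page∞-dimension tree
  where
  open Configurations T
  open FilteredComplexProperties SC-filtered using (isSpectralSequence; d-bidegree)
  open SeifertCohomology T using (leading-iso)
  open SeifertSum T using (module Sum; module Page; ψ-leading; ψ-d)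
  open TotalCohomology T using (converges; page∞-dimension)
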